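{- Let $q\in\mathbb{C}$ with $|q|<1$. Then $$\sum_{n=0}^{\infty}\frac{q^{2n^2}(q;q^2)_{n}}{(-q;q^2)_{n}(q^4;q^4)_{n}} =\frac{(q^3;q^6)_{\infty}^{2}(q^6;q^6)_{\infty}}{(q^2;q^2)_{\infty}}.$$
   Context: For $|q|<1$, $x\in\mathbb{C}$ and an integer $n\ge 0$: $(x;q)_n=\prod_{j=0}^{n-1}(1-xq^j)$ (so $(x;q)_0=1$) and $(x;q)_\infty=\prod_{j=0}^{\infty}(1-xq^j)$. The same notation is used with base $q^m$ in place of $q$. -}

module Defs where

open import Algebra.Bundles.Raw using (RawRing)
import Algebra.Definitions.RawSemiring as RawSemiringDefs
open import Data.Fin.Base using (toℕ)
open import Data.Nat.Base as ℕ using (ℕ)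
import Data.Nat.Properties as ℕ
open import Data.Product.Base using (∃-syntax; _×_; _,_; proj₁; proj₂)
open import Data.Rational.Base as ℚ using (ℚ; 0ℚ; 1ℚ; ∣_∣)
import Data.Rational.Properties as ℚ
open import Data.Rational.Solver using (module +-*-Solver)
open import Level using (0ℓ)
open import Relation.Binary.PropositionalEquality
open import Relation.Nullary.Decidable.Core using (yes; no)
open import Relation.Nullary.Negation.Core using (contradiction)

------------------------------------------------------------------------
-- Rational estimates

-- Extended by recip 0 = 0, as the library's 1/_ needs a NonZero instance.
recip : ℚ → ℚ
recip p with p ℚ.≟ 0ℚ
... | yes _  = 0ℚ
... | no p≢0 = (ℚ.1/ p) {{ℚ.≢-nonZero p≢0}}

recip-inverse : ∀ p → p ≢ 0ℚ → p ℚ.* recip p ≡ 1ℚ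
recip-inverse p p≢0 with p ℚ.≟ 0ℚ
... | yes p≡0 = contradiction p≡0 p≢0
... | no  p≢0 = ℚ.*-inverseʳ p {{ℚ.≢-nonZero p≢0}}

recip-pos : ∀ {p} → 0ℚ ℚ.< p → 0ℚ ℚ.< recip p
recip-pos {p} 0<p with p ℚ.≟ 0ℚ
... | yes p≡0 = contradiction (sym p≡0) (ℚ.<⇒≢ 0<p)
... | no  p≢0 =
  ℚ.positive⁻¹ _ {{ℚ.1/pos⇒pos p {{ℚ.positive 0<p}}}}

*-pos : ∀ {p q} → 0ℚ ℚ.< p → 0ℚ ℚ.< q → 0ℚ ℚ.< p ℚ.* q
*-pos {p} {q} 0<p 0<q = subst (ℚ._< p ℚ.* q) (ℚ.*-zeroʳ p)
  (ℚ.*-monoʳ-<-pos p {{ℚ.positive 0<p}} 0<q)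

*-mono-≤ : ∀ {a b c d} → 0ℚ ℚ.≤ b → 0ℚ ℚ.≤ c →
           a ℚ.≤ c → b ℚ.≤ d → a ℚ.* b ℚ.≤ c ℚ.* d
*-mono-≤ {a} {b} {c} {d} 0≤b 0≤c a≤c b≤d = ℚ.≤-trans
  (ℚ.*-monoʳ-≤-nonNeg b {{ℚ.nonNegative 0≤b}} a≤c)
  (ℚ.*-monoˡ-≤-nonNeg c {{ℚ.nonNegative 0≤c}} b≤d)

half : ℚ → ℚ
half ε = ε ℚ.* ℚ.½

half-pos : ∀ {ε} → 0ℚ ℚ.< ε → 0ℚ ℚ.< half ε
half-pos 0<ε = *-pos 0<ε (ℚ.positive⁻¹ ℚ.½)

half+half : ∀ ε → half ε ℚ.+ half ε ≡ ε
half+half ε = trans (sym (ℚ.*-distribˡ-+ ε ℚ.½ ℚ.½)) (ℚ.*-identityʳ ε)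

∣+∣-split : ∀ p q ε → ∣ p ∣ ℚ.< half ε → ∣ q ∣ ℚ.< half ε → ∣ p ℚ.+ q ∣ ℚ.< ε
∣+∣-split p q ε p< q< = begin-strict
  ∣ p ℚ.+ q ∣          ≤⟨ ℚ.∣p+q∣≤∣p∣+∣q∣ p q ⟩
  ∣ p ∣ ℚ.+ ∣ q ∣      <⟨ ℚ.+-mono-< p< q< ⟩
  half ε ℚ.+ half ε    ≡⟨ half+half ε ⟩
  ε                    ∎
  where open ℚ.≤-Reasoning

scale : ∀ p d B ε → 0ℚ ℚ.< B → ∣ p ∣ ℚ.≤ B →
        ∣ d ∣ ℚ.< ε ℚ.* recip B → ∣ p ℚ.* d ∣ ℚ.< ε
scale p d B ε 0<B p≤B d< = begin-strict
  ∣ p ℚ.* d ∣            ≡⟨ ℚ.∣p*q∣≡∣p∣*∣q∣ p d ⟩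
  ∣ p ∣ ℚ.* ∣ d ∣        ≤⟨ ℚ.*-monoʳ-≤-nonNeg ∣ d ∣ {{ℚ.∣-∣-nonNeg d}} p≤B ⟩
  B ℚ.* ∣ d ∣            <⟨ ℚ.*-monoʳ-<-pos B {{ℚ.positive 0<B}} d< ⟩
  B ℚ.* (ε ℚ.* recip B)  ≡⟨ regroup B ε (recip B) ⟩
  ε ℚ.* (B ℚ.* recip B)  ≡⟨ cong (ε ℚ.*_) (recip-inverse B (≢-sym (ℚ.<⇒≢ 0<B))) ⟩
  ε ℚ.* 1ℚ               ≡⟨ ℚ.*-identityʳ ε ⟩
  ε                      ∎
  where
  open ℚ.≤-Reasoning
  regroup : ∀ a b c → a ℚ.* (b ℚ.* c) ≡ b ℚ.* (a ℚ.* c)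
  regroup = solve 3 (λ a b c → a :* (b :* c) := b :* (a :* c)) refl
    where open +-*-Solver

+-diff : ∀ a b c d ε → ∣ a ℚ.- c ∣ ℚ.< half ε → ∣ b ℚ.- d ∣ ℚ.< half ε →
         ∣ (a ℚ.+ b) ℚ.- (c ℚ.+ d) ∣ ℚ.< ε
+-diff a b c d ε ac bd = subst (λ e → ∣ e ∣ ℚ.< ε) (sym (regroup a b c d))
  (∣+∣-split (a ℚ.- c) (b ℚ.- d) ε ac bd)
  where
  regroup : ∀ a b c d → (a ℚ.+ b) ℚ.- (c ℚ.+ d) ≡ (a ℚ.- c) ℚ.+ (b ℚ.- d)
  regroup = solve 4 (λ a b c d →
    (a :+ b) :- (c :+ d) := (a :- c) :+ (b :- d)) refl
    where open +-*-Solver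

*-diff : ∀ a b c d A B ε → 0ℚ ℚ.< A → 0ℚ ℚ.< B → ∣ a ∣ ℚ.≤ A → ∣ d ∣ ℚ.≤ B →
         ∣ a ℚ.- c ∣ ℚ.< half ε ℚ.* recip B → ∣ b ℚ.- d ∣ ℚ.< half ε ℚ.* recip A →
         ∣ a ℚ.* b ℚ.- c ℚ.* d ∣ ℚ.< ε
*-diff a b c d A B ε 0<A 0<B a≤A d≤B ac bd =
  subst (λ e → ∣ e ∣ ℚ.< ε) (sym (regroup a b c d))
    (∣+∣-split (a ℚ.* (b ℚ.- d)) (d ℚ.* (a ℚ.- c)) ε
      (scale a (b ℚ.- d) A (half ε) 0<A a≤A bd)
      (scale d (a ℚ.- c) B (half ε) 0<B d≤B ac))
  where
  regroup : ∀ a b c d →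
    a ℚ.* b ℚ.- c ℚ.* d ≡ a ℚ.* (b ℚ.- d) ℚ.+ d ℚ.* (a ℚ.- c)
  regroup = solve 4 (λ a b c d →
    a :* b :- c :* d := a :* (b :- d) :+ d :* (a :- c)) refl
    where open +-*-Solver

------------------------------------------------------------------------
-- Real numbers: Cauchy sequences of rationals

IsCauchy : (ℕ → ℚ) → Set
IsCauchy s = ∀ ε → 0ℚ ℚ.< ε →
  ∃[ N ] ∀ m n → N ℕ.≤ m → N ℕ.≤ n → ∣ s m ℚ.- s n ∣ ℚ.< ε

record ℝ : Set where
  constructor mkℝ
  field
    seq    : ℕ → ℚ
    cauchy : IsCauchy seq

open ℝ public

infix  4 _≈ℝ_ _<ℝ_
infixl 6 _+ℝ_ _-ℝ_
infixl 7 _*ℝ_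
infix  8 -ℝ_

_≈ℝ_ : ℝ → ℝ → Set
x ≈ℝ y = ∀ ε → 0ℚ ℚ.< ε →
  ∃[ N ] ∀ n → N ℕ.≤ n → ∣ seq x n ℚ.- seq y n ∣ ℚ.< ε

_<ℝ_ : ℝ → ℝ → Set
x <ℝ y = ∃[ ε ] 0ℚ ℚ.< ε ×
  ∃[ N ] (∀ n → N ℕ.≤ n → seq x n ℚ.+ ε ℚ.≤ seq y n)

fromℚ : ℚ → ℝ
fromℚ p = mkℝ (λ _ → p) λ ε 0<ε →
  0 , λ _ _ _ _ → subst (λ d → ∣ d ∣ ℚ.< ε) (sym (ℚ.+-inverseʳ p)) 0<ε

0ℝ 1ℝ : ℝ
0ℝ = fromℚ 0ℚ
1ℝ = fromℚ 1ℚ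

_+ℝ_ : ℝ → ℝ → ℝ
x +ℝ y = mkℝ s s-cauchy
  where
  s : ℕ → ℚ
  s n = seq x n ℚ.+ seq y n

  s-cauchy : IsCauchy s
  s-cauchy ε 0<ε =
    let M , xM = cauchy x (half ε) (half-pos 0<ε)
        N , yN = cauchy y (half ε) (half-pos 0<ε)
    in M ℕ.⊔ N , λ m n ≤m ≤n →
    +-diff (seq x m) (seq y m) (seq x n) (seq y n) ε
      (xM m n (ℕ.m⊔n≤o⇒m≤o M N ≤m) (ℕ.m⊔n≤o⇒m≤o M N ≤n))
      (yN m n (ℕ.m⊔n≤o⇒n≤o M N ≤m) (ℕ.m⊔n≤o⇒n≤o M N ≤n))

-ℝ_ : ℝ → ℝ
-ℝ x = mkℝ s s-cauchy
  where
  s : ℕ → ℚ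
  s n = ℚ.- seq x n

  regroup : ∀ a b → ℚ.- a ℚ.- ℚ.- b ≡ ℚ.- (a ℚ.- b)
  regroup = solve 2 (λ a b → :- a :- (:- b) := :- (a :- b)) refl
    where open +-*-Solver

  s-cauchy : IsCauchy s
  s-cauchy ε 0<ε = let N , xN = cauchy x ε 0<ε in N , λ m n ≤m ≤n → subst (ℚ._< ε)
    (sym (trans (cong ∣_∣ (regroup (seq x m) (seq x n)))
                (ℚ.∣-p∣≡∣p∣ (seq x m ℚ.- seq x n))))
    (xN m n ≤m ≤n)

_-ℝ_ : ℝ → ℝ → ℝ
x -ℝ y = x +ℝ (-ℝ y)

eventually-bounded : ∀ x → ∃[ B ] 0ℚ ℚ.< B ×
  ∃[ N ] (∀ n → N ℕ.≤ n → ∣ seq x n ∣ ℚ.≤ B)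
eventually-bounded x with cauchy x 1ℚ (ℚ.positive⁻¹ 1ℚ)
... | N , xN = 1ℚ ℚ.+ a , 0<B , N , bound
  where
  a : ℚ
  a = ∣ seq x N ∣

  0<B : 0ℚ ℚ.< 1ℚ ℚ.+ a
  0<B = ℚ.+-mono-<-≤ (ℚ.positive⁻¹ 1ℚ) (ℚ.0≤∣p∣ (seq x N))

  regroup : ∀ p r → p ≡ (p ℚ.- r) ℚ.+ r
  regroup = solve 2 (λ p r → p := (p :- r) :+ r) refl
    where open +-*-Solver

  bound : ∀ n → N ℕ.≤ n → ∣ seq x n ∣ ℚ.≤ 1ℚ ℚ.+ a
  bound n N≤n = ℚ.≤-trans
    (subst (λ d → ∣ d ∣ ℚ.≤ ∣ seq x n ℚ.- seq x N ∣ ℚ.+ a)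
      (sym (regroup (seq x n) (seq x N)))
      (ℚ.∣p+q∣≤∣p∣+∣q∣ (seq x n ℚ.- seq x N) (seq x N)))
    (ℚ.+-monoˡ-≤ a (ℚ.<⇒≤ (xN n N N≤n ℕ.≤-refl)))

_*ℝ_ : ℝ → ℝ → ℝ
x *ℝ y = mkℝ s s-cauchy
  where
  s : ℕ → ℚ
  s n = seq x n ℚ.* seq y n

  s-cauchy : IsCauchy s
  s-cauchy ε 0<ε =
    let A , 0<A , K , xK = eventually-bounded x
        B , 0<B , L , yL = eventually-bounded y
        M , xM = cauchy x (half ε ℚ.* recip B) (*-pos (half-pos 0<ε) (recip-pos 0<B))
        N , yN = cauchy y (half ε ℚ.* recip A) (*-pos (half-pos 0<ε) (recip-pos 0<A))
    in (K ℕ.⊔ L) ℕ.⊔ (M ℕ.⊔ N) , λ m n ≤m ≤n →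
    let KL≤m = ℕ.m⊔n≤o⇒m≤o (K ℕ.⊔ L) (M ℕ.⊔ N) ≤m
        KL≤n = ℕ.m⊔n≤o⇒m≤o (K ℕ.⊔ L) (M ℕ.⊔ N) ≤n
        MN≤m = ℕ.m⊔n≤o⇒n≤o (K ℕ.⊔ L) (M ℕ.⊔ N) ≤m
        MN≤n = ℕ.m⊔n≤o⇒n≤o (K ℕ.⊔ L) (M ℕ.⊔ N) ≤n
    in *-diff (seq x m) (seq y m) (seq x n) (seq y n) A B ε 0<A 0<B
      (xK m (ℕ.m⊔n≤o⇒m≤o K L KL≤m))
      (yL n (ℕ.m⊔n≤o⇒n≤o K L KL≤n))
      (xM m n (ℕ.m⊔n≤o⇒m≤o M N MN≤m) (ℕ.m⊔n≤o⇒m≤o M N MN≤n))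
      (yN m n (ℕ.m⊔n≤o⇒n≤o M N MN≤m) (ℕ.m⊔n≤o⇒n≤o M N MN≤n))

-- Only positive reals are inverted: complex division needs no more.
recipℝ : (x : ℝ) → 0ℝ <ℝ x → ℝ
recipℝ x (δ , 0<δ , K , δ≤x) = mkℝ s s-cauchy
  where
  s : ℕ → ℚ
  s n = recip (seq x n)

  B : ℚ
  B = recip δ ℚ.* recip δ

  δ≤ : ∀ n → K ℕ.≤ n → δ ℚ.≤ seq x n
  δ≤ n K≤n = subst (ℚ._≤ seq x n) (ℚ.+-identityˡ δ) (δ≤x n K≤n)

  0<x : ∀ n → K ℕ.≤ n → 0ℚ ℚ.< seq x n
  0<x n K≤n = ℚ.<-≤-trans 0<δ (δ≤ n K≤n)

  x*s≡1 : ∀ n → K ℕ.≤ n → seq x n ℚ.* s n ≡ 1ℚ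
  x*s≡1 n K≤n = recip-inverse (seq x n) (≢-sym (ℚ.<⇒≢ (0<x n K≤n)))

  0≤s : ∀ n → K ℕ.≤ n → 0ℚ ℚ.≤ s n
  0≤s n K≤n = ℚ.<⇒≤ (recip-pos (0<x n K≤n))

  s≤ : ∀ n → K ℕ.≤ n → s n ℚ.≤ recip δ
  s≤ n K≤n = begin
    s n                              ≡⟨ ℚ.*-identityʳ (s n) ⟨
    s n ℚ.* 1ℚ                       ≡⟨ cong (s n ℚ.*_) (recip-inverse δ (≢-sym (ℚ.<⇒≢ 0<δ))) ⟨
    s n ℚ.* (δ ℚ.* recip δ)          ≤⟨ ℚ.*-monoˡ-≤-nonNeg (s n) {{ℚ.nonNegative (0≤s n K≤n)}}
                                          (ℚ.*-monoʳ-≤-nonNeg (recip δ)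
                                            {{ℚ.nonNegative (ℚ.<⇒≤ (recip-pos 0<δ))}} (δ≤ n K≤n)) ⟩
    s n ℚ.* (seq x n ℚ.* recip δ)    ≡⟨ regroup (s n) (seq x n) (recip δ) ⟩
    (seq x n ℚ.* s n) ℚ.* recip δ    ≡⟨ cong (ℚ._* recip δ) (x*s≡1 n K≤n) ⟩
    1ℚ ℚ.* recip δ                   ≡⟨ ℚ.*-identityˡ (recip δ) ⟩
    recip δ                          ∎
    where
    open ℚ.≤-Reasoning
    regroup : ∀ a b c → a ℚ.* (b ℚ.* c) ≡ (b ℚ.* a) ℚ.* c
    regroup = solve 3 (λ a b c → a :* (b :* c) := (b :* a) :* c) refl
      where open +-*-Solver

  s*s≤B : ∀ m n → K ℕ.≤ m → K ℕ.≤ n → ∣ s m ℚ.* s n ∣ ℚ.≤ B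
  s*s≤B m n K≤m K≤n = subst (ℚ._≤ B)
    (sym (trans (ℚ.∣p*q∣≡∣p∣*∣q∣ (s m) (s n))
                (cong₂ ℚ._*_ (ℚ.0≤p⇒∣p∣≡p (0≤s m K≤m)) (ℚ.0≤p⇒∣p∣≡p (0≤s n K≤n)))))
    (*-mono-≤ (0≤s n K≤n) (ℚ.<⇒≤ (recip-pos 0<δ)) (s≤ m K≤m) (s≤ n K≤n))

  difference : ∀ m n → K ℕ.≤ m → K ℕ.≤ n →
    s m ℚ.- s n ≡ (s m ℚ.* s n) ℚ.* (seq x n ℚ.- seq x m)
  difference m n K≤m K≤n = begin
    s m ℚ.- s n
      ≡⟨ cong₂ ℚ._-_ (ℚ.*-identityʳ (s m)) (ℚ.*-identityʳ (s n)) ⟨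
    s m ℚ.* 1ℚ ℚ.- s n ℚ.* 1ℚ
      ≡⟨ cong₂ (λ a b → s m ℚ.* a ℚ.- s n ℚ.* b) (x*s≡1 n K≤n) (x*s≡1 m K≤m) ⟨
    s m ℚ.* (seq x n ℚ.* s n) ℚ.- s n ℚ.* (seq x m ℚ.* s m)
      ≡⟨ regroup (s m) (s n) (seq x m) (seq x n) ⟩
    (s m ℚ.* s n) ℚ.* (seq x n ℚ.- seq x m)
      ∎
    where
    open ≡-Reasoning
    regroup : ∀ a b c d →
      a ℚ.* (d ℚ.* b) ℚ.- b ℚ.* (c ℚ.* a) ≡ (a ℚ.* b) ℚ.* (d ℚ.- c)
    regroup = solve 4 (λ a b c d →
      a :* (d :* b) :- b :* (c :* a) := (a :* b) :* (d :- c)) refl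
      where open +-*-Solver

  0<B : 0ℚ ℚ.< B
  0<B = *-pos (recip-pos 0<δ) (recip-pos 0<δ)

  s-cauchy : IsCauchy s
  s-cauchy ε 0<ε =
    let N , xN = cauchy x (ε ℚ.* recip B) (*-pos 0<ε (recip-pos 0<B))
    in K ℕ.⊔ N , λ m n ≤m ≤n →
    let K≤m = ℕ.m⊔n≤o⇒m≤o K N ≤m
        K≤n = ℕ.m⊔n≤o⇒m≤o K N ≤n
    in subst (λ d → ∣ d ∣ ℚ.< ε) (sym (difference m n K≤m K≤n))
      (scale (s m ℚ.* s n) (seq x n ℚ.- seq x m) B ε 0<B (s*s≤B m n K≤m K≤n)
        (xN n m (ℕ.m⊔n≤o⇒n≤o K N ≤n) (ℕ.m⊔n≤o⇒n≤o K N ≤m)))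

------------------------------------------------------------------------
-- Complex numbers

infix 5 _+i_

record ℂ : Set where
  constructor _+i_
  field
    re im : ℝ

open ℂ public

infix  4 _≈_
infixl 6 _+_ _-_
infixl 7 _*_ _/_[_]
infix  8 -_

_≈_ : ℂ → ℂ → Set
z ≈ w = re z ≈ℝ re w × im z ≈ℝ im w

0ℂ 1ℂ : ℂ
0ℂ = 0ℝ +i 0ℝ
1ℂ = 1ℝ +i 0ℝ

_+_ : ℂ → ℂ → ℂ
z + w = (re z +ℝ re w) +i (im z +ℝ im w)

-_ : ℂ → ℂ
-_ z = (-ℝ re z) +i (-ℝ im z)

_-_ : ℂ → ℂ → ℂ
z - w = z + (- w)

_*_ : ℂ → ℂ → ℂ
z * w = (re z *ℝ re w -ℝ im z *ℝ im w) +i (re z *ℝ im w +ℝ im z *ℝ re w)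

ℂ-rawRing : RawRing 0ℓ 0ℓ
ℂ-rawRing = record
  { Carrier = ℂ
  ; _≈_ = _≈_
  ; _+_ = _+_
  ; _*_ = _*_
  ; -_  = -_
  ; 0#  = 0ℂ
  ; 1#  = 1ℂ
  }

open RawSemiringDefs (RawRing.rawSemiring ℂ-rawRing) public
  using (_^_; sum; product)

normSq : ℂ → ℝ
normSq z = re z *ℝ re z +ℝ im z *ℝ im z

-- |z| < r, squared so as to avoid the square root; meant for r > 0.
∣_∣<_ : ℂ → ℚ → Set
∣ z ∣< r = normSq z <ℝ fromℚ (r ℚ.* r)

-- z ≠ 0 in the positive form (apartness) that division requires.
_#0 : ℂ → Set
z #0 = 0ℝ <ℝ normSq z

infix 4 ∣_∣<_ _#0 _⟶_ _sumsTo_ [_⨾_]∞≈_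

_/_[_] : (z w : ℂ) → w #0 → ℂ
z / w [ w#0 ] = z * ((re w *ℝ r) +i ((-ℝ im w) *ℝ r))
  where
  r : ℝ
  r = recipℝ (normSq w) w#0

------------------------------------------------------------------------
-- Limits, series and q-Pochhammer symbols

_⟶_ : (ℕ → ℂ) → ℂ → Set
s ⟶ l = ∀ ε → 0ℚ ℚ.< ε → ∃[ N ] ∀ n → N ℕ.≤ n → ∣ s n - l ∣< ε

_sumsTo_ : (ℕ → ℂ) → ℂ → Set
t sumsTo l = (λ N → sum {N} (λ n → t (toℕ n))) ⟶ l

[_⨾_] : ℂ → ℂ → ℕ → ℂ
[ x ⨾ q ] n = product {n} (λ j → 1ℂ - x * q ^ toℕ j)

-- The infinite product converges to P.
[_⨾_]∞≈_ : ℂ → ℂ → ℂ → Set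
[ x ⨾ q ]∞≈ P = [ x ⨾ q ] ⟶ P

{-# OPTIONS --safe #-}
module Submission where

-- With Q = q² the summand is Q^(n²) βₙ, where βₙ = (q;Q)ₙ² / (Q;Q)₂ₙ because
-- (Q;Q)₂ₙ = (q;Q)ₙ (-q;Q)ₙ (q⁴;q⁴)ₙ.  The finite Jacobi triple product gives
-- βₙ = ∑ᵣ (-1)ʳ q^(r²) / ((Q;Q)ₙ₋ᵣ (Q;Q)ₙ₊ᵣ) over ∣r∣ ≤ n, and by the q-Vandermonde sum
-- ∑ₙ Q^(n²) / ((Q;Q)ₙ₋ᵣ (Q;Q)ₙ₊ᵣ) = Q^(r²) / (Q;Q)∞ (Bailey's lemma), so that the series
-- times (Q;Q)∞ is ∑ᵣ (-1)ʳ q^(3r²).  The triple product in base q³ evaluates this theta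
-- series as (q³;q⁶)∞² (q⁶;q⁶)∞.  The interchange of limits is justified by comparing finite
-- sums, all errors being O(ρⁿ) for a rational ρ < 1 that bounds ∣q∣.

-- The reals are constructive here: a limit needs a rate, and a quotient needs a rational lower
-- bound for its divisor. Hence the algebra is done on finite sums, over any commutative ring with
-- given inverses of 1 - Qⁿ⁺¹. One observation leads from finite to infinite: (Q;Q)ₐ₊ₖ / (Q;Q)ₐ is 1
-- + O(ρᵃ) uniformly in k. Multiplying a finite identity by suitable (Q;Q)ₙ turns unwanted
-- denominators into such quotients, and the decay of Q^(m²) or q^(3r²) pays for the terms in which
-- a is small. The q-Vandermonde limit is used with a shift 2r that varies inside a sum, so its rate
-- must be uniform in the shift. The other obstacle is the norm. The modulus needs square roots,
-- while the ℓ¹ norm is not multiplicative, and ∥q∥ may exceed 1 although ∣q∣ < 1. Powers of q are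
-- therefore bounded through ∣z∣², which is multiplicative, and only the result is converted, at the
-- cost of a constant factor.

open import Algebra.Bundles using (CommutativeRing; RawRing; Semiring)
import Algebra.Definitions.RawSemiring as RawSemiringDefinitions
import Algebra.Properties.AbelianGroup as AbelianGroupProperties
import Algebra.Properties.CommutativeSemigroup as CommutativeSemigroupProperties
import Algebra.Properties.CommutativeSemiring.Exp as Exponentiation
import Algebra.Properties.Ring as RingProperties
import Algebra.Properties.Semiring.Mult.TCOptimised as SemiringMultiples
import Algebra.Solver.Ring as RingSolver
open import Algebra.Solver.Ring.AlmostCommutativeRing
  using (_-Raw-AlmostCommutative⟶_; fromCommutativeRing)
open import Algebra.Structures using (IsCommutativeRing)
open import Data.Fin.Base using (toℕ)
open import Data.Integer.Base as ℤ using (ℤ)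
import Data.Integer.Properties as ℤ
open import Data.Maybe.Base using (Maybe; just; nothing)
open import Data.Nat.Base as ℕ using (ℕ; zero; suc)
import Data.Nat.Coprimality as Coprimality
import Data.Nat.Properties as ℕ
open import Data.Nat.Tactic.RingSolver using (solve-∀)
open import Data.Product.Base using (Σ-syntax; ∃-syntax; _×_; _,_; proj₁; proj₂)
open import Data.Rational.Base as ℚ using (ℚ; 0ℚ; 1ℚ; ∣_∣)
import Data.Rational.Properties as ℚ
open import Data.Rational.Solver using (module +-*-Solver)
open import Data.Sum.Base using (inj₁; inj₂)
open import Level using (_⊔_; 0ℓ) renaming (suc to lsuc)
import Relation.Binary.Reasoning.Setoid as SetoidReasoning
open import Relation.Binary.PropositionalEquality as ≡ using (_≡_)
open import Relation.Binary.Structures using (IsEquivalence)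
open import Relation.Nullary.Decidable.Core using (yes; no)
open import Defs using (recip; recip-inverse; recip-pos; *-pos)

-- Commutative rings: solver, finite sums and products

-- The solvers of the library either lack negation or need a ring with decidable
-- equality; here the coefficients are formal differences of natural numbers.
module IntegerSolver {c ℓ} (R : CommutativeRing c ℓ) where

  open CommutativeRing R
  open AbelianGroupProperties +-abelianGroup using (⁻¹-∙-comm; ⁻¹-involutive)
  open RingProperties ring using (-‿distribˡ-*; -‿distribʳ-*)
  open CommutativeSemigroupProperties +-commutativeSemigroup using (interchange)
  open SemiringMultiples semiring using (×-homo-+; ×1-homo-*; 1+×) renaming (_×_ to _×ᴿ_)
  open SetoidReasoning setoid

  private
    -- Common successors are cancelled, and nothing is subtracted when the second component is zero,
    -- so that `0 , 0` and `1 , 0` evaluate to `0#` and `1#` on the nose. Equations obtained from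
    -- `solve` then match goals written with these constants.
    ⟦_⟧ᶜ : ℕ × ℕ → Carrier
    ⟦ m     , zero  ⟧ᶜ = m ×ᴿ 1#
    ⟦ zero  , suc n ⟧ᶜ = - (suc n ×ᴿ 1#)
    ⟦ suc m , suc n ⟧ᶜ = ⟦ m , n ⟧ᶜ

    x-0≈x : ∀ x → x - 0# ≈ x
    x-0≈x x = begin
      x - 0#         ≈⟨ +-congʳ (+-identityʳ x) ⟨
      (x + 0#) - 0#  ≈⟨ +-assoc x 0# (- 0#) ⟩
      x + (0# - 0#)  ≈⟨ +-congˡ (-‿inverseʳ 0#) ⟩
      x + 0#         ≈⟨ +-identityʳ x ⟩
      x              ∎

    differences : RawRing _ _
    differences = record
      { Carrier = ℕ × ℕ
      ; _≈_ = _≡_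
      ; _+_ = λ (a , b) (c , d) → a ℕ.+ c , b ℕ.+ d
      ; _*_ = λ (a , b) (c , d) → a ℕ.* c ℕ.+ b ℕ.* d , a ℕ.* d ℕ.+ b ℕ.* c
      ; -_  = λ (a , b) → b , a
      ; 0#  = 0 , 0
      ; 1#  = 1 , 0
      }

    [w+x]-[y+z]≈[w-y]+[x-z] : ∀ w x y z → (w + x) - (y + z) ≈ (w - y) + (x - z)
    [w+x]-[y+z]≈[w-y]+[x-z] w x y z = begin
      (w + x) - (y + z)      ≈⟨ +-congˡ (⁻¹-∙-comm y z) ⟨
      (w + x) + (- y - z)    ≈⟨ interchange w x (- y) (- z) ⟩
      (w - y) + (x - z)      ∎

    [w-x]*[y-z]≈[wy+xz]-[wz+xy] : ∀ w x y z →
      (w - x) * (y - z) ≈ (w * y + x * z) - (w * z + x * y)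
    [w-x]*[y-z]≈[wy+xz]-[wz+xy] w x y z = begin
      (w - x) * (y - z)
        ≈⟨ distribʳ (y - z) w (- x) ⟩
      w * (y - z) + - x * (y - z)
        ≈⟨ +-cong (distribˡ w y (- z)) (distribˡ (- x) y (- z)) ⟩
      (w * y + w * - z) + (- x * y + - x * - z)
        ≈⟨ +-cong (+-congˡ (sym (-‿distribʳ-* w z)))
                  (+-cong (sym (-‿distribˡ-* x y)) (-x*-z≈x*z)) ⟩
      (w * y - w * z) + (- (x * y) + x * z)
        ≈⟨ +-congˡ (+-comm _ _) ⟩
      (w * y - w * z) + (x * z - x * y)
        ≈⟨ [w+x]-[y+z]≈[w-y]+[x-z] (w * y) (x * z) (w * z) (x * y) ⟨
      (w * y + x * z) - (w * z + x * y)
        ∎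
      where
      -x*-z≈x*z : - x * - z ≈ x * z
      -x*-z≈x*z = begin
        - x * - z      ≈⟨ -‿distribˡ-* x (- z) ⟨
        - (x * - z)    ≈⟨ -‿cong (-‿distribʳ-* x z) ⟨
        - (- (x * z))  ≈⟨ ⁻¹-involutive (x * z) ⟩
        x * z          ∎

    ⟦⟧ᶜ-def : ∀ m n → ⟦ m , n ⟧ᶜ ≈ (m ×ᴿ 1#) - (n ×ᴿ 1#)
    ⟦⟧ᶜ-def zero    zero    = sym (x-0≈x 0#)
    ⟦⟧ᶜ-def (suc m) zero    = sym (x-0≈x (suc m ×ᴿ 1#))
    ⟦⟧ᶜ-def zero    (suc n) = sym (+-identityˡ _)
    ⟦⟧ᶜ-def (suc m) (suc n) = begin
      ⟦ m , n ⟧ᶜ                                  ≈⟨ ⟦⟧ᶜ-def m n ⟩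
      (m ×ᴿ 1#) - (n ×ᴿ 1#)                       ≈⟨ +-identityˡ _ ⟨
      0# + ((m ×ᴿ 1#) - (n ×ᴿ 1#))                ≈⟨ +-congʳ (-‿inverseʳ 1#) ⟨
      (1# - 1#) + ((m ×ᴿ 1#) - (n ×ᴿ 1#))         ≈⟨ [w+x]-[y+z]≈[w-y]+[x-z] 1# _ 1# _ ⟨
      (1# + (m ×ᴿ 1#)) - (1# + (n ×ᴿ 1#))         ≈⟨ +-cong (1+× m 1#) (-‿cong (1+× n 1#)) ⟨
      (suc m ×ᴿ 1#) - (suc n ×ᴿ 1#)               ∎

    ⟦⟧-homomorphism : differences -Raw-AlmostCommutative⟶ fromCommutativeRing R
    ⟦⟧-homomorphism = record
      { ⟦_⟧    = ⟦_⟧ᶜ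
      ; +-homo = λ (a , b) (c , d) → begin
          ⟦ a ℕ.+ c , b ℕ.+ d ⟧ᶜ
            ≈⟨ ⟦⟧ᶜ-def (a ℕ.+ c) (b ℕ.+ d) ⟩
          ((a ℕ.+ c) ×ᴿ 1#) - ((b ℕ.+ d) ×ᴿ 1#)
            ≈⟨ +-cong (×-homo-+ 1# a c) (-‿cong (×-homo-+ 1# b d)) ⟩
          ((a ×ᴿ 1#) + (c ×ᴿ 1#)) - ((b ×ᴿ 1#) + (d ×ᴿ 1#))
            ≈⟨ [w+x]-[y+z]≈[w-y]+[x-z] _ _ _ _ ⟩
          ((a ×ᴿ 1#) - (b ×ᴿ 1#)) + ((c ×ᴿ 1#) - (d ×ᴿ 1#))
            ≈⟨ +-cong (⟦⟧ᶜ-def a b) (⟦⟧ᶜ-def c d) ⟨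
          ⟦ a , b ⟧ᶜ + ⟦ c , d ⟧ᶜ
            ∎
      ; *-homo = λ (a , b) (c , d) → begin
          ⟦ a ℕ.* c ℕ.+ b ℕ.* d , a ℕ.* d ℕ.+ b ℕ.* c ⟧ᶜ
            ≈⟨ ⟦⟧ᶜ-def (a ℕ.* c ℕ.+ b ℕ.* d) (a ℕ.* d ℕ.+ b ℕ.* c) ⟩
          ((a ℕ.* c ℕ.+ b ℕ.* d) ×ᴿ 1#) - ((a ℕ.* d ℕ.+ b ℕ.* c) ×ᴿ 1#)
            ≈⟨ +-cong (×1-homo-+* a c b d) (-‿cong (×1-homo-+* a d b c)) ⟩
          _ ≈⟨ [w-x]*[y-z]≈[wy+xz]-[wz+xy] _ _ _ _ ⟨
          ((a ×ᴿ 1#) - (b ×ᴿ 1#)) * ((c ×ᴿ 1#) - (d ×ᴿ 1#))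
            ≈⟨ *-cong (⟦⟧ᶜ-def a b) (⟦⟧ᶜ-def c d) ⟨
          ⟦ a , b ⟧ᶜ * ⟦ c , d ⟧ᶜ
            ∎
      ; -‿homo = λ (a , b) → begin
          ⟦ b , a ⟧ᶜ                     ≈⟨ ⟦⟧ᶜ-def b a ⟩
          (b ×ᴿ 1#) - (a ×ᴿ 1#)          ≈⟨ +-comm _ _ ⟩
          - (a ×ᴿ 1#) + (b ×ᴿ 1#)        ≈⟨ +-congˡ (⁻¹-involutive _) ⟨
          - (a ×ᴿ 1#) - - (b ×ᴿ 1#)      ≈⟨ ⁻¹-∙-comm _ _ ⟩
          - ((a ×ᴿ 1#) - (b ×ᴿ 1#))      ≈⟨ -‿cong (⟦⟧ᶜ-def a b) ⟨
          - ⟦ a , b ⟧ᶜ                   ∎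
      ; 0-homo = refl
      ; 1-homo = refl
      }
      where
      ×1-homo-+* : ∀ a b c d → (a ℕ.* b ℕ.+ c ℕ.* d) ×ᴿ 1# ≈
                   (a ×ᴿ 1#) * (b ×ᴿ 1#) + (c ×ᴿ 1#) * (d ×ᴿ 1#)
      ×1-homo-+* a b c d = trans (×-homo-+ 1# (a ℕ.* b) (c ℕ.* d))
        (+-cong (×1-homo-* a b) (×1-homo-* c d))

    -- Pairs are compared as integers, by a + d = c + b, and not componentwise: normalisation
    -- produces coefficients such as `1 , 1`, which must be recognised as zero.
    ⟦⟧≟ : ∀ x y → Maybe (⟦ x ⟧ᶜ ≈ ⟦ y ⟧ᶜ)
    ⟦⟧≟ (a , b) (c , d) with a ℕ.+ d ℕ.≟ c ℕ.+ b
    ... | no  _  = nothing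
    ... | yes eq = just (begin
      ⟦ a , b ⟧ᶜ             ≈⟨ ⟦⟧ᶜ-def a b ⟩
      A - B                  ≈⟨ +-identityʳ _ ⟨
      (A - B) + 0#           ≈⟨ +-congˡ (-‿inverseʳ D) ⟨
      (A - B) + (D - D)      ≈⟨ [w+x]-[y+z]≈[w-y]+[x-z] A D B D ⟨
      (A + D) - (B + D)      ≈⟨ +-congʳ A+D≈C+B ⟩
      (C + B) - (B + D)      ≈⟨ +-congˡ (-‿cong (+-comm B D)) ⟩
      (C + B) - (D + B)      ≈⟨ [w+x]-[y+z]≈[w-y]+[x-z] C B D B ⟩
      (C - D) + (B - B)      ≈⟨ +-congˡ (-‿inverseʳ B) ⟩
      (C - D) + 0#           ≈⟨ +-identityʳ _ ⟩
      C - D                  ≈⟨ ⟦⟧ᶜ-def c d ⟨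
      ⟦ c , d ⟧ᶜ             ∎)
      where
      A = a ×ᴿ 1#
      B = b ×ᴿ 1#
      C = c ×ᴿ 1#
      D = d ×ᴿ 1#
      A+D≈C+B : A + D ≈ C + B
      A+D≈C+B = begin
        A + D            ≈⟨ ×-homo-+ 1# a d ⟨
        (a ℕ.+ d) ×ᴿ 1#  ≡⟨ ≡.cong (_×ᴿ 1#) eq ⟩
        (c ℕ.+ b) ×ᴿ 1#  ≈⟨ ×-homo-+ 1# c b ⟩
        C + B            ∎

  open RingSolver differences (fromCommutativeRing R) ⟦⟧-homomorphism ⟦⟧≟ public
    using (Polynomial; solve; con; _:+_; _:*_; _:-_; :-_; _:=_)

  𝟙 : ∀ {n} → Polynomial n
  𝟙 = con (1 , 0)

module FiniteSums {c ℓ} (R : CommutativeRing c ℓ) where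

  open CommutativeRing R
  open RawSemiringDefinitions (Semiring.rawSemiring semiring) using (_^_; sum; product)
  open IntegerSolver R
  open SetoidReasoning setoid

  ∏ : ℕ → (ℕ → Carrier) → Carrier
  ∏ n f = product {n} (λ j → f (toℕ j))

  ∏-cong : ∀ n {f g} → (∀ i → f i ≈ g i) → ∏ n f ≈ ∏ n g
  ∏-cong zero    f≈g = refl
  ∏-cong (suc n) f≈g = *-cong (f≈g 0) (∏-cong n (λ i → f≈g (suc i)))

  ∏-last : ∀ n f → ∏ (suc n) f ≈ ∏ n f * f n
  ∏-last zero    f = *-comm (f 0) 1#
  ∏-last (suc n) f = trans (*-congˡ (∏-last n (λ i → f (suc i)))) (sym (*-assoc _ _ _))

  ∏-split : ∀ m n f → ∏ (m ℕ.+ n) f ≈ ∏ m f * ∏ n (λ i → f (m ℕ.+ i))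
  ∏-split zero    n f = sym (*-identityˡ _)
  ∏-split (suc m) n f =
    trans (*-congˡ (∏-split m n (λ i → f (suc i)))) (sym (*-assoc _ _ _))

  ∏-* : ∀ n f g → ∏ n (λ i → f i * g i) ≈ ∏ n f * ∏ n g
  ∏-* zero    f g = sym (*-identityˡ 1#)
  ∏-* (suc n) f g = trans (*-congˡ (∏-* n (λ i → f (suc i)) (λ i → g (suc i))))
    (solve 4 (λ a b c d → (a :* b) :* (c :* d) := (a :* c) :* (b :* d)) refl _ _ _ _)

  ∏-1 : ∀ n {f} → (∀ i → f i ≈ 1#) → ∏ n f ≈ 1#
  ∏-1 zero    f≈1 = refl
  ∏-1 (suc n) f≈1 = trans (*-cong (f≈1 0) (∏-1 n (λ i → f≈1 (suc i)))) (*-identityˡ 1#)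

  -- Summing over r + s = n avoids truncated subtraction.
  ∑Δ : ℕ → (ℕ → ℕ → Carrier) → Carrier
  ∑Δ zero    f = f 0 0
  ∑Δ (suc n) f = f 0 (suc n) + ∑Δ n (λ r s → f (suc r) s)

  ∑Δ-cong : ∀ n {f g} → (∀ r s → r ℕ.+ s ≡ n → f r s ≈ g r s) → ∑Δ n f ≈ ∑Δ n g
  ∑Δ-cong zero    f≈g = f≈g 0 0 ≡.refl
  ∑Δ-cong (suc n) f≈g = +-cong (f≈g 0 (suc n) ≡.refl)
    (∑Δ-cong n (λ r s r+s≡n → f≈g (suc r) s (≡.cong suc r+s≡n)))

  ∑Δ-+ : ∀ n f g → ∑Δ n (λ r s → f r s + g r s) ≈ ∑Δ n f + ∑Δ n g
  ∑Δ-+ zero    f g = refl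
  ∑Δ-+ (suc n) f g =
    trans (+-congˡ (∑Δ-+ n (λ r s → f (suc r) s) (λ r s → g (suc r) s)))
      (solve 4 (λ a b c d → (a :+ b) :+ (c :+ d) := (a :+ c) :+ (b :+ d)) refl _ _ _ _)

  ∑Δ-*ˡ : ∀ n x f → x * ∑Δ n f ≈ ∑Δ n (λ r s → x * f r s)
  ∑Δ-*ˡ zero    x f = refl
  ∑Δ-*ˡ (suc n) x f = trans (distribˡ x _ _) (+-congˡ (∑Δ-*ˡ n x (λ r s → f (suc r) s)))

  ∑Δ-last : ∀ n f → ∑Δ (suc n) f ≈ ∑Δ n (λ r s → f r (suc s)) + f (suc n) 0
  ∑Δ-last zero    f = refl
  ∑Δ-last (suc n) f =
    trans (+-congˡ (∑Δ-last n (λ r s → f (suc r) s))) (sym (+-assoc _ _ _))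

  -- Both sides run over the triples r + s + t = n; the induction splits off the terms with r = 0.
  ∑Δ-assoc : ∀ n (f : ℕ → ℕ → ℕ → Carrier) →
    ∑Δ n (λ m t → ∑Δ m (λ r s → f r s t)) ≈ ∑Δ n (λ r m → ∑Δ m (λ s t → f r s t))
  ∑Δ-assoc zero    f = refl
  ∑Δ-assoc (suc n) f = begin
    f 0 0 (suc n) + ∑Δ n (λ m t → f 0 (suc m) t + ∑Δ m (λ r s → f (suc r) s t))
      ≈⟨ +-congˡ (∑Δ-+ n (λ m t → f 0 (suc m) t) _) ⟩
    f 0 0 (suc n) + (∑Δ n (λ m t → f 0 (suc m) t) + ∑Δ n (λ m t → ∑Δ m (λ r s → f (suc r) s t)))
      ≈⟨ +-congˡ (+-congˡ (∑Δ-assoc n (λ r s t → f (suc r) s t))) ⟩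
    f 0 0 (suc n) + (∑Δ n (λ m t → f 0 (suc m) t) + ∑Δ n (λ r m → ∑Δ m (λ s t → f (suc r) s t)))
      ≈⟨ +-assoc _ _ _ ⟨
    ∑Δ (suc n) (λ s t → f 0 s t) + ∑Δ n (λ r m → ∑Δ m (λ s t → f (suc r) s t))
      ∎

  sum≈∑Δ : ∀ n f → sum {suc n} (λ j → f (toℕ j)) ≈ ∑Δ n (λ r _ → f r)
  sum≈∑Δ zero    f = +-identityʳ (f 0)
  sum≈∑Δ (suc n) f = +-congˡ (sum≈∑Δ n (λ i → f (suc i)))

  poch : Carrier → Carrier → ℕ → Carrier
  poch x y n = ∏ n (λ j → 1# - x * y ^ j)

-- Finite q-series identities: Vandermonde, triple product, Bailey pair

module QSeries {c ℓ} (R : CommutativeRing c ℓ) where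

  open CommutativeRing R
  open RawSemiringDefinitions (Semiring.rawSemiring semiring) using (_^_)

  -- `Q` is a parameter of its own because it is used twice, as `q ^ 2` for the series and as
  -- `q ^ 6` over `q ^ 3` for the theta function, where it is the square only up to `_≈_`.
  module Identities (q Q : Carrier) (Q≈q² : Q ≈ q * q)
    (v : ℕ → Carrier) (v-inverse : ∀ n → (1# - Q * Q ^ n) * v n ≈ 1#) where

    open FiniteSums R
    open IntegerSolver R
    open Exponentiation commutativeSemiring using (^-homo-*; ^-congʳ; ^-assocʳ; ^-congˡ)
    open SetoidReasoning setoid

    P I X : ℕ → Carrier
    P = poch Q Q
    I n = ∏ n v
    X = poch q Q

    θ : ℕ → Carrier
    θ r = (- 1#) ^ r * q ^ (r ℕ.* r)

    P*I≈1 : ∀ n → P n * I n ≈ 1#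
    P*I≈1 n = trans (sym (∏-* n (λ j → 1# - Q * Q ^ j) v)) (∏-1 n v-inverse)

    I-step : ∀ n → (1# - Q ^ suc n) * I (suc n) ≈ I n
    I-step n = begin
      (1# - Q ^ suc n) * I (suc n)      ≈⟨ *-congˡ (∏-last n v) ⟩
      (1# - Q ^ suc n) * (I n * v n)
        ≈⟨ solve 3 (λ a b c → a :* (b :* c) := (a :* c) :* b) refl _ (I n) (v n) ⟩
      ((1# - Q ^ suc n) * v n) * I n    ≈⟨ *-congʳ (v-inverse n) ⟩
      1# * I n                          ≈⟨ *-identityˡ (I n) ⟩
      I n                               ∎

    private
      factor-cancelˡ : ∀ n {x y} → (1# - Q ^ suc n) * x ≈ (1# - Q ^ suc n) * y → x ≈ y
      factor-cancelˡ n {x} {y} eq = begin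
        x                                  ≈⟨ expand x ⟩
        v n * ((1# - Q ^ suc n) * x)       ≈⟨ *-congˡ eq ⟩
        v n * ((1# - Q ^ suc n) * y)       ≈⟨ expand y ⟨
        y                                  ∎
        where
        expand : ∀ z → z ≈ v n * ((1# - Q ^ suc n) * z)
        expand z = begin
          z                                ≈⟨ *-identityˡ z ⟨
          1# * z                           ≈⟨ *-congʳ (v-inverse n) ⟨
          ((1# - Q ^ suc n) * v n) * z
            ≈⟨ solve 3 (λ a b c → (a :* b) :* c := b :* (a :* c)) refl _ (v n) z ⟩
          v n * ((1# - Q ^ suc n) * z)     ∎

      ∑Δ-zeroʳ : ∀ n f → (∀ r → f r 0 ≈ 0#) → ∑Δ (suc n) f ≈ ∑Δ n (λ r s → f r (suc s))
      ∑Δ-zeroʳ n f f≈0 = trans (∑Δ-last n f) (trans (+-congˡ (f≈0 (suc n))) (+-identityʳ _))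

      [1-1]*x≈0 : ∀ x → (1# - 1#) * x ≈ 0#
      [1-1]*x≈0 x = trans (*-congʳ (-‿inverseʳ 1#)) (zeroˡ x)

    -- From 1 - Qʳ⁺ˢ = (1 - Qʳ) + Qʳ (1 - Qˢ).
    ∑Δ-leibniz : ∀ n f → (1# - Q ^ suc n) * ∑Δ (suc n) f ≈
      ∑Δ n (λ r s → (1# - Q ^ suc r) * f (suc r) s + Q ^ r * ((1# - Q ^ suc s) * f r (suc s)))
    ∑Δ-leibniz n f = begin
      (1# - Q ^ suc n) * ∑Δ (suc n) f
        ≈⟨ ∑Δ-*ˡ (suc n) _ f ⟩
      ∑Δ (suc n) (λ r s → (1# - Q ^ suc n) * f r s)
        ≈⟨ ∑Δ-cong (suc n) split ⟩
      ∑Δ (suc n) (λ r s → (1# - Q ^ r) * f r s + Q ^ r * ((1# - Q ^ s) * f r s))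
        ≈⟨ ∑Δ-+ (suc n) (λ r s → (1# - Q ^ r) * f r s) (λ r s → Q ^ r * ((1# - Q ^ s) * f r s)) ⟩
      ∑Δ (suc n) (λ r s → (1# - Q ^ r) * f r s) +
      ∑Δ (suc n) (λ r s → Q ^ r * ((1# - Q ^ s) * f r s))
        ≈⟨ +-cong (trans (+-congʳ ([1-1]*x≈0 (f 0 (suc n)))) (+-identityˡ _))
             (∑Δ-zeroʳ n (λ r s → Q ^ r * ((1# - Q ^ s) * f r s))
               (λ r → trans (*-congˡ ([1-1]*x≈0 (f r 0))) (zeroʳ _))) ⟩
      ∑Δ n (λ r s → (1# - Q ^ suc r) * f (suc r) s) +
      ∑Δ n (λ r s → Q ^ r * ((1# - Q ^ suc s) * f r (suc s)))
        ≈⟨ ∑Δ-+ n (λ r s → (1# - Q ^ suc r) * f (suc r) s) _ ⟨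
      ∑Δ n (λ r s → (1# - Q ^ suc r) * f (suc r) s + Q ^ r * ((1# - Q ^ suc s) * f r (suc s)))
        ∎
      where
      split : ∀ r s → r ℕ.+ s ≡ suc n →
        (1# - Q ^ suc n) * f r s ≈ (1# - Q ^ r) * f r s + Q ^ r * ((1# - Q ^ s) * f r s)
      split r s r+s≡1+n = begin
        (1# - Q ^ suc n) * f r s
          ≡⟨ ≡.cong (λ k → (1# - Q ^ k) * f r s) r+s≡1+n ⟨
        (1# - Q ^ (r ℕ.+ s)) * f r s
          ≈⟨ *-congʳ (+-congˡ (-‿cong (^-homo-* Q r s))) ⟩
        (1# - Q ^ r * Q ^ s) * f r s
          ≈⟨ solve 3 (λ x y z → (𝟙 :- x :* y) :* z :=
               (𝟙 :- x) :* z :+ x :* ((𝟙 :- y) :* z)) refl _ _ _ ⟩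
        (1# - Q ^ r) * f r s + Q ^ r * ((1# - Q ^ s) * f r s)
          ∎

    -- Multiplication by 1 - Qⁿ⁺¹ and the Leibniz rule turn the sum for (n + 1, s) into the one for
    -- (n, s + 1), so the induction on n needs s free. The right side obeys the same rule, as n + (s
    -- + 1) = (n + 1) + s.
    vandermonde : ∀ n s →
      ∑Δ n (λ m k → Q ^ (m ℕ.* (m ℕ.+ s)) * (I m * I (m ℕ.+ s)) * I k) ≈ I n * I (n ℕ.+ s)
    vandermonde zero    s = solve 1 (λ x → 𝟙 :* (𝟙 :* x) :* 𝟙 := 𝟙 :* x) refl (I s)
    vandermonde (suc n) s = factor-cancelˡ n (begin
      (1# - Q ^ suc n) * ∑Δ (suc n) f
        ≈⟨ ∑Δ-leibniz n f ⟩
      ∑Δ n (λ m k → (1# - Q ^ suc m) * f (suc m) k + Q ^ m * ((1# - Q ^ suc k) * f m (suc k)))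
        ≈⟨ ∑Δ-cong n (λ m k _ → term m k) ⟩
      ∑Δ n (λ m k → Q ^ (m ℕ.* (m ℕ.+ suc s)) * (I m * I (m ℕ.+ suc s)) * I k)
        ≈⟨ vandermonde n (suc s) ⟩
      I n * I (n ℕ.+ suc s)
        ≡⟨ ≡.cong (λ k → I n * I k) (ℕ.+-suc n s) ⟩
      I n * I (suc n ℕ.+ s)
        ≈⟨ *-congʳ (I-step n) ⟨
      (1# - Q ^ suc n) * I (suc n) * I (suc n ℕ.+ s)
        ≈⟨ *-assoc _ _ _ ⟩
      (1# - Q ^ suc n) * (I (suc n) * I (suc n ℕ.+ s))
        ∎)
      where
      f : ℕ → ℕ → Carrier
      f m k = Q ^ (m ℕ.* (m ℕ.+ s)) * (I m * I (m ℕ.+ s)) * I k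

      exponent₁ : ∀ m s → suc m ℕ.* (suc m ℕ.+ s) ≡ m ℕ.* (m ℕ.+ suc s) ℕ.+ suc (m ℕ.+ s)
      exponent₁ = solve-∀

      exponent₂ : ∀ m s → m ℕ.* (m ℕ.+ suc s) ≡ m ℕ.+ m ℕ.* (m ℕ.+ s)
      exponent₂ = solve-∀

      term : ∀ m k →
        (1# - Q ^ suc m) * f (suc m) k + Q ^ m * ((1# - Q ^ suc k) * f m (suc k)) ≈
        Q ^ (m ℕ.* (m ℕ.+ suc s)) * (I m * I (m ℕ.+ suc s)) * I k
      term m k = begin
        (1# - Q ^ suc m) * f (suc m) k + Q ^ m * ((1# - Q ^ suc k) * f m (suc k))
          ≈⟨ +-cong
               (*-congˡ (*-congʳ (*-congʳ (trans (^-congʳ Q (exponent₁ m s)) (^-homo-* Q e _)))))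
               (solve 6 (λ x y z w i j → x :* (y :* (z :* (i :* j) :* w)) :=
                 (x :* z) :* (i :* j) :* (y :* w)) refl _ _ _ _ _ _) ⟩
        (1# - Q ^ suc m) * (Q ^ e * Q ^ suc l * (I (suc m) * I (suc l)) * I k) +
        (Q ^ m * Q ^ (m ℕ.* (m ℕ.+ s))) * (I m * I l) * ((1# - Q ^ suc k) * I (suc k))
          ≈⟨ +-cong
               (solve 6 (λ a b c i j k → a :* (b :* c :* (i :* j) :* k) :=
                 (a :* i) :* (b :* c :* j :* k)) refl _ _ _ _ _ _)
               (*-cong (*-cong (trans (sym (^-homo-* Q m _)) (^-congʳ Q (≡.sym (exponent₂ m s))))
                               (*-congˡ (sym (I-step l))))
                       (I-step k)) ⟩
        ((1# - Q ^ suc m) * I (suc m)) * (Q ^ e * Q ^ suc l * I (suc l) * I k) +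
        Q ^ e * (I m * ((1# - Q ^ suc l) * I (suc l))) * I k
          ≈⟨ +-congʳ (*-congʳ (I-step m)) ⟩
        I m * (Q ^ e * Q ^ suc l * I (suc l) * I k) +
        Q ^ e * (I m * ((1# - Q ^ suc l) * I (suc l))) * I k
          -- Both summands are now multiples of Q^e I(m) I(l+1) I(k), with the factors Q^(l+1) and 1
          -- - Q^(l+1), which add up to 1.
          ≈⟨ solve 5 (λ i e x j k → i :* (e :* x :* j :* k) :+
               e :* (i :* ((𝟙 :- x) :* j)) :* k := e :* (i :* j) :* k) refl _ _ _ _ _ ⟩
        Q ^ e * (I m * I (suc l)) * I k
          ≡⟨ ≡.cong (λ t → Q ^ e * (I m * I t) * I k) (ℕ.+-suc m s) ⟨
        Q ^ e * (I m * I (m ℕ.+ suc s)) * I k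
          ∎
        where
        e = m ℕ.* (m ℕ.+ suc s)
        l = m ℕ.+ s

    -- J a b is ∑ᵣ (-1)ʳ q^(r²) / ((Q;Q)_(a+r) (Q;Q)_(b-r)) over -a ≤ r ≤ b; H a b is the half r ≥ 0.
    H : ℕ → ℕ → Carrier
    H a b = ∑Δ b (λ r k → θ r * (I (a ℕ.+ r) * I k))

    J : ℕ → ℕ → Carrier
    J a b = H a b + H b a - I a * I b

    J-sym : ∀ a b → J a b ≈ J b a
    J-sym a b = solve 4 (λ x y i j → x :+ y :- i :* j := y :+ x :- j :* i) refl _ _ (I a) (I b)

    private
      θ-step : ∀ r → θ (suc r) ≈ - (θ r * (q * Q ^ r))
      θ-step r = begin
        - 1# * (- 1#) ^ r * q ^ (suc r ℕ.* suc r)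
          ≈⟨ *-congˡ (^-congʳ q (exponent r)) ⟩
        - 1# * (- 1#) ^ r * q ^ (r ℕ.* r ℕ.+ suc (2 ℕ.* r))
          ≈⟨ *-congˡ (^-homo-* q (r ℕ.* r) _) ⟩
        - 1# * (- 1#) ^ r * (q ^ (r ℕ.* r) * (q * q ^ (2 ℕ.* r)))
          ≈⟨ *-congˡ (*-congˡ (*-congˡ (trans (sym (^-assocʳ q 2 r)) (^-congˡ r q^2≈Q)))) ⟩
        - 1# * (- 1#) ^ r * (q ^ (r ℕ.* r) * (q * Q ^ r))
          ≈⟨ solve 4 (λ s t q x → (:- 𝟙) :* s :* (t :* (q :* x)) := :- (s :* t :* (q :* x))) refl _ _ _ _ ⟩
        - (θ r * (q * Q ^ r))
          ∎
        where
        exponent : ∀ r → suc r ℕ.* suc r ≡ r ℕ.* r ℕ.+ suc (2 ℕ.* r)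
        exponent = solve-∀
        q^2≈Q : q ^ 2 ≈ Q
        q^2≈Q = trans (*-congˡ (*-identityʳ q)) (sym Q≈q²)

      Q^-shift : ∀ m n {k} → m ℕ.+ n ≡ k → Q ^ m * Q ^ n ≈ Q ^ k
      Q^-shift m n ≡.refl = sym (^-homo-* Q m n)

      -- For r + k = b + 1 the factor is 1 - Q^(a+r) Q^k = (1 - Q^k) + Q^k (1 - Q^(a+r)). The first
      -- part cancels against I(k) and leaves `H a b`. The second cancels against I(a+r), and after
      -- a shift of r by one it is -q Q^b times the same sum; its term r = 0 is left over.
      H-stepʳ : ∀ a b → (1# - Q ^ suc (a ℕ.+ b)) * H a (suc b) ≈
        (1# - q * Q ^ b) * H a b + Q ^ suc b * ((1# - Q ^ a) * (I a * I (suc b)))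
      H-stepʳ a b = begin
        (1# - Q ^ suc (a ℕ.+ b)) * ∑Δ (suc b) f
          ≈⟨ ∑Δ-*ˡ (suc b) _ f ⟩
        ∑Δ (suc b) (λ r k → (1# - Q ^ suc (a ℕ.+ b)) * f r k)
          ≈⟨ ∑Δ-cong (suc b) split ⟩
        ∑Δ (suc b) (λ r k → θ r * I (a ℕ.+ r) * ((1# - Q ^ k) * I k) + g r k)
          ≈⟨ ∑Δ-+ (suc b) (λ r k → θ r * I (a ℕ.+ r) * ((1# - Q ^ k) * I k)) g ⟩
        ∑Δ (suc b) (λ r k → θ r * I (a ℕ.+ r) * ((1# - Q ^ k) * I k)) + ∑Δ (suc b) g
          ≈⟨ +-cong
               (trans (∑Δ-zeroʳ b (λ r k → θ r * I (a ℕ.+ r) * ((1# - Q ^ k) * I k))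
                        (λ r → trans (*-congˡ ([1-1]*x≈0 1#)) (zeroʳ _)))
                      (∑Δ-cong b (λ r k _ → trans (*-congˡ (I-step k)) (*-assoc _ _ _))))
               (+-cong first (trans (∑Δ-cong b rest) (sym (∑Δ-*ˡ b _ f)))) ⟩
        H a b + (Q ^ suc b * ((1# - Q ^ a) * (I a * I (suc b))) + - (q * Q ^ b) * H a b)
          ≈⟨ solve 3 (λ h x y → h :+ (x :+ (:- y) :* h) := (𝟙 :- y) :* h :+ x) refl _ _ _ ⟩
        (1# - q * Q ^ b) * H a b + Q ^ suc b * ((1# - Q ^ a) * (I a * I (suc b)))
          ∎
        where
        f g : ℕ → ℕ → Carrier
        f r k = θ r * (I (a ℕ.+ r) * I k)
        g r k = θ r * Q ^ k * ((1# - Q ^ (a ℕ.+ r)) * I (a ℕ.+ r)) * I k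

        split : ∀ r k → r ℕ.+ k ≡ suc b → (1# - Q ^ suc (a ℕ.+ b)) * f r k ≈
          θ r * I (a ℕ.+ r) * ((1# - Q ^ k) * I k) + g r k
        split r k r+k≡1+b = begin
          (1# - Q ^ suc (a ℕ.+ b)) * f r k
            ≈⟨ *-congʳ (+-congˡ (-‿cong (Q^-shift (a ℕ.+ r) k exponent))) ⟨
          (1# - Q ^ (a ℕ.+ r) * Q ^ k) * f r k
            ≈⟨ solve 5 (λ x y t i j → (𝟙 :- x :* y) :* (t :* (i :* j)) :=
                 t :* i :* ((𝟙 :- y) :* j) :+ t :* y :* ((𝟙 :- x) :* i) :* j) refl _ _ _ _ _ ⟩
          θ r * I (a ℕ.+ r) * ((1# - Q ^ k) * I k) + g r k
            ∎
          where
          exponent : a ℕ.+ r ℕ.+ k ≡ suc (a ℕ.+ b)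
          exponent = ≡.trans (ℕ.+-assoc a r k)
            (≡.trans (≡.cong (a ℕ.+_) r+k≡1+b) (ℕ.+-suc a b))

        first : g 0 (suc b) ≈ Q ^ suc b * ((1# - Q ^ a) * (I a * I (suc b)))
        first = begin
          g 0 (suc b)
            ≡⟨ ≡.cong (λ k → θ 0 * Q ^ suc b * ((1# - Q ^ k) * I k) * I (suc b)) (ℕ.+-identityʳ a) ⟩
          θ 0 * Q ^ suc b * ((1# - Q ^ a) * I a) * I (suc b)
            ≈⟨ solve 4 (λ y x i j → 𝟙 :* 𝟙 :* y :* ((𝟙 :- x) :* i) :* j :=
                 y :* ((𝟙 :- x) :* (i :* j))) refl _ _ _ _ ⟩
          Q ^ suc b * ((1# - Q ^ a) * (I a * I (suc b)))
            ∎

        rest : ∀ r k → r ℕ.+ k ≡ b → g (suc r) k ≈ - (q * Q ^ b) * f r k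
        rest r k r+k≡b = begin
          g (suc r) k
            ≡⟨ ≡.cong (λ l → θ (suc r) * Q ^ k * ((1# - Q ^ l) * I l) * I k) (ℕ.+-suc a r) ⟩
          θ (suc r) * Q ^ k * ((1# - Q ^ suc (a ℕ.+ r)) * I (suc (a ℕ.+ r))) * I k
            ≈⟨ *-congʳ (*-cong (*-congʳ (θ-step r)) (I-step (a ℕ.+ r))) ⟩
          - (θ r * (q * Q ^ r)) * Q ^ k * I (a ℕ.+ r) * I k
            ≈⟨ solve 6 (λ t q x y i j → (:- (t :* (q :* x))) :* y :* i :* j :=
                 (:- (q :* (x :* y))) :* (t :* (i :* j))) refl _ _ _ _ _ _ ⟩
          - (q * (Q ^ r * Q ^ k)) * f r k
            ≈⟨ *-congʳ (-‿cong (*-congˡ (Q^-shift r k r+k≡b))) ⟩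
          - (q * Q ^ b) * f r k
            ∎

      -- The factor is split in the other order, as (1 - x) + x (1 - y) with x = Q^(b+r+1) and y =
      -- Q^k. By Q = q² and `θ-step` the second part is the shifted sum, which lacks the term r = 0
      -- of `H b a`.
      H-stepˡ : ∀ a b → (1# - Q ^ suc (a ℕ.+ b)) * H (suc b) a ≈
        H b a - q * Q ^ b * (H b a - I b * I a)
      H-stepˡ a b = begin
        (1# - Q ^ suc (a ℕ.+ b)) * ∑Δ a (λ r k → θ r * (I (suc b ℕ.+ r) * I k))
          ≈⟨ ∑Δ-*ˡ a _ _ ⟩
        ∑Δ a (λ r k → (1# - Q ^ suc (a ℕ.+ b)) * (θ r * (I (suc b ℕ.+ r) * I k)))
          ≈⟨ ∑Δ-cong a split ⟩
        ∑Δ a (λ r k → f r k + g r k)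
          ≈⟨ ∑Δ-+ a f g ⟩
        H b a + ∑Δ a g
          ≈⟨ +-congˡ (rest a) ⟩
        H b a - q * Q ^ b * (H b a - I b * I a)
          ∎
        where
        f g : ℕ → ℕ → Carrier
        f r k = θ r * (I (b ℕ.+ r) * I k)
        g r k = θ r * Q ^ suc (b ℕ.+ r) * I (suc (b ℕ.+ r)) * ((1# - Q ^ k) * I k)

        split : ∀ r k → r ℕ.+ k ≡ a →
          (1# - Q ^ suc (a ℕ.+ b)) * (θ r * (I (suc b ℕ.+ r) * I k)) ≈ f r k + g r k
        split r k r+k≡a = begin
          (1# - Q ^ suc (a ℕ.+ b)) * (θ r * (I (suc b ℕ.+ r) * I k))
            ≈⟨ *-congʳ (+-congˡ (-‿cong (Q^-shift (suc (b ℕ.+ r)) k exponent))) ⟨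
          (1# - Q ^ suc (b ℕ.+ r) * Q ^ k) * (θ r * (I (suc b ℕ.+ r) * I k))
            ≈⟨ solve 5 (λ x y t i j → (𝟙 :- x :* y) :* (t :* (i :* j)) :=
                 t :* (((𝟙 :- x) :* i) :* j) :+ t :* x :* i :* ((𝟙 :- y) :* j)) refl _ _ _ _ _ ⟩
          θ r * (((1# - Q ^ suc (b ℕ.+ r)) * I (suc (b ℕ.+ r))) * I k) + g r k
            ≈⟨ +-congʳ (*-congˡ (*-congʳ (I-step (b ℕ.+ r)))) ⟩
          f r k + g r k
            ∎
          where
          exponent : suc (b ℕ.+ r) ℕ.+ k ≡ suc (a ℕ.+ b)
          exponent = ≡.cong suc (≡.trans (ℕ.+-assoc b r k)
            (≡.trans (≡.cong (b ℕ.+_) r+k≡a) (ℕ.+-comm b a)))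

        rest : ∀ a → ∑Δ a g ≈ - (q * Q ^ b * (H b a - I b * I a))
        rest zero = begin
          θ 0 * Q ^ suc (b ℕ.+ 0) * I (suc (b ℕ.+ 0)) * ((1# - 1#) * 1#)
            ≈⟨ trans (*-congˡ ([1-1]*x≈0 1#)) (zeroʳ _) ⟩
          0#
            ≈⟨ solve 2 (λ i q → con (0 , 0) := :- (q :* (𝟙 :* 𝟙 :* (i :* 𝟙) :- i :* 𝟙))) refl (I b) _ ⟩
          - (q * Q ^ b * (θ 0 * (I b * I 0) - I b * I 0))
            ≡⟨ ≡.cong (λ k → - (q * Q ^ b * (θ 0 * (I k * I 0) - I b * I 0))) (ℕ.+-identityʳ b) ⟨
          - (q * Q ^ b * (H b 0 - I b * I 0))
            ∎
        rest (suc a) = begin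
          ∑Δ (suc a) g
            ≈⟨ ∑Δ-zeroʳ a g (λ r → trans (*-congˡ ([1-1]*x≈0 1#)) (zeroʳ _)) ⟩
          ∑Δ a (λ r k → g r (suc k))
            ≈⟨ ∑Δ-cong a (λ r k _ → term r k) ⟩
          ∑Δ a (λ r k → - (q * Q ^ b) * f (suc r) k)
            ≈⟨ ∑Δ-*ˡ a _ _ ⟨
          - (q * Q ^ b) * ∑Δ a (λ r k → f (suc r) k)
            ≈⟨ solve 4 (λ y i j s → (:- y) :* s :=
                 :- (y :* ((𝟙 :* 𝟙 :* (i :* j) :+ s) :- i :* j))) refl _ (I b) _ _ ⟩
          - (q * Q ^ b * ((θ 0 * (I b * I (suc a)) + ∑Δ a (λ r k → f (suc r) k)) - I b * I (suc a)))
            ≡⟨ ≡.cong (λ k → - (q * Q ^ b *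
                 ((θ 0 * (I k * I (suc a)) + ∑Δ a (λ r k → f (suc r) k)) - I b * I (suc a))))
                 (ℕ.+-identityʳ b) ⟨
          - (q * Q ^ b * (H b (suc a) - I b * I (suc a)))
            ∎
          where
          term : ∀ r k → g r (suc k) ≈ - (q * Q ^ b) * f (suc r) k
          term r k = begin
            θ r * (Q * Q ^ (b ℕ.+ r)) * I (suc (b ℕ.+ r)) * ((1# - Q ^ suc k) * I (suc k))
              ≈⟨ *-cong (*-congʳ (*-congˡ (*-cong Q≈q² (^-homo-* Q b r)))) (I-step k) ⟩
            θ r * (q * q * (Q ^ b * Q ^ r)) * I (suc (b ℕ.+ r)) * I k
              ≈⟨ solve 6 (λ t q x y i j → t :* (q :* q :* (x :* y)) :* i :* j :=
                   (:- (q :* x)) :* ((:- (t :* (q :* y))) :* (i :* j))) refl _ _ _ _ _ _ ⟩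
            - (q * Q ^ b) * (- (θ r * (q * Q ^ r)) * (I (suc (b ℕ.+ r)) * I k))
              ≈⟨ *-congˡ (*-congʳ (θ-step r)) ⟨
            - (q * Q ^ b) * (θ (suc r) * (I (suc (b ℕ.+ r)) * I k))
              ≡⟨ ≡.cong (λ l → - (q * Q ^ b) * (θ (suc r) * (I l * I k))) (ℕ.+-suc b r) ⟨
            - (q * Q ^ b) * f (suc r) k
              ∎

    -- The boundary terms left by the two half sums are those produced by the doubly counted r = 0,
    -- so they cancel and a first-order recurrence in b remains. Together with `J-sym` it determines
    -- `J` from `J 0 0`.
    J-step : ∀ a b → (1# - Q ^ suc (a ℕ.+ b)) * J a (suc b) ≈ (1# - q * Q ^ b) * J a b
    J-step a b = begin
      d * (H a (suc b) + H (suc b) a - I a * I (suc b))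
        ≈⟨ solve 4 (λ c x y z → c :* (x :+ y :- z) := c :* x :+ c :* y :- c :* z) refl _ _ _ _ ⟩
      d * H a (suc b) + d * H (suc b) a - d * (I a * I (suc b))
        ≈⟨ +-cong (+-cong (H-stepʳ a b) (H-stepˡ a b)) (-‿cong split) ⟩
      ((1# - q * Q ^ b) * H a b + z) + (H b a - q * Q ^ b * (H b a - I b * I a)) - (I a * I b + z)
        ≈⟨ solve 6 (λ x h h′ z i j → (𝟙 :- x) :* h :+ z :+ (h′ :- x :* (h′ :- j :* i)) :- (i :* j :+ z) :=
             (𝟙 :- x) :* (h :+ h′ :- i :* j)) refl _ _ _ _ (I a) (I b) ⟩
      (1# - q * Q ^ b) * J a b
        ∎
      where
      d z : Carrier
      d = 1# - Q ^ suc (a ℕ.+ b)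
      z = Q ^ suc b * ((1# - Q ^ a) * (I a * I (suc b)))
      split : d * (I a * I (suc b)) ≈ I a * I b + z
      split = begin
        d * (I a * I (suc b))
          ≈⟨ *-congʳ (+-congˡ (-‿cong (Q^-shift a (suc b) (ℕ.+-suc a b)))) ⟨
        (1# - Q ^ a * Q ^ suc b) * (I a * I (suc b))
          ≈⟨ solve 4 (λ x y i j → (𝟙 :- x :* y) :* (i :* j) :=
               i :* ((𝟙 :- y) :* j) :+ y :* ((𝟙 :- x) :* (i :* j))) refl _ _ _ _ ⟩
        I a * ((1# - Q ^ suc b) * I (suc b)) + z
          ≈⟨ +-congʳ (*-congˡ (I-step b)) ⟩
        I a * I b + z
          ∎

    private
      X*-step : ∀ a b {x} → P (a ℕ.+ b) * J a b ≈ x → P (a ℕ.+ suc b) * J a (suc b) ≈ x * (1# - q * Q ^ b)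
      X*-step a b {x} ih = begin
        P (a ℕ.+ suc b) * J a (suc b)
          ≡⟨ ≡.cong (λ k → P k * J a (suc b)) (ℕ.+-suc a b) ⟩
        P (suc (a ℕ.+ b)) * J a (suc b)
          ≈⟨ *-congʳ (∏-last (a ℕ.+ b) (λ j → 1# - Q * Q ^ j)) ⟩
        P (a ℕ.+ b) * (1# - Q ^ suc (a ℕ.+ b)) * J a (suc b)
          ≈⟨ *-assoc _ _ _ ⟩
        P (a ℕ.+ b) * ((1# - Q ^ suc (a ℕ.+ b)) * J a (suc b))
          ≈⟨ *-congˡ (J-step a b) ⟩
        P (a ℕ.+ b) * ((1# - q * Q ^ b) * J a b)
          ≈⟨ solve 3 (λ x y z → x :* (y :* z) := (x :* z) :* y) refl _ _ _ ⟩
        P (a ℕ.+ b) * J a b * (1# - q * Q ^ b)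
          ≈⟨ *-congʳ ih ⟩
        x * (1# - q * Q ^ b)
          ∎

    -- Multiplied by (Q;Q)_(a+b), the terms of `J` carry q-binomial coefficients; only one value of
    -- the free variable of the triple product occurs. The recurrence lowers b; once b = 0, symmetry
    -- swaps the arguments and the same recurrence lowers a.
    jacobi-triple-product : ∀ a b → P (a ℕ.+ b) * J a b ≈ X a * X b
    jacobi-triple-product a (suc b) = begin
      P (a ℕ.+ suc b) * J a (suc b)     ≈⟨ X*-step a b (jacobi-triple-product a b) ⟩
      X a * X b * (1# - q * Q ^ b)      ≈⟨ *-assoc _ _ _ ⟩
      X a * (X b * (1# - q * Q ^ b))    ≈⟨ *-congˡ (∏-last b (λ j → 1# - q * Q ^ j)) ⟨
      X a * X (suc b)                   ∎
    jacobi-triple-product zero zero =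
      solve 0 (𝟙 :* (𝟙 :* 𝟙 :* (𝟙 :* 𝟙) :+ 𝟙 :* 𝟙 :* (𝟙 :* 𝟙) :- 𝟙 :* 𝟙) := 𝟙 :* 𝟙) refl
    jacobi-triple-product (suc a) zero = begin
      P (suc a ℕ.+ 0) * J (suc a) 0     ≈⟨ *-cong (reflexive (≡.cong P (ℕ.+-identityʳ (suc a)))) (J-sym (suc a) 0) ⟩
      P (suc a) * J 0 (suc a)           ≈⟨ X*-step 0 a base ⟩
      X a * X 0 * (1# - q * Q ^ a)
        ≈⟨ solve 2 (λ x y → x :* 𝟙 :* y := (x :* y) :* 𝟙) refl _ _ ⟩
      X a * (1# - q * Q ^ a) * X 0      ≈⟨ *-congʳ (∏-last a (λ j → 1# - q * Q ^ j)) ⟨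
      X (suc a) * X 0                   ∎
      where
      base : P a * J 0 a ≈ X a * X 0
      base = trans (*-cong (reflexive (≡.cong P (≡.sym (ℕ.+-identityʳ a)))) (J-sym 0 a))
                   (jacobi-triple-product a 0)

    V : ℕ → ℕ → Carrier
    V n s = ∑Δ n (λ m _ → Q ^ (m ℕ.* (m ℕ.+ s)) * (I m * I (m ℕ.+ s)))

    X*X*I≈J : ∀ n → X n * X n * I (n ℕ.+ n) ≈ J n n
    X*X*I≈J n = begin
      X n * X n * I (n ℕ.+ n)                      ≈⟨ *-congʳ (jacobi-triple-product n n) ⟨
      P (n ℕ.+ n) * J n n * I (n ℕ.+ n)
        ≈⟨ solve 3 (λ x y z → x :* y :* z := (x :* z) :* y) refl _ _ _ ⟩
      P (n ℕ.+ n) * I (n ℕ.+ n) * J n n            ≈⟨ *-congʳ (P*I≈1 (n ℕ.+ n)) ⟩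
      1# * J n n                                   ≈⟨ *-identityˡ _ ⟩
      J n n                                        ∎

    -- Put m = r + s in the half sums: m² = r² + s (s + 2r), and the subscripts m + r and m - r
    -- become s + 2r and s, so that the inner sum is `V` with shift 2r. The subtracted `V n 0` is
    -- the contribution of r = 0, which both halves contain.
    ∑J≈∑V : ∀ n → ∑Δ n (λ m _ → Q ^ (m ℕ.* m) * J m m) ≈
      ∑Δ n (λ r k → Q ^ (r ℕ.* r) * θ r * V k (r ℕ.+ r)) +
      ∑Δ n (λ r k → Q ^ (r ℕ.* r) * θ r * V k (r ℕ.+ r)) - V n 0
    ∑J≈∑V n = begin
      ∑Δ n (λ m _ → Q ^ (m ℕ.* m) * J m m)
        ≈⟨ ∑Δ-cong n (λ m _ _ → split m) ⟩
      ∑Δ n (λ m k → (h m k + h m k) + - 1# * d m k)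
        ≈⟨ ∑Δ-+ n (λ m k → h m k + h m k) (λ m k → - 1# * d m k) ⟩
      ∑Δ n (λ m k → h m k + h m k) + ∑Δ n (λ m k → - 1# * d m k)
        ≈⟨ +-cong (∑Δ-+ n h h) (sym (∑Δ-*ˡ n (- 1#) d)) ⟩
      (∑Δ n h + ∑Δ n h) + - 1# * V n 0
        ≈⟨ +-cong (+-cong ∑h ∑h) (solve 1 (λ x → (:- 𝟙) :* x := :- x) refl _) ⟩
      ∑Δ n (λ r k → Q ^ (r ℕ.* r) * θ r * V k (r ℕ.+ r)) +
      ∑Δ n (λ r k → Q ^ (r ℕ.* r) * θ r * V k (r ℕ.+ r)) - V n 0
        ∎
      where
      h d : ℕ → ℕ → Carrier
      h m _ = Q ^ (m ℕ.* m) * H m m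
      d m _ = Q ^ (m ℕ.* (m ℕ.+ 0)) * (I m * I (m ℕ.+ 0))

      split : ∀ m → Q ^ (m ℕ.* m) * J m m ≈ (h m 0 + h m 0) + - 1# * d m 0
      split m = begin
        Q ^ (m ℕ.* m) * (H m m + H m m - I m * I m)
          ≈⟨ solve 4 (λ x h i j → x :* (h :+ h :- i :* j) :=
               (x :* h :+ x :* h) :+ (:- 𝟙) :* (x :* (i :* j))) refl _ _ _ _ ⟩
        (h m 0 + h m 0) + - 1# * (Q ^ (m ℕ.* m) * (I m * I m))
          ≡⟨ ≡.cong (λ k → (h m 0 + h m 0) + - 1# * (Q ^ (m ℕ.* k) * (I m * I k))) (ℕ.+-identityʳ m) ⟨
        (h m 0 + h m 0) + - 1# * d m 0
          ∎

      exponent₁ : ∀ r s → (r ℕ.+ s) ℕ.* (r ℕ.+ s) ≡ r ℕ.* r ℕ.+ s ℕ.* (s ℕ.+ (r ℕ.+ r))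
      exponent₁ = solve-∀

      exponent₂ : ∀ r s → r ℕ.+ s ℕ.+ r ≡ s ℕ.+ (r ℕ.+ r)
      exponent₂ = solve-∀

      g : ℕ → ℕ → ℕ → Carrier
      g r s _ = Q ^ (r ℕ.* r) * θ r * (Q ^ (s ℕ.* (s ℕ.+ (r ℕ.+ r))) * (I s * I (s ℕ.+ (r ℕ.+ r))))

      term : ∀ r s → Q ^ ((r ℕ.+ s) ℕ.* (r ℕ.+ s)) * (θ r * (I (r ℕ.+ s ℕ.+ r) * I s)) ≈ g r s 0
      term r s = begin
        Q ^ ((r ℕ.+ s) ℕ.* (r ℕ.+ s)) * (θ r * (I (r ℕ.+ s ℕ.+ r) * I s))
          ≈⟨ *-cong (trans (^-congʳ Q (exponent₁ r s)) (^-homo-* Q (r ℕ.* r) _))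
               (*-congˡ (*-congʳ (reflexive (≡.cong I (exponent₂ r s))))) ⟩
        Q ^ (r ℕ.* r) * Q ^ (s ℕ.* (s ℕ.+ (r ℕ.+ r))) * (θ r * (I (s ℕ.+ (r ℕ.+ r)) * I s))
          ≈⟨ solve 5 (λ x y t i j → x :* y :* (t :* (i :* j)) := x :* t :* (y :* (j :* i))) refl _ _ _ _ _ ⟩
        g r s 0
          ∎

      ∑h : ∑Δ n h ≈ ∑Δ n (λ r k → Q ^ (r ℕ.* r) * θ r * V k (r ℕ.+ r))
      ∑h = begin
        ∑Δ n (λ m _ → Q ^ (m ℕ.* m) * H m m)
          ≈⟨ ∑Δ-cong n (λ m _ _ → trans (∑Δ-*ˡ m _ _) (∑Δ-cong m (λ where r s ≡.refl → term r s))) ⟩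
        ∑Δ n (λ m t → ∑Δ m (λ r s → g r s t))
          ≈⟨ ∑Δ-assoc n g ⟩
        ∑Δ n (λ r k → ∑Δ k (λ s t → g r s t))
          ≈⟨ ∑Δ-cong n (λ r k _ → ∑Δ-*ˡ k _ _) ⟨
        ∑Δ n (λ r k → Q ^ (r ℕ.* r) * θ r * V k (r ℕ.+ r))
          ∎

-- Estimates O(ρᵉ) in a normed ring

module ℚPowers (ρ : ℚ) (0<ρ : 0ℚ ℚ.< ρ) (ρ<1 : ρ ℚ.< 1ℚ) where

  open RawSemiringDefinitions ℚ.+-*-rawSemiring public using (_^_)
  private module ^ = Exponentiation (CommutativeRing.commutativeSemiring ℚ.+-*-commutativeRing)

  ρ^+ : ∀ m n → ρ ^ (m ℕ.+ n) ≡ ρ ^ m ℚ.* ρ ^ n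
  ρ^+ = ^.^-homo-* ρ

  0<ρ^ : ∀ n → 0ℚ ℚ.< ρ ^ n
  0<ρ^ zero    = ℚ.positive⁻¹ 1ℚ
  0<ρ^ (suc n) = *-pos 0<ρ (0<ρ^ n)

  *-monoʳ-≤ : ∀ {x y z} → 0ℚ ℚ.< z → x ℚ.≤ y → z ℚ.* x ℚ.≤ z ℚ.* y
  *-monoʳ-≤ {z = z} 0<z = ℚ.*-monoˡ-≤-nonNeg z {{ℚ.nonNegative (ℚ.<⇒≤ 0<z)}}

  *-monoˡ-≤ : ∀ {x y z} → 0ℚ ℚ.< z → x ℚ.≤ y → x ℚ.* z ℚ.≤ y ℚ.* z
  *-monoˡ-≤ {z = z} 0<z = ℚ.*-monoʳ-≤-nonNeg z {{ℚ.nonNegative (ℚ.<⇒≤ 0<z)}}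

  ρ^≤1 : ∀ n → ρ ^ n ℚ.≤ 1ℚ
  ρ^≤1 zero    = ℚ.≤-refl
  ρ^≤1 (suc n) = ℚ.≤-trans (*-monoʳ-≤ 0<ρ (ρ^≤1 n))
    (ℚ.≤-trans (ℚ.≤-reflexive (ℚ.*-identityʳ ρ)) (ℚ.<⇒≤ ρ<1))

  ρ^-anti : ∀ {m n} → m ℕ.≤ n → ρ ^ n ℚ.≤ ρ ^ m
  ρ^-anti {m} {n} m≤n = begin
    ρ ^ n                        ≡⟨ ≡.cong (ρ ^_) (ℕ.m+[n∸m]≡n m≤n) ⟨
    ρ ^ (m ℕ.+ (n ℕ.∸ m))        ≡⟨ ρ^+ m (n ℕ.∸ m) ⟩
    ρ ^ m ℚ.* ρ ^ (n ℕ.∸ m)      ≤⟨ *-monoʳ-≤ (0<ρ^ m) (ρ^≤1 (n ℕ.∸ m)) ⟩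
    ρ ^ m ℚ.* 1ℚ                 ≡⟨ ℚ.*-identityʳ (ρ ^ m) ⟩
    ρ ^ m                        ∎
    where open ℚ.≤-Reasoning

  0<1-ρ : 0ℚ ℚ.< 1ℚ ℚ.- ρ
  0<1-ρ = ≡.subst (ℚ._< 1ℚ ℚ.- ρ) (ℚ.+-inverseʳ ρ) (ℚ.+-monoˡ-< (ℚ.- ρ) ρ<1)

  -- The value G of the series ∑ K ρⁱ. It enters through the equation G = K + G ρ: a bound G ρⁿ⁺¹
  -- for what follows absorbs one more term K ρⁿ and becomes G ρⁿ, which closes the inductions over
  -- tails.
  geometric : ℚ → ℚ
  geometric K = K ℚ.* recip (1ℚ ℚ.- ρ)

  geometric-pos : ∀ {K} → 0ℚ ℚ.< K → 0ℚ ℚ.< geometric K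
  geometric-pos 0<K = *-pos 0<K (recip-pos 0<1-ρ)

  geometric-step : ∀ K → K ℚ.+ geometric K ℚ.* ρ ≡ geometric K
  geometric-step K = begin
    K ℚ.+ K ℚ.* r ℚ.* ρ
      ≡⟨ ≡.cong (ℚ._+ K ℚ.* r ℚ.* ρ) (≡.trans (≡.sym (ℚ.*-identityʳ K))
           (≡.cong (K ℚ.*_) (≡.sym (recip-inverse _ (≡.≢-sym (ℚ.<⇒≢ 0<1-ρ)))))) ⟩
    K ℚ.* ((1ℚ ℚ.- ρ) ℚ.* r) ℚ.+ K ℚ.* r ℚ.* ρ
      ≡⟨ solve 3 (λ K r ρ → K :* ((con 1ℚ :- ρ) :* r) :+ K :* r :* ρ := K :* r) ≡.refl K r ρ ⟩
    K ℚ.* r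
      ∎
    where
    open ≡.≡-Reasoning
    open +-*-Solver
    r = recip (1ℚ ℚ.- ρ)

  geometric-stepρ : ∀ K n → K ℚ.* ρ ^ n ℚ.+ geometric K ℚ.* ρ ^ suc n ≡ geometric K ℚ.* ρ ^ n
  geometric-stepρ K n = ≡.trans
    (solve 4 (λ K G ρ x → K :* x :+ G :* (ρ :* x) := (K :+ G :* ρ) :* x) ≡.refl
      K (geometric K) ρ (ρ ^ n))
    (≡.cong (ℚ._* ρ ^ n) (geometric-step K))
    where open +-*-Solver

  private
    d : ℚ
    d = 1ℚ ℚ.- ρ

    fromℕ : ℕ → ℚ
    fromℕ n = ℚ.mkℚ (ℤ.+ n) 0 (Coprimality.sym (Coprimality.1-coprimeTo n))

    fromℕ-suc : ∀ n → fromℕ (suc n) ≡ 1ℚ ℚ.+ fromℕ n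
    fromℕ-suc n = ≡.trans (≡.sym (ℚ.↥p/↧p≡p (fromℕ (suc n))))
      (≡.cong (λ i → (ℤ.1ℤ ℤ.+ i) ℚ./ 1) (≡.sym (ℤ.*-identityʳ (ℤ.+ n))))

    ≤fromℕ : ∀ p → p ℚ.≤ fromℕ ℤ.∣ ℚ.numerator p ∣
    ≤fromℕ (ℚ.mkℚ (ℤ.+ n)    d _) = ℚ.*≤* (≡.subst₂ ℤ._≤_
      (≡.sym (ℤ.*-identityʳ (ℤ.+ n))) (ℤ.pos-* n (suc d)) (ℤ.+≤+ (ℕ.m≤m*n n (suc d))))
    ≤fromℕ (ℚ.mkℚ ℤ.-[1+ n ] d _) = ℚ.*≤* ℤ.-≤+

    -- With ρ = 1 - d one has ρ (1 + (n + 1) d) = (1 + n d) - (n + 1) d².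
    bernoulli : ∀ n → ρ ^ n ℚ.* (1ℚ ℚ.+ fromℕ n ℚ.* d) ℚ.≤ 1ℚ
    bernoulli zero    = ℚ.≤-reflexive (≡.trans (ℚ.*-identityˡ _)
      (≡.trans (≡.cong (1ℚ ℚ.+_) (ℚ.*-zeroˡ d)) (ℚ.+-identityʳ 1ℚ)))
    bernoulli (suc n) = begin
      ρ ℚ.* ρ ^ n ℚ.* (1ℚ ℚ.+ fromℕ (suc n) ℚ.* d)
        ≡⟨ ≡.cong (λ k → ρ ℚ.* ρ ^ n ℚ.* (1ℚ ℚ.+ k ℚ.* d)) (fromℕ-suc n) ⟩
      ρ ℚ.* ρ ^ n ℚ.* (1ℚ ℚ.+ (1ℚ ℚ.+ fromℕ n) ℚ.* d)
        ≡⟨ solve 3 (λ r x k → r :* x :* (con 1ℚ :+ (con 1ℚ :+ k) :* (con 1ℚ :- r)) :=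
             x :* (con 1ℚ :+ k :* (con 1ℚ :- r)) :- (con 1ℚ :+ k) :* (x :* ((con 1ℚ :- r) :* (con 1ℚ :- r))))
             ≡.refl ρ (ρ ^ n) (fromℕ n) ⟩
      ρ ^ n ℚ.* (1ℚ ℚ.+ fromℕ n ℚ.* d) ℚ.- (1ℚ ℚ.+ fromℕ n) ℚ.* (ρ ^ n ℚ.* (d ℚ.* d))
        ≤⟨ ℚ.+-monoʳ-≤ (ρ ^ n ℚ.* (1ℚ ℚ.+ fromℕ n ℚ.* d))
             (ℚ.neg-antimono-≤ (ℚ.<⇒≤ (*-pos 0<1+n (*-pos (0<ρ^ n) (*-pos 0<1-ρ 0<1-ρ))))) ⟩
      ρ ^ n ℚ.* (1ℚ ℚ.+ fromℕ n ℚ.* d) ℚ.+ 0ℚ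
        ≡⟨ ℚ.+-identityʳ _ ⟩
      ρ ^ n ℚ.* (1ℚ ℚ.+ fromℕ n ℚ.* d)
        ≤⟨ bernoulli n ⟩
      1ℚ
        ∎
      where
      open ℚ.≤-Reasoning
      open +-*-Solver
      0<1+n : 0ℚ ℚ.< 1ℚ ℚ.+ fromℕ n
      0<1+n = ≡.subst (0ℚ ℚ.<_) (fromℕ-suc n) (ℚ.positive⁻¹ (fromℕ (suc n)))

  -- By Bernoulli's inequality ρᴺ N d ≤ 1, so any N ≥ K / (d ε) will do. The numerator of that
  -- rational is such an N, since its denominator is at least 1.
  ρ^-small : ∀ K ε → 0ℚ ℚ.< K → 0ℚ ℚ.< ε → ∃[ N ] ∀ n → N ℕ.≤ n → K ℚ.* ρ ^ n ℚ.≤ ε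
  ρ^-small K ε 0<K 0<ε = N , λ n N≤n → ℚ.≤-trans (*-monoʳ-≤ 0<K (ρ^-anti N≤n)) bound
    where
    open ℚ.≤-Reasoning
    open +-*-Solver
    t : ℚ
    t = recip (d ℚ.* ε)
    N : ℕ
    N = ℤ.∣ ℚ.numerator (K ℚ.* t) ∣
    0<dε : 0ℚ ℚ.< d ℚ.* ε
    0<dε = *-pos 0<1-ρ 0<ε
    bound : K ℚ.* ρ ^ N ℚ.≤ ε
    bound = begin
      K ℚ.* ρ ^ N
        ≡⟨ ℚ.*-identityʳ _ ⟨
      K ℚ.* ρ ^ N ℚ.* 1ℚ
        ≡⟨ ≡.cong (K ℚ.* ρ ^ N ℚ.*_) (recip-inverse _ (≡.≢-sym (ℚ.<⇒≢ 0<dε))) ⟨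
      K ℚ.* ρ ^ N ℚ.* (d ℚ.* ε ℚ.* t)
        ≡⟨ solve 5 (λ K x d e t → K :* x :* (d :* e :* t) := e :* (x :* (K :* t :* d)))
             ≡.refl K (ρ ^ N) d ε t ⟩
      ε ℚ.* (ρ ^ N ℚ.* (K ℚ.* t ℚ.* d))
        ≤⟨ *-monoʳ-≤ 0<ε (*-monoʳ-≤ (0<ρ^ N) (*-monoˡ-≤ 0<1-ρ (≤fromℕ (K ℚ.* t)))) ⟩
      ε ℚ.* (ρ ^ N ℚ.* (fromℕ N ℚ.* d))
        ≡⟨ ≡.cong (λ x → ε ℚ.* (ρ ^ N ℚ.* x)) (ℚ.+-identityˡ _) ⟨
      ε ℚ.* (ρ ^ N ℚ.* (0ℚ ℚ.+ fromℕ N ℚ.* d))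
        ≤⟨ *-monoʳ-≤ 0<ε (*-monoʳ-≤ (0<ρ^ N) (ℚ.+-monoˡ-≤ (fromℕ N ℚ.* d) (ℚ.<⇒≤ (ℚ.positive⁻¹ 1ℚ)))) ⟩
      ε ℚ.* (ρ ^ N ℚ.* (1ℚ ℚ.+ fromℕ N ℚ.* d))
        ≤⟨ *-monoʳ-≤ 0<ε (bernoulli N) ⟩
      ε ℚ.* 1ℚ
        ≡⟨ ℚ.*-identityʳ ε ⟩
      ε
        ∎

module NormedRing {c ℓ} (R : CommutativeRing c ℓ) (ρ : ℚ) where

  open CommutativeRing R
  open RawSemiringDefinitions ℚ.+-*-rawSemiring using (_^_)

  -- The norm of a complex number is a real number, so only its strict rational upper bounds are
  -- axiomatised. `1+≺` is an axiom beside `+≺` because a strict bound for `1#` exceeds 1, and such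
  -- an excess in every factor would spoil the bounds for long products. Completeness is asked for
  -- geometric rates only, and hands such a rate on to the limit.
  record Norm : Set (c ⊔ ℓ ⊔ lsuc 0ℓ) where
    infix 4 _≺_
    field
      _≺_        : Carrier → ℚ → Set
      ≺-resp-≈   : ∀ {x y r} → x ≈ y → x ≺ r → y ≺ r
      ≺-weaken   : ∀ {x r s} → r ℚ.≤ s → x ≺ r → x ≺ s
      ≺-pos      : ∀ {x r} → x ≺ r → 0ℚ ℚ.< r
      0≺         : ∀ {r} → 0ℚ ℚ.< r → 0# ≺ r
      1+≺        : ∀ {x r} → x ≺ r → 1# + x ≺ 1ℚ ℚ.+ r
      -≺         : ∀ {x r} → x ≺ r → - x ≺ r
      +≺         : ∀ {x y r s} → x ≺ r → y ≺ s → x + y ≺ r ℚ.+ s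
      *≺         : ∀ {x y r s} → x ≺ r → y ≺ s → x * y ≺ r ℚ.* s
      finite     : ∀ x → ∃[ r ] x ≺ r
      separated  : ∀ {x} → (∀ ε → 0ℚ ℚ.< ε → x ≺ ε) → x ≈ 0#
      complete   : ∀ (s : ℕ → Carrier) K → (∀ n k → s (n ℕ.+ k) - s n ≺ K ℚ.* ρ ^ n) →
                   ∃[ l ] ∃[ L ] ∀ n → s n - l ≺ L ℚ.* ρ ^ n

module Asymptotics {c ℓ} (R : CommutativeRing c ℓ)
  (ρ : ℚ) (0<ρ : 0ℚ ℚ.< ρ) (ρ<1 : ρ ℚ.< 1ℚ) (norm : NormedRing.Norm R ρ) where

  open CommutativeRing R
  open NormedRing.Norm norm public
  open ℚPowers ρ 0<ρ ρ<1
  open FiniteSums R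
  open IntegerSolver R

  -- The arbitrary index set makes the constant uniform in all parameters at once, as is needed when
  -- such bounds are summed over r + k = n.
  record O {I : Set} (e : I → ℕ) (u : I → Carrier) : Set where
    constructor mkO
    field
      constant : ℚ
      positive : 0ℚ ℚ.< constant
      bounded  : ∀ i → u i ≺ constant ℚ.* ρ ^ e i

  open O

  module _ {I : Set} where

    O-resp : ∀ {e : I → ℕ} {u w} → (∀ i → u i ≈ w i) → O e u → O e w
    O-resp u≈w (mkO K 0<K uK) = mkO K 0<K λ i → ≺-resp-≈ (u≈w i) (uK i)

    O-mono : ∀ {e f : I → ℕ} {u} → (∀ i → f i ℕ.≤ e i) → O e u → O f u
    O-mono f≤e (mkO K 0<K uK) = mkO K 0<K λ i → ≺-weaken (*-monoʳ-≤ 0<K (ρ^-anti (f≤e i))) (uK i)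

    O-+ : ∀ {e : I → ℕ} {u w} → O e u → O e w → O e (λ i → u i + w i)
    O-+ {e} (mkO K 0<K uK) (mkO L 0<L wL) = mkO (K ℚ.+ L) (ℚ.+-mono-< 0<K 0<L)
      λ i → ≺-weaken (ℚ.≤-reflexive (≡.sym (ℚ.*-distribʳ-+ (ρ ^ e i) K L))) (+≺ (uK i) (wL i))

    O-neg : ∀ {e : I → ℕ} {u} → O e u → O e (λ i → - u i)
    O-neg (mkO K 0<K uK) = mkO K 0<K λ i → -≺ (uK i)

    O-* : ∀ {e f : I → ℕ} {u w} → O e u → O f w → O (λ i → e i ℕ.+ f i) (λ i → u i * w i)
    O-* {e} {f} (mkO K 0<K uK) (mkO L 0<L wL) = mkO (K ℚ.* L) (*-pos 0<K 0<L)
      λ i → ≺-weaken (ℚ.≤-reflexive (≡.trans (regroup K (ρ ^ e i) L (ρ ^ f i))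
        (≡.cong (K ℚ.* L ℚ.*_) (≡.sym (ρ^+ (e i) (f i)))))) (*≺ (uK i) (wL i))
      where
      regroup : ∀ a b c d → a ℚ.* b ℚ.* (c ℚ.* d) ≡ a ℚ.* c ℚ.* (b ℚ.* d)
      regroup = Q.solve 4 (λ a b c d → a Q.:* b Q.:* (c Q.:* d) Q.:= a Q.:* c Q.:* (b Q.:* d)) ≡.refl
        where module Q = +-*-Solver

    O-const : ∀ x → O {I} (λ _ → 0) (λ _ → x)
    O-const x with finite x
    ... | r , x≺r = mkO r (≺-pos x≺r) λ _ → ≺-weaken (ℚ.≤-reflexive (≡.sym (ℚ.*-identityʳ r))) x≺r

    O-reindex : ∀ {J : Set} {e : J → ℕ} {u} (g : I → J) → O e u → O (λ i → e (g i)) (λ i → u (g i))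
    O-reindex g (mkO K 0<K uK) = mkO K 0<K λ i → uK (g i)

    -- On the line r + k = n the bound ρ^(r+(r+k)) is ρʳ ρⁿ: the first factor makes a geometric
    -- series, the second is the rate of the sum.
    O-∑Δ : ∀ {f : I → ℕ → ℕ → Carrier} →
      O {I × ℕ × ℕ} (λ (i , r , k) → r ℕ.+ (r ℕ.+ k)) (λ (i , r , k) → f i r k) →
      O {I × ℕ} (λ (i , n) → n) (λ (i , n) → ∑Δ n (f i))
    O-∑Δ {f} (mkO K 0<K fK) = mkO (geometric K) (geometric-pos 0<K) λ (i , n) →
      ≺-weaken (ℚ.≤-reflexive (≡.cong (ℚ._* ρ ^ n) (ℚ.*-identityʳ (geometric K))))
        (sum n n 0 (f i) λ r k r+k≡n →
          ≺-weaken (ℚ.≤-reflexive (bound r k n r+k≡n)) (fK (i , r , k)))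
      where
      module Q = +-*-Solver

      bound : ∀ r k n → r ℕ.+ k ≡ n → K ℚ.* ρ ^ (r ℕ.+ (r ℕ.+ k)) ≡ K ℚ.* ρ ^ (0 ℕ.+ r) ℚ.* ρ ^ n
      bound r k n ≡.refl = ≡.trans (≡.cong (K ℚ.*_) (ρ^+ r (r ℕ.+ k))) (≡.sym (ℚ.*-assoc K _ _))

      -- `n` shrinks during the induction while the rate `ρ ^ N` stays; `a` counts the terms already
      -- split off.
      sum : ∀ n N a g →
        (∀ r k → r ℕ.+ k ≡ n → g r k ≺ K ℚ.* ρ ^ (a ℕ.+ r) ℚ.* ρ ^ N) →
        ∑Δ n g ≺ geometric K ℚ.* ρ ^ a ℚ.* ρ ^ N
      sum zero N a g g≺ = ≺-weaken
        (*-monoˡ-≤ (0<ρ^ N) (≡.subst₂ ℚ._≤_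
          (≡.trans (ℚ.+-identityʳ _) (≡.cong (λ b → K ℚ.* ρ ^ b) (≡.sym (ℕ.+-identityʳ a))))
          (geometric-stepρ K a)
          (ℚ.+-monoʳ-≤ (K ℚ.* ρ ^ a) (ℚ.<⇒≤ (*-pos (geometric-pos 0<K) (0<ρ^ (suc a)))))))
        (g≺ 0 0 ≡.refl)
      sum (suc n) N a g g≺ = ≺-weaken
        (ℚ.≤-reflexive (≡.trans (≡.sym (ℚ.*-distribʳ-+ (ρ ^ N) (K ℚ.* ρ ^ (a ℕ.+ 0)) (geometric K ℚ.* ρ ^ suc a)))
          (≡.cong (ℚ._* ρ ^ N) (≡.trans
            (≡.cong (λ b → K ℚ.* ρ ^ b ℚ.+ geometric K ℚ.* ρ ^ suc a) (ℕ.+-identityʳ a))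
            (geometric-stepρ K a)))))
        (+≺ (g≺ 0 (suc n) ≡.refl)
          (sum n N (suc a) (λ r k → g (suc r) k) λ r k r+k≡n →
            ≡.subst (λ b → g (suc r) k ≺ K ℚ.* ρ ^ b ℚ.* ρ ^ N) (ℕ.+-suc a r)
              (g≺ (suc r) k (≡.cong suc r+k≡n))))

  -- This is how an equation between limits is proved: the difference does not depend on n and yet
  -- is O(ρⁿ).
  O⇒≈0 : ∀ {x} → O (λ n → n) (λ _ → x) → x ≈ 0#
  O⇒≈0 (mkO K 0<K x≺) = separated λ ε 0<ε →
    let N , small = ρ^-small K ε 0<K 0<ε in ≺-weaken (small N ℕ.≤-refl) (x≺ N)

  limit : ∀ {s : ℕ → Carrier} → O {ℕ × ℕ} (λ (n , k) → n) (λ (n , k) → s (n ℕ.+ k) - s n) →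
    ∃[ l ] O (λ n → n) (λ n → s n - l)
  limit {s} (mkO K 0<K sK) with complete s K (λ n k → sK (n , k))
  ... | l , L , sL = l , mkO L 0<L sL
    where
    0<L : 0ℚ ℚ.< L
    0<L = ≡.subst (0ℚ ℚ.<_) (ℚ.*-identityʳ L) (≺-pos (sL 0))

  module Products {u : ℕ → Carrier} (u-small : O (λ j → j) u) where

    tail : ℕ → ℕ → Carrier
    tail a k = ∏ k (λ i → 1# + u (a ℕ.+ i))

    private
      K κ : ℚ
      K = constant u-small
      κ = geometric K
      0<K = positive u-small
      0<κ = geometric-pos 0<K

      module Q = +-*-Solver

      tail-suc : ∀ a k → (1# + u a) * tail (suc a) k ≈ tail a (suc k)
      tail-suc a k = *-cong
        (+-congˡ (reflexive (≡.cong u (≡.sym (ℕ.+-identityʳ a)))))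
        (∏-cong k λ i → +-congˡ (reflexive (≡.cong u (≡.sym (ℕ.+-suc a i)))))

      1≺ : ∀ {r} → 1ℚ ℚ.< r → 1# ≺ r
      1≺ {r} 1<r = ≡.subst (1# ≺_) (regroup r) (≺-resp-≈ (+-identityʳ 1#)
        (1+≺ (0≺ (≡.subst (ℚ._< r ℚ.- 1ℚ) (ℚ.+-inverseʳ 1ℚ) (ℚ.+-monoˡ-< (ℚ.- 1ℚ) 1<r)))))
        where
        regroup : ∀ r → 1ℚ ℚ.+ (r ℚ.- 1ℚ) ≡ r
        regroup = Q.solve 1 (λ r → Q.con 1ℚ Q.:+ (r Q.:- Q.con 1ℚ) Q.:= r) ≡.refl

      1<1+ : ∀ {r} → 0ℚ ℚ.< r → 1ℚ ℚ.< 1ℚ ℚ.+ r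
      1<1+ {r} 0<r = ≡.subst (ℚ._< 1ℚ ℚ.+ r) (ℚ.+-identityʳ 1ℚ) (ℚ.+-monoʳ-< 1ℚ 0<r)

      -- With Kρᵃ + κρᵃ⁺¹ = κρᵃ and 2κρᵃ⁺¹ ≤ 1: (1 + Kρᵃ)(1 + 2κρᵃ⁺¹) ≤ 1 + 2κρᵃ.
      absorb : ∀ a → (κ ℚ.+ κ) ℚ.* ρ ^ suc a ℚ.≤ 1ℚ →
        (1ℚ ℚ.+ K ℚ.* ρ ^ a) ℚ.* (1ℚ ℚ.+ (κ ℚ.+ κ) ℚ.* ρ ^ suc a) ℚ.≤ 1ℚ ℚ.+ (κ ℚ.+ κ) ℚ.* ρ ^ a
      absorb a small = begin
        (1ℚ ℚ.+ k) ℚ.* (1ℚ ℚ.+ y)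
          ≡⟨ Q.solve 2 (λ k y → (Q.con 1ℚ Q.:+ k) Q.:* (Q.con 1ℚ Q.:+ y) Q.:=
               (Q.con 1ℚ Q.:+ k Q.:+ y) Q.:+ k Q.:* y) ≡.refl k y ⟩
        (1ℚ ℚ.+ k ℚ.+ y) ℚ.+ k ℚ.* y
          ≤⟨ ℚ.+-monoʳ-≤ (1ℚ ℚ.+ k ℚ.+ y) (*-monoʳ-≤ (*-pos 0<K (0<ρ^ a)) small) ⟩
        (1ℚ ℚ.+ k ℚ.+ y) ℚ.+ k ℚ.* 1ℚ
          ≡⟨ Q.solve 3 (λ k κ z → (Q.con 1ℚ Q.:+ k Q.:+ (κ Q.:+ κ) Q.:* z) Q.:+ k Q.:* Q.con 1ℚ Q.:=
               Q.con 1ℚ Q.:+ ((k Q.:+ κ Q.:* z) Q.:+ (k Q.:+ κ Q.:* z))) ≡.refl k κ (ρ ^ suc a) ⟩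
        1ℚ ℚ.+ ((k ℚ.+ κ ℚ.* ρ ^ suc a) ℚ.+ (k ℚ.+ κ ℚ.* ρ ^ suc a))
          ≡⟨ ≡.cong (λ x → 1ℚ ℚ.+ (x ℚ.+ x)) (geometric-stepρ K a) ⟩
        1ℚ ℚ.+ (κ ℚ.* ρ ^ a ℚ.+ κ ℚ.* ρ ^ a)
          ≡⟨ ≡.cong (1ℚ ℚ.+_) (ℚ.*-distribʳ-+ (ρ ^ a) κ κ) ⟨
        1ℚ ℚ.+ (κ ℚ.+ κ) ℚ.* ρ ^ a
          ∎
        where
        open ℚ.≤-Reasoning
        k = K ℚ.* ρ ^ a
        y = (κ ℚ.+ κ) ℚ.* ρ ^ suc a

      0<2κ : 0ℚ ℚ.< κ ℚ.+ κ
      0<2κ = ℚ.+-mono-< 0<κ 0<κ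

      abstract
        threshold : ∃[ N ] ∀ n → N ℕ.≤ n → (κ ℚ.+ κ) ℚ.* ρ ^ n ℚ.≤ 1ℚ
        threshold = ρ^-small (κ ℚ.+ κ) 1ℚ 0<2κ (ℚ.positive⁻¹ 1ℚ)

      -- Induction on the length, moving the start from a to a + 1. The doubled constant 2κ leaves
      -- room for the product of the two small terms in `absorb`, which from `threshold` on is at
      -- most K ρᵃ.
      late-tail : ∀ k a → proj₁ threshold ℕ.≤ a → tail a k ≺ 1ℚ ℚ.+ (κ ℚ.+ κ) ℚ.* ρ ^ a
      late-tail zero    a N≤a = 1≺ (1<1+ (*-pos 0<2κ (0<ρ^ a)))
      late-tail (suc k) a N≤a =
        ≺-weaken (absorb a (proj₂ threshold (suc a) (ℕ.m≤n⇒m≤1+n N≤a)))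
          (≺-resp-≈ (tail-suc a k) (*≺ (1+≺ (bounded u-small a))
            (late-tail k (suc a) (ℕ.m≤n⇒m≤1+n N≤a))))

      -- One bound serves all tails that start at a or later. The condition 1 < B is carried along
      -- for the empty tail, whose value must lie strictly below the bound.
      TailsBounded : ℕ → Set
      TailsBounded a = ∃[ B ] 1ℚ ℚ.< B × ∀ i k → tail (a ℕ.+ i) k ≺ B

      late-bounded : TailsBounded (proj₁ threshold)
      late-bounded = 1ℚ ℚ.+ (κ ℚ.+ κ) , 1<1+ 0<2κ , λ i k →
        ≺-weaken (ℚ.+-monoʳ-≤ 1ℚ (ℚ.≤-trans (*-monoʳ-≤ 0<2κ (ρ^≤1 (proj₁ threshold ℕ.+ i)))
                   (ℚ.≤-reflexive (ℚ.*-identityʳ (κ ℚ.+ κ)))))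
          (late-tail k _ (ℕ.m≤m+n _ i))

      -- Only finitely many starts precede the threshold, so each of them may cost a factor 1 + K.
      earlier : ∀ a → TailsBounded (suc a) → TailsBounded a
      earlier a (B , 1<B , tail≺) = B′ , ℚ.<-≤-trans 1<B B≤B′ , bound
        where
        B′ : ℚ
        B′ = (1ℚ ℚ.+ K) ℚ.* B

        B≤B′ : B ℚ.≤ B′
        B≤B′ = ≡.subst (ℚ._≤ B′) (ℚ.*-identityˡ B)
          (*-monoˡ-≤ (ℚ.<-trans (ℚ.positive⁻¹ 1ℚ) 1<B) (ℚ.<⇒≤ (1<1+ 0<K)))

        Kρ^a≤K : K ℚ.* ρ ^ a ℚ.≤ K
        Kρ^a≤K = ℚ.≤-trans (*-monoʳ-≤ 0<K (ρ^≤1 a)) (ℚ.≤-reflexive (ℚ.*-identityʳ K))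

        bound : ∀ i k → tail (a ℕ.+ i) k ≺ B′
        bound zero    zero    = 1≺ (ℚ.<-≤-trans 1<B B≤B′)
        bound zero    (suc k) = ≡.subst (λ b → tail b (suc k) ≺ B′) (≡.sym (ℕ.+-identityʳ a))
          (≺-resp-≈ (tail-suc a k)
            (*≺ (1+≺ (≺-weaken Kρ^a≤K (bounded u-small a)))
                (≡.subst (λ b → tail b k ≺ B) (ℕ.+-identityʳ (suc a)) (tail≺ 0 k))))
        bound (suc i) k       = ≡.subst (λ b → tail b k ≺ B′) (≡.sym (ℕ.+-suc a i))
          (≺-weaken B≤B′ (tail≺ i k))

      all-bounded : ∀ a → TailsBounded a → TailsBounded 0
      all-bounded zero    b = b
      all-bounded (suc a) b = all-bounded a (earlier a b)

      abstract
        uniform : TailsBounded 0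
        uniform = all-bounded (proj₁ threshold) late-bounded

      B : ℚ
      B = proj₁ uniform
      0<B : 0ℚ ℚ.< B
      0<B = ℚ.<-trans (ℚ.positive⁻¹ 1ℚ) (proj₁ (proj₂ uniform))
      tail≺B : ∀ a k → tail a k ≺ B
      tail≺B = proj₂ (proj₂ uniform)

    tail-bounded : O {ℕ × ℕ} (λ _ → 0) (λ (a , k) → tail a k)
    tail-bounded = mkO B 0<B λ (a , k) →
      ≺-weaken (ℚ.≤-reflexive (≡.sym (ℚ.*-identityʳ B))) (tail≺B a k)

    -- Splitting off the first factor changes `tail - 1#` by u(a) times a bounded tail, hence by at
    -- most K B ρᵃ. These changes are dominated by a geometric series, whatever the length k.
    tail-1 : O {ℕ × ℕ} (λ (a , k) → a) (λ (a , k) → tail a k - 1#)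
    tail-1 = mkO (geometric (K ℚ.* B)) 0<G λ (a , k) → bound a k
      where
      0<G : 0ℚ ℚ.< geometric (K ℚ.* B)
      0<G = geometric-pos (*-pos 0<K 0<B)

      bound : ∀ a k → tail a k - 1# ≺ geometric (K ℚ.* B) ℚ.* ρ ^ a
      bound a zero    = ≺-resp-≈ (sym (-‿inverseʳ 1#)) (0≺ (*-pos 0<G (0<ρ^ a)))
      bound a (suc k) = ≺-resp-≈ regroup
        (≺-weaken (ℚ.≤-reflexive (≡.trans (≡.cong (ℚ._+ G′) swap) (geometric-stepρ (K ℚ.* B) a)))
          (+≺ (*≺ (bounded u-small a) (tail≺B (suc a) k)) (bound (suc a) k)))
        where
        G′ : ℚ
        G′ = geometric (K ℚ.* B) ℚ.* ρ ^ suc a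
        swap : K ℚ.* ρ ^ a ℚ.* B ≡ K ℚ.* B ℚ.* ρ ^ a
        swap = Q.solve 3 (λ x y z → x Q.:* y Q.:* z Q.:= x Q.:* z Q.:* y) ≡.refl K (ρ ^ a) B
        regroup : u a * tail (suc a) k + (tail (suc a) k - 1#) ≈ tail a (suc k) - 1#
        regroup = trans
          (solve 2 (λ x t → x :* t :+ (t :- 𝟙) := (𝟙 :+ x) :* t :- 𝟙) refl _ _)
          (+-congʳ (tail-suc a k))

    difference : O {ℕ × ℕ} (λ (a , k) → a) (λ (a , k) → tail 0 (a ℕ.+ k) - tail 0 a)
    difference = O-resp (λ (a , k) → trans
        (solve 2 (λ x y → x :* (y :- 𝟙) := x :* y :- x) refl (tail 0 a) (tail a k))
        (+-congʳ (sym (∏-split a k (λ i → 1# + u i)))))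
      (O-* (O-reindex (λ (a , k) → 0 , a) tail-bounded) tail-1)

-- The identity in a complete normed ring

module Limits {c ℓ} (R : CommutativeRing c ℓ)
  (ρ : ℚ) (0<ρ : 0ℚ ℚ.< ρ) (ρ<1 : ρ ℚ.< 1ℚ) (norm : NormedRing.Norm R ρ) where

  open CommutativeRing R
  open RawSemiringDefinitions (Semiring.rawSemiring semiring) using (_^_; sum)
  open Exponentiation commutativeSemiring using (^-homo-*; ^-congʳ; ^-assocʳ; ^-congˡ; ^-distrib-*)
  open Asymptotics R ρ 0<ρ ρ<1 norm
  open FiniteSums R
  open IntegerSolver R
  open SetoidReasoning setoid

  module Pochhammer (x y : Carrier) (y^-small : O (λ n → n) (y ^_)) where

    factor-small : O (λ j → j) (λ j → - (x * y ^ j))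
    factor-small = O-neg (O-* (O-const x) y^-small)

    open Products factor-small public

    poch-bounded : O (λ _ → 0) (poch x y)
    poch-bounded = O-reindex (λ n → 0 , n) tail-bounded

    poch-limit : ∃[ l ] O (λ n → n) (λ n → poch x y n - l)
    poch-limit = limit difference

  module EulerProduct (x : Carrier) (x^-small : O (λ n → n) (x ^_)) (v : ℕ → Carrier)
    (v-inverse : ∀ n → (1# - x * x ^ n) * v n ≈ 1#) (v-bounded : O (λ _ → 0) v) where

    open Pochhammer x x x^-small using (tail; tail-1; poch-bounded; poch-limit)

    private
      -- As 1 / (1 - y) = 1 + y / (1 - y), the product of the reciprocals is again a product of
      -- factors 1 + O(ρʲ), and `Products` applies to it as well.
      v≈ : ∀ j → 1# + x * x ^ j * v j ≈ v j
      v≈ j = begin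
        1# + x * x ^ j * v j                          ≈⟨ +-congʳ (v-inverse j) ⟨
        (1# - x * x ^ j) * v j + x * x ^ j * v j
          ≈⟨ solve 2 (λ y v → (𝟙 :- y) :* v :+ y :* v := v) refl _ _ ⟩
        v j                                           ∎

      inverse-factor-small : O (λ j → j) (λ j → x * x ^ j * v j)
      inverse-factor-small = O-mono (λ j → ℕ.≤-reflexive (≡.sym (ℕ.+-identityʳ j)))
        (O-* (O-* (O-const x) x^-small) v-bounded)

      module I = Products inverse-factor-small

    I≈ : ∀ n → I.tail 0 n ≈ ∏ n v
    I≈ n = ∏-cong n v≈

    I-bounded : O (λ _ → 0) (λ n → ∏ n v)
    I-bounded = O-resp I≈ (O-reindex (λ n → 0 , n) I.tail-bounded)

    private
      I-difference : O {ℕ × ℕ} (λ (n , k) → n) (λ (n , k) → ∏ (n ℕ.+ k) v - ∏ n v)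
      I-difference = O-resp (λ (n , k) → +-cong (I≈ (n ℕ.+ k)) (-‿cong (I≈ n))) I.difference

    P I : ℕ → Carrier
    P = poch x x
    I n = ∏ n v

    P*I≈1 : ∀ n → P n * I n ≈ 1#
    P*I≈1 n = trans (sym (∏-* n (λ j → 1# - x * x ^ j) v)) (∏-1 n v-inverse)

    P∞ I∞ : Carrier
    P∞ = proj₁ poch-limit
    I∞ = proj₁ (limit I-difference)

    P→P∞ : O (λ n → n) (λ n → P n - P∞)
    P→P∞ = proj₂ poch-limit

    I→I∞ : O (λ n → n) (λ n → I n - I∞)
    I→I∞ = proj₂ (limit I-difference)

    P-bounded : O (λ _ → 0) P
    P-bounded = poch-bounded

    P∞*I∞≈1 : P∞ * I∞ ≈ 1#
    P∞*I∞≈1 = begin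
      P∞ * I∞               ≈⟨ solve 1 (λ x → x := (x :- 𝟙) :+ 𝟙) refl _ ⟩
      (P∞ * I∞ - 1#) + 1#   ≈⟨ +-congʳ (O⇒≈0 small) ⟩
      0# + 1#               ≈⟨ +-identityˡ 1# ⟩
      1#                    ∎
      where
      small : O (λ n → n) (λ _ → P∞ * I∞ - 1#)
      small = O-resp
        (λ n → begin
          - ((P n - P∞) * I n) + - (P∞ * (I n - I∞))
            ≈⟨ solve 4 (λ p i P I → :- ((p :- P) :* i) :+ :- (P :* (i :- I)) := P :* I :- p :* i) refl _ _ _ _ ⟩
          P∞ * I∞ - P n * I n
            ≈⟨ +-congˡ (-‿cong (P*I≈1 n)) ⟩
          P∞ * I∞ - 1#
            ∎)
        (O-+ (O-neg (O-mono (λ n → ℕ.≤-reflexive (≡.sym (ℕ.+-identityʳ n))) (O-* P→P∞ I-bounded)))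
             (O-neg (O-* (O-const P∞) I→I∞)))

    -- `I a` cancels the first a factors of `P` and leaves a tail that starts at a.
    P*I-1 : O {ℕ × ℕ} (λ (a , k) → a) (λ (a , k) → P (a ℕ.+ k) * I a - 1#)
    P*I-1 = O-resp (λ (a , k) → +-congʳ (sym (begin
        P (a ℕ.+ k) * I a
          ≈⟨ *-congʳ (∏-split a k (λ j → 1# - x * x ^ j)) ⟩
        P a * tail a k * I a
          ≈⟨ solve 3 (λ p t i → p :* t :* i := p :* i :* t) refl _ _ _ ⟩
        P a * I a * tail a k
          ≈⟨ *-congʳ (P*I≈1 a) ⟩
        1# * tail a k
          ≈⟨ *-identityˡ _ ⟩
        tail a k
          ∎))) tail-1

  -- Submultiplicativity would give only powers of a bound for `- 1#`, which may grow; but negation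
  -- preserves bounds.
  sign-bounded : O (λ _ → 0) ((- 1#) ^_)
  sign-bounded = mkO K 0<K bound
    where
    1-bounded : O {ℕ} (λ _ → 0) (λ _ → 1#)
    1-bounded = O-const 1#
    K = O.constant 1-bounded
    0<K = O.positive 1-bounded
    bound : ∀ n → (- 1#) ^ n ≺ K ℚ.* 1ℚ
    bound zero    = O.bounded 1-bounded 0
    bound (suc n) = ≺-resp-≈ (solve 1 (λ x → :- x := (:- 𝟙) :* x) refl _) (-≺ (bound n))

  module Identity (q : Carrier) (q^-small : O (λ n → n) (q ^_))
    (v₂ : ℕ → Carrier) (v₂-inverse : ∀ n → (1# - q ^ 2 * (q ^ 2) ^ n) * v₂ n ≈ 1#)
    (v₂-bounded : O (λ _ → 0) v₂)
    (v₆ : ℕ → Carrier) (v₆-inverse : ∀ n → (1# - q ^ 6 * (q ^ 6) ^ n) * v₆ n ≈ 1#)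
    (v₆-bounded : O (λ _ → 0) v₆)
    where

    powers-small : ∀ c → O (λ n → c ℕ.* n) ((q ^ c) ^_)
    powers-small c = O-resp (λ n → sym (^-assocʳ q c n)) (O-reindex (c ℕ.*_) q^-small)

    powers-small′ : ∀ c .{{_ : ℕ.NonZero c}} → O (λ n → n) ((q ^ c) ^_)
    powers-small′ c = O-mono (λ n → ℕ.m≤n*m n c) (powers-small c)

    open QSeries.Identities R q (q ^ 2) (*-congˡ (*-identityʳ q)) v₂ v₂-inverse
      using (X; J; θ; V; vandermonde; ∑J≈∑V; X*X*I≈J)
    open EulerProduct (q ^ 2) (powers-small′ 2) v₂ v₂-inverse v₂-bounded

    module E₆ = EulerProduct (q ^ 6) (powers-small′ 6) v₆ v₆-inverse v₆-bounded
    module Q₆ = QSeries.Identities R (q ^ 3) (q ^ 6) (^-homo-* q 3 3) v₆ v₆-inverse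
    module X₆ = Pochhammer (q ^ 3) (q ^ 6) (powers-small′ 6)

    -- `V n s` is the Vandermonde sum without its factor I(k). For m + k = n one has P(n) I(k) = 1 +
    -- O(ρᵏ), so inserting P(n) I(k) into each term costs O(ρ^(2m(m+s)+k)), and these errors add up
    -- to O(ρⁿ). The completed sum is P(n) I(n) I(n+s) = I(n+s), and neither its limit nor the rate
    -- depends on s.
    V→I∞ : O {ℕ × ℕ} (λ (s , n) → n) (λ (s , n) → V n s - I∞)
    V→I∞ = O-resp (λ (s , n) → solve 3 (λ v i I → (v :- i) :+ (i :- I) := v :- I) refl _ _ _)
      (O-+ (O-resp error (O-∑Δ term))
           (O-mono (λ (s , n) → ℕ.m≤m+n n s) (O-reindex (λ (s , n) → n ℕ.+ s) I→I∞)))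
      where
      c′ : ℕ → ℕ → Carrier
      c′ s m = (q ^ 2) ^ (m ℕ.* (m ℕ.+ s)) * (I m * I (m ℕ.+ s))

      term : O {ℕ × ℕ × ℕ} (λ (s , m , k) → m ℕ.+ (m ℕ.+ k))
        (λ (s , m , k) → - c′ s m * (P (k ℕ.+ m) * I k - 1#))
      term = O-mono {e = λ (s , m , k) → 2 ℕ.* (m ℕ.* (m ℕ.+ s)) ℕ.+ (0 ℕ.+ 0) ℕ.+ k}
        (λ (s , m , k) → exponent s m k)
        (O-* (O-neg (O-* (O-reindex (λ (s , m , k) → m ℕ.* (m ℕ.+ s)) (powers-small 2))
                         (O-* (O-reindex (λ (s , m , k) → m) I-bounded)
                              (O-reindex (λ (s , m , k) → m ℕ.+ s) I-bounded))))
             (O-reindex (λ (s , m , k) → k , m) P*I-1))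
        where
        exponent : ∀ s m k → m ℕ.+ (m ℕ.+ k) ℕ.≤ 2 ℕ.* (m ℕ.* (m ℕ.+ s)) ℕ.+ (0 ℕ.+ 0) ℕ.+ k
        exponent s zero    k = ℕ.≤-refl
        exponent s (suc m) k = ≡.subst (suc m ℕ.+ (suc m ℕ.+ k) ℕ.≤_) (regroup m s k) (ℕ.m≤m+n _ _)
          where
          regroup : ∀ m s k → suc m ℕ.+ (suc m ℕ.+ k) ℕ.+ 2 ℕ.* (suc m ℕ.* (m ℕ.+ s)) ≡
            2 ℕ.* (suc m ℕ.* (suc m ℕ.+ s)) ℕ.+ 0 ℕ.+ k
          regroup = solve-∀

      error : ∀ ((s , n) : ℕ × ℕ) →
        ∑Δ n (λ m k → - c′ s m * (P (k ℕ.+ m) * I k - 1#)) ≈ V n s - I (n ℕ.+ s)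
      error (s , n) = begin
        ∑Δ n (λ m k → - c′ s m * (P (k ℕ.+ m) * I k - 1#))
          ≈⟨ ∑Δ-cong n split ⟩
        ∑Δ n (λ m k → c′ s m + - P n * (c′ s m * I k))
          ≈⟨ ∑Δ-+ n (λ m _ → c′ s m) (λ m k → - P n * (c′ s m * I k)) ⟩
        V n s + ∑Δ n (λ m k → - P n * (c′ s m * I k))
          ≈⟨ +-congˡ (∑Δ-*ˡ n (- P n) (λ m k → c′ s m * I k)) ⟨
        V n s + - P n * ∑Δ n (λ m k → c′ s m * I k)
          ≈⟨ +-congˡ (*-congˡ (vandermonde n s)) ⟩
        V n s + - P n * (I n * I (n ℕ.+ s))
          ≈⟨ solve 4 (λ v p i j → v :+ (:- p) :* (i :* j) := v :- (p :* i) :* j) refl _ _ _ _ ⟩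
        V n s - (P n * I n) * I (n ℕ.+ s)
          ≈⟨ +-congˡ (-‿cong (trans (*-congʳ (P*I≈1 n)) (*-identityˡ _))) ⟩
        V n s - I (n ℕ.+ s)
          ∎
        where
        split : ∀ m k → m ℕ.+ k ≡ n →
          - c′ s m * (P (k ℕ.+ m) * I k - 1#) ≈ c′ s m + - P n * (c′ s m * I k)
        split m k m+k≡n = begin
          - c′ s m * (P (k ℕ.+ m) * I k - 1#)
            ≡⟨ ≡.cong (λ l → - c′ s m * (P l * I k - 1#)) (≡.trans (ℕ.+-comm k m) m+k≡n) ⟩
          - c′ s m * (P n * I k - 1#)
            ≈⟨ solve 3 (λ c p i → (:- c) :* (p :* i :- 𝟙) := c :+ (:- p) :* (c :* i)) refl _ _ _ ⟩
          c′ s m + - P n * (c′ s m * I k)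
            ∎

    -- Equal to (-1)ʳ q^(3r²), the theta term in base q³; Q^(r²) is the part of Q^(m²) that the
    -- substitution m = r + s sets free.
    t : ℕ → Carrier
    t r = (q ^ 2) ^ (r ℕ.* r) * θ r

    Θ : ℕ → Carrier
    Θ n = ∑Δ n (λ r _ → t r)

    -- Of the exponent 3r² only 2r is kept: with k from the other factor it makes the 2r + k that
    -- `O-∑Δ` asks for.
    t-small : O (λ r → 2 ℕ.* r) t
    t-small = O-mono (λ r → ℕ.≤-trans (exponent r) (ℕ.m≤m+n _ _))
      (O-* (O-reindex (λ r → r ℕ.* r) (powers-small 2))
           (O-* sign-bounded (O-reindex (λ r → r ℕ.* r) q^-small)))
      where
      exponent : ∀ r → 2 ℕ.* r ℕ.≤ 2 ℕ.* (r ℕ.* r)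
      exponent zero      = ℕ.z≤n
      exponent r@(suc _) = ℕ.*-monoʳ-≤ 2 (ℕ.m≤m*n r r)

    weighted-small : {f : ℕ → ℕ → Carrier} → O {ℕ × ℕ} (λ (r , k) → k) (λ (r , k) → f r k) →
      O (λ n → n) (λ n → ∑Δ n (λ r k → t r * f r k))
    weighted-small {f} f-small = O-reindex (λ n → 0 , n) (O-∑Δ {I = ℕ} {f = λ _ r k → t r * f r k}
      (O-mono (λ (_ , r , k) → ℕ.≤-reflexive (regroup r k))
        (O-* (O-reindex (λ (_ , r , k) → r) t-small) (O-reindex (λ (_ , r , k) → r , k) f-small))))
      where
      regroup : ∀ r k → r ℕ.+ (r ℕ.+ k) ≡ 2 ℕ.* r ℕ.+ k
      regroup = solve-∀

    ∑Δ-t-1 : ∀ n (f : ℕ → ℕ → Carrier) x →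
      ∑Δ n (λ r k → t r * (f r k - x)) ≈ ∑Δ n (λ r k → t r * f r k) - x * Θ n
    ∑Δ-t-1 n f x = begin
      ∑Δ n (λ r k → t r * (f r k - x))
        ≈⟨ ∑Δ-cong n (λ r k _ → solve 3 (λ t f x → t :* (f :- x) := t :* f :+ (:- x) :* t) refl _ _ _) ⟩
      ∑Δ n (λ r k → t r * f r k + - x * t r)
        ≈⟨ ∑Δ-+ n (λ r k → t r * f r k) (λ r _ → - x * t r) ⟩
      ∑Δ n (λ r k → t r * f r k) + ∑Δ n (λ r _ → - x * t r)
        ≈⟨ +-congˡ (∑Δ-*ˡ n (- x) (λ r _ → t r)) ⟨
      ∑Δ n (λ r k → t r * f r k) + - x * Θ n
        ≈⟨ +-congˡ (solve 2 (λ x y → (:- x) :* y := :- (x :* y)) refl _ _) ⟩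
      ∑Δ n (λ r k → t r * f r k) - x * Θ n
        ∎

    S : ℕ → Carrier
    S n = ∑Δ n (λ m _ → (q ^ 2) ^ (m ℕ.* m) * (X m * X m * I (m ℕ.+ m)))

    -- In `∑J≈∑V` every value of `V` is replaced by its limit `I∞`; the errors O(ρᵏ) are weighted by
    -- `t r`. Taking `I∞` out leaves the two-sided theta sum, where `1#` is the doubly counted term
    -- r = 0.
    S→ : O (λ n → n) (λ n → S n - I∞ * (Θ n + Θ n - 1#))
    S→ = O-resp error (O-+ (O-+ U-small U-small) (O-neg (O-reindex (λ n → 0 , n) V→I∞)))
      where
      U-small : O (λ n → n) (λ n → ∑Δ n (λ r k → t r * (V k (r ℕ.+ r) - I∞)))
      U-small = weighted-small (O-reindex (λ (r , k) → r ℕ.+ r , k) V→I∞)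

      error : ∀ n → (∑Δ n (λ r k → t r * (V k (r ℕ.+ r) - I∞)) + ∑Δ n (λ r k → t r * (V k (r ℕ.+ r) - I∞)))
        - (V n 0 - I∞) ≈ S n - I∞ * (Θ n + Θ n - 1#)
      error n = begin
        _ ≈⟨ +-congʳ (+-cong eq eq) ⟩
        ((U - I∞ * Θ n) + (U - I∞ * Θ n)) - (V n 0 - I∞)
          ≈⟨ solve 4 (λ u i θ v → ((u :- i :* θ) :+ (u :- i :* θ)) :- (v :- i) :=
               (u :+ u :- v) :- i :* (θ :+ θ :- 𝟙)) refl _ _ _ _ ⟩
        (U + U - V n 0) - I∞ * (Θ n + Θ n - 1#)
          ≈⟨ +-congʳ (trans (∑Δ-cong n (λ m _ _ → *-congˡ (X*X*I≈J m))) (∑J≈∑V n)) ⟨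
        S n - I∞ * (Θ n + Θ n - 1#)
          ∎
        where
        U : Carrier
        U = ∑Δ n (λ r k → t r * V k (r ℕ.+ r))
        eq = ∑Δ-t-1 n (λ r k → V k (r ℕ.+ r)) I∞

    t≈θ₆ : ∀ r → Q₆.θ r ≈ t r
    t≈θ₆ r = begin
      (- 1#) ^ r * (q ^ 3) ^ (r ℕ.* r)
        ≈⟨ *-congˡ (trans (^-congˡ (r ℕ.* r) (^-homo-* q 2 1)) (^-distrib-* (q ^ 2) (q ^ 1) (r ℕ.* r))) ⟩
      (- 1#) ^ r * ((q ^ 2) ^ (r ℕ.* r) * (q ^ 1) ^ (r ℕ.* r))
        ≈⟨ *-congˡ (*-congˡ (^-congˡ (r ℕ.* r) (*-identityʳ q))) ⟩
      (- 1#) ^ r * ((q ^ 2) ^ (r ℕ.* r) * q ^ (r ℕ.* r))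
        ≈⟨ solve 3 (λ a b c → a :* (b :* c) := b :* (a :* c)) refl _ _ _ ⟩
      t r
        ∎

    -- The terms of the finite triple product contain I₆(n+r) I₆(n-r). The product P₆(n) P₆(2n)
    -- turns both reciprocals into quotients close to 1, so that theta terms remain; on the other
    -- side P₆(2n) is used up by the triple product and P₆(n) survives.
    X₆*X₆*P₆→ : O (λ n → n) (λ n → Q₆.X n * Q₆.X n * E₆.P n - (Θ n + Θ n - 1#))
    X₆*X₆*P₆→ = O-resp error (O-+ (O-+ H-small H-small) (O-neg I-small))
      where
      open E₆ using () renaming (P to P₆; I to I₆)

      -- For n = r + k this is P₆(n) I₆(k) P₆(2n) I₆(n+r), written in r and k so that both pairs
      -- have the shape of `E₆.P*I-1`, with starts k and k + 2r.
      ratio : ℕ → ℕ → Carrier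
      ratio r k = P₆ (k ℕ.+ r) * I₆ k * (P₆ (k ℕ.+ r ℕ.+ r ℕ.+ k) * I₆ (k ℕ.+ r ℕ.+ r))

      ratio-1 : O {ℕ × ℕ} (λ (r , k) → k) (λ (r , k) → ratio r k - 1#)
      ratio-1 = O-resp (λ (r , k) → solve 2 (λ x y → ((x :- 𝟙) :* (y :- 𝟙) :+ (x :- 𝟙)) :+ (y :- 𝟙) := x :* y :- 𝟙)
          refl (P₆ (k ℕ.+ r) * I₆ k) (P₆ (k ℕ.+ r ℕ.+ r ℕ.+ k) * I₆ (k ℕ.+ r ℕ.+ r)))
        (O-+ (O-+ (O-mono (λ (r , k) → ℕ.m≤m+n k _) (O-* a b)) a) 
             (O-mono (λ (r , k) → ℕ.≤-trans (ℕ.m≤m+n k r) (ℕ.m≤m+n _ r)) b))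
        where
        a : O {ℕ × ℕ} (λ (r , k) → k) (λ (r , k) → P₆ (k ℕ.+ r) * I₆ k - 1#)
        a = O-reindex (λ (r , k) → k , r) E₆.P*I-1
        b : O {ℕ × ℕ} (λ (r , k) → k ℕ.+ r ℕ.+ r)
          (λ (r , k) → P₆ (k ℕ.+ r ℕ.+ r ℕ.+ k) * I₆ (k ℕ.+ r ℕ.+ r) - 1#)
        b = O-reindex (λ (r , k) → k ℕ.+ r ℕ.+ r , k) E₆.P*I-1

      H-small : O (λ n → n) (λ n → ∑Δ n (λ r k → t r * (ratio r k - 1#)))
      H-small = weighted-small ratio-1

      I-small : O (λ n → n) (λ n → P₆ (n ℕ.+ n) * I₆ n - 1#)
      I-small = O-reindex (λ n → n , n) E₆.P*I-1

      error : ∀ n → (∑Δ n (λ r k → t r * (ratio r k - 1#)) + ∑Δ n (λ r k → t r * (ratio r k - 1#))) -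
        (P₆ (n ℕ.+ n) * I₆ n - 1#) ≈ Q₆.X n * Q₆.X n * P₆ n - (Θ n + Θ n - 1#)
      error n = begin
        _ ≈⟨ +-cong (+-cong eq eq) (-‿cong (+-congʳ eq′)) ⟩
        ((p * H - 1# * Θ n) + (p * H - 1# * Θ n)) - (p * (I₆ n * I₆ n) - 1#)
          ≈⟨ solve 4 (λ p h i θ → ((p :* h :- 𝟙 :* θ) :+ (p :* h :- 𝟙 :* θ)) :- (p :* i :- 𝟙) :=
               p :* (h :+ h :- i) :- (θ :+ θ :- 𝟙)) refl p H _ (Θ n) ⟩
        p * Q₆.J n n - (Θ n + Θ n - 1#)
          ≈⟨ +-congʳ (solve 3 (λ x y z → x :* y :* z := (y :* z) :* x) refl _ _ _) ⟩
        P₆ (n ℕ.+ n) * Q₆.J n n * P₆ n - (Θ n + Θ n - 1#)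
          ≈⟨ +-congʳ (*-congʳ (Q₆.jacobi-triple-product n n)) ⟩
        Q₆.X n * Q₆.X n * P₆ n - (Θ n + Θ n - 1#)
          ∎
        where
        p H : Carrier
        p = P₆ n * P₆ (n ℕ.+ n)
        H = Q₆.H n n

        eq′ : P₆ (n ℕ.+ n) * I₆ n ≈ p * (I₆ n * I₆ n)
        eq′ = begin
          P₆ (n ℕ.+ n) * I₆ n                      ≈⟨ *-identityˡ _ ⟨
          1# * (P₆ (n ℕ.+ n) * I₆ n)               ≈⟨ *-congʳ (E₆.P*I≈1 n) ⟨
          P₆ n * I₆ n * (P₆ (n ℕ.+ n) * I₆ n)
            ≈⟨ solve 3 (λ a b i → a :* i :* (b :* i) := a :* b :* (i :* i)) refl _ _ _ ⟩
          p * (I₆ n * I₆ n)                        ∎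

        term : ∀ r k → r ℕ.+ k ≡ n → t r * ratio r k ≈ p * (Q₆.θ r * (I₆ (n ℕ.+ r) * I₆ k))
        term r k ≡.refl = begin
          t r * (P₆ (k ℕ.+ r) * I₆ k * (P₆ (k ℕ.+ r ℕ.+ r ℕ.+ k) * I₆ (k ℕ.+ r ℕ.+ r)))
            ≡⟨ ≡.cong₂ (λ m l → t r * (P₆ m * I₆ k * (P₆ l * I₆ (m ℕ.+ r)))) (ℕ.+-comm k r) (exponent r k) ⟩
          t r * (P₆ n * I₆ k * (P₆ (n ℕ.+ n) * I₆ (n ℕ.+ r)))
            ≈⟨ *-congʳ (t≈θ₆ r) ⟨
          Q₆.θ r * (P₆ n * I₆ k * (P₆ (n ℕ.+ n) * I₆ (n ℕ.+ r)))
            ≈⟨ solve 5 (λ t a i b j → t :* (a :* i :* (b :* j)) := a :* b :* (t :* (j :* i))) refl _ _ _ _ _ ⟩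
          p * (Q₆.θ r * (I₆ (n ℕ.+ r) * I₆ k))
            ∎
          where
          exponent : ∀ r k → k ℕ.+ r ℕ.+ r ℕ.+ k ≡ (r ℕ.+ k) ℕ.+ (r ℕ.+ k)
          exponent = solve-∀

        eq : ∑Δ n (λ r k → t r * (ratio r k - 1#)) ≈ p * H - 1# * Θ n
        eq = trans (∑Δ-t-1 n ratio 1#)
          (+-congʳ (trans (∑Δ-cong n term) (sym (∑Δ-*ˡ n p (λ r k → Q₆.θ r * (I₆ (n ℕ.+ r) * I₆ k))))))

    A B : Carrier
    A = proj₁ X₆.poch-limit
    B = E₆.P∞

    S-limit : O (λ n → n) (λ n → S n - A * A * B * I∞)
    S-limit = O-resp
      -- Here x² p - A² B is split as p (x + A) (x - A) + A² (p - B): each difference is O(ρⁿ) and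
      -- its cofactor is bounded.
      (λ n → solve 7 (λ s i z x p A B →
        (s :- i :* z) :+ ((:- i) :* (x :* x :* p :- z) :+
          ((i :* p :* (x :+ A)) :* (x :- A) :+ (i :* (A :* A)) :* (p :- B))) :=
        s :- A :* A :* B :* i) refl (S n) I∞ (Θ n + Θ n - 1#) (Q₆.X n) (E₆.P n) A B)
      (O-+ S→ (O-+ (O-* (O-const (- I∞)) X₆*X₆*P₆→)
        (O-+ (O-* (O-* (O-* (O-const I∞) E₆.P-bounded) (O-+ X₆.poch-bounded (O-const A))) (proj₂ X₆.poch-limit))
             (O-* (O-const (I∞ * (A * A))) E₆.P→P∞))))

    -- With y = Qⁿ the new factors are (1 - q y) (1 + q y) = 1 - Q^(2n+1) and 1 - q⁴ y² = 1 -
    -- Q^(2n+2), the two that lead from P(2n) to P(2n+2).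
    poch-split : ∀ n → X n * (poch (- q) (q ^ 2) n * poch (q ^ 4) (q ^ 4) n) ≈ P (n ℕ.+ n)
    poch-split zero = trans (*-identityˡ _) (*-identityˡ _)
    poch-split (suc n) = begin
      X (suc n) * (poch (- q) (q ^ 2) (suc n) * poch (q ^ 4) (q ^ 4) (suc n))
        ≈⟨ *-cong (∏-last n (λ j → 1# - q * (q ^ 2) ^ j))
             (*-cong (∏-last n (λ j → 1# - - q * (q ^ 2) ^ j)) (∏-last n (λ j → 1# - q ^ 4 * (q ^ 4) ^ j))) ⟩
      X n * (1# - q * y) * (poch (- q) (q ^ 2) n * (1# - - q * y) *
        (poch (q ^ 4) (q ^ 4) n * (1# - q ^ 4 * (q ^ 4) ^ n)))
        ≈⟨ *-congˡ (*-congˡ (*-congˡ (+-congˡ (-‿cong (*-cong (^-homo-* q 2 2) q⁴ⁿ≈y²))))) ⟩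
      X n * (1# - q * y) * (poch (- q) (q ^ 2) n * (1# - - q * y) *
        (poch (q ^ 4) (q ^ 4) n * (1# - q ^ 2 * q ^ 2 * (y * y))))
        ≈⟨ solve 6 (λ q y Q a b c →
             a :* (𝟙 :- q :* y) :* (b :* (𝟙 :- (:- q) :* y) :* (c :* (𝟙 :- Q :* Q :* (y :* y)))) :=
             a :* (b :* c) :* (𝟙 :- q :* q :* (y :* y)) :* (𝟙 :- Q :* (Q :* (y :* y))))
             refl q y (q ^ 2) _ _ _ ⟩
      X n * (poch (- q) (q ^ 2) n * poch (q ^ 4) (q ^ 4) n) *
        (1# - q * q * (y * y)) * (1# - q ^ 2 * (q ^ 2 * (y * y)))
        ≈⟨ *-cong (*-cong (poch-split n)
             (+-congˡ (-‿cong (*-cong (*-congˡ (sym (*-identityʳ q))) (sym (^-homo-* (q ^ 2) n n))))))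
             (+-congˡ (-‿cong (*-congˡ (*-congˡ (sym (^-homo-* (q ^ 2) n n)))))) ⟩
      P (n ℕ.+ n) * (1# - q ^ 2 * (q ^ 2) ^ (n ℕ.+ n)) * (1# - q ^ 2 * (q ^ 2) ^ suc (n ℕ.+ n))
        ≈⟨ *-congʳ (∏-last (n ℕ.+ n) (λ j → 1# - q ^ 2 * (q ^ 2) ^ j)) ⟨
      P (suc (n ℕ.+ n)) * (1# - q ^ 2 * (q ^ 2) ^ suc (n ℕ.+ n))
        ≈⟨ ∏-last (suc (n ℕ.+ n)) (λ j → 1# - q ^ 2 * (q ^ 2) ^ j) ⟨
      P (suc (suc (n ℕ.+ n)))
        ≡⟨ ≡.cong (λ k → P (suc k)) (ℕ.+-suc n n) ⟨
      P (suc n ℕ.+ suc n)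
        ∎
      where
      y : Carrier
      y = (q ^ 2) ^ n
      q⁴ⁿ≈y² : (q ^ 4) ^ n ≈ y * y
      q⁴ⁿ≈y² = trans (^-congˡ n (^-homo-* q 2 2)) (^-distrib-* (q ^ 2) (q ^ 2) n)

    summand : ∀ n w → (poch (- q) (q ^ 2) n * poch (q ^ 4) (q ^ 4) n) * w ≈ 1# →
      q ^ (2 ℕ.* n ℕ.^ 2) * X n * w ≈ (q ^ 2) ^ (n ℕ.* n) * (X n * X n * I (n ℕ.+ n))
    summand n w D*w≈1 = begin
      q ^ (2 ℕ.* n ℕ.^ 2) * X n * w
        ≈⟨ *-cong (*-congʳ (trans (^-congʳ q (≡.cong (2 ℕ.*_) (≡.cong (n ℕ.*_) (ℕ.*-identityʳ n))))
             (sym (^-assocʳ q 2 (n ℕ.* n))))) w≈ ⟩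
      (q ^ 2) ^ (n ℕ.* n) * X n * (X n * I (n ℕ.+ n))
        ≈⟨ solve 3 (λ a x i → a :* x :* (x :* i) := a :* (x :* x :* i)) refl _ _ _ ⟩
      (q ^ 2) ^ (n ℕ.* n) * (X n * X n * I (n ℕ.+ n))
        ∎
      where
      D : Carrier
      D = poch (- q) (q ^ 2) n * poch (q ^ 4) (q ^ 4) n
      w≈ : w ≈ X n * I (n ℕ.+ n)
      w≈ = begin
        w                                    ≈⟨ *-identityʳ w ⟨
        w * 1#                               ≈⟨ *-congˡ (P*I≈1 (n ℕ.+ n)) ⟨
        w * (P (n ℕ.+ n) * I (n ℕ.+ n))      ≈⟨ *-congˡ (*-congʳ (poch-split n)) ⟨
        w * (X n * D * I (n ℕ.+ n))
          ≈⟨ solve 4 (λ w x d i → w :* (x :* d :* i) := d :* w :* (x :* i)) refl _ _ _ _ ⟩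
        D * w * (X n * I (n ℕ.+ n))          ≈⟨ *-congʳ D*w≈1 ⟩
        1# * (X n * I (n ℕ.+ n))             ≈⟨ *-identityˡ _ ⟩
        X n * I (n ℕ.+ n)                    ∎

    series-limit : ∀ (t : ℕ → Carrier) →
      (∀ n → t n ≈ (q ^ 2) ^ (n ℕ.* n) * (X n * X n * I (n ℕ.+ n))) →
      O (λ n → n) (λ n → sum {suc n} (λ j → t (toℕ j)) - A * A * B * I∞)
    series-limit t t≈ = O-resp
      (λ n → +-congʳ (sym (trans (sum≈∑Δ n t) (∑Δ-cong n (λ m _ _ → t≈ m))))) S-limit

open import Defs

-- Real and complex numbers

module ℝProperties where

  private module Q = +-*-Solver

  ≈ℝ-eventually : ∀ x y N → (∀ n → N ℕ.≤ n → seq x n ≡ seq y n) → x ≈ℝ y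
  ≈ℝ-eventually x y N x≡y ε 0<ε = N , λ n N≤n →
    ≡.subst (λ d → ∣ d ∣ ℚ.< ε)
      (≡.sym (≡.trans (≡.cong (ℚ._- seq y n) (x≡y n N≤n)) (ℚ.+-inverseʳ (seq y n)))) 0<ε

  ≈ℝ-pointwise : ∀ x y → (∀ n → seq x n ≡ seq y n) → x ≈ℝ y
  ≈ℝ-pointwise x y x≡y = ≈ℝ-eventually x y 0 (λ n _ → x≡y n)

  ≈ℝ-refl : ∀ x → x ≈ℝ x
  ≈ℝ-refl x = ≈ℝ-pointwise x x (λ _ → ≡.refl)

  ≈ℝ-sym : ∀ x y → x ≈ℝ y → y ≈ℝ x
  ≈ℝ-sym x y x≈y ε 0<ε = let N , close = x≈y ε 0<ε in N , λ n N≤n →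
    ≡.subst (ℚ._< ε) (≡.trans (≡.sym (ℚ.∣-p∣≡∣p∣ (seq x n ℚ.- seq y n)))
      (≡.cong ∣_∣ (swap (seq x n) (seq y n)))) (close n N≤n)
    where
    swap : ∀ a b → ℚ.- (a ℚ.- b) ≡ b ℚ.- a
    swap = Q.solve 2 (λ a b → Q.:- (a Q.:- b) Q.:= b Q.:- a) ≡.refl

  ≈ℝ-trans : ∀ x y z → x ≈ℝ y → y ≈ℝ z → x ≈ℝ z
  ≈ℝ-trans x y z x≈y y≈z ε 0<ε =
    let M , xy = x≈y (half ε) (half-pos 0<ε)
        N , yz = y≈z (half ε) (half-pos 0<ε)
    in M ℕ.⊔ N , λ n ≤n →
    ≡.subst (λ d → ∣ d ∣ ℚ.< ε) (insert (seq x n) (seq y n) (seq z n))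
      (∣+∣-split (seq x n ℚ.- seq y n) (seq y n ℚ.- seq z n) ε
        (xy n (ℕ.m⊔n≤o⇒m≤o M N ≤n)) (yz n (ℕ.m⊔n≤o⇒n≤o M N ≤n)))
    where
    insert : ∀ a b c → (a ℚ.- b) ℚ.+ (b ℚ.- c) ≡ a ℚ.- c
    insert = Q.solve 3 (λ a b c → (a Q.:- b) Q.:+ (b Q.:- c) Q.:= a Q.:- c) ≡.refl

  +ℝ-cong : ∀ x x′ y y′ → x ≈ℝ x′ → y ≈ℝ y′ → x +ℝ y ≈ℝ x′ +ℝ y′
  +ℝ-cong x x′ y y′ x≈x′ y≈y′ ε 0<ε =
    let M , xM = x≈x′ (half ε) (half-pos 0<ε)
        N , yN = y≈y′ (half ε) (half-pos 0<ε)
    in M ℕ.⊔ N , λ n ≤n →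
    +-diff (seq x n) (seq y n) (seq x′ n) (seq y′ n) ε
      (xM n (ℕ.m⊔n≤o⇒m≤o M N ≤n)) (yN n (ℕ.m⊔n≤o⇒n≤o M N ≤n))

  -ℝ-cong : ∀ x y → x ≈ℝ y → -ℝ x ≈ℝ -ℝ y
  -ℝ-cong x y x≈y ε 0<ε = let N , close = x≈y ε 0<ε in N , λ n N≤n →
    ≡.subst (ℚ._< ε) (≡.trans (≡.sym (ℚ.∣-p∣≡∣p∣ (seq x n ℚ.- seq y n)))
      (≡.cong ∣_∣ (distribute (seq x n) (seq y n)))) (close n N≤n)
    where
    distribute : ∀ a b → ℚ.- (a ℚ.- b) ≡ ℚ.- a ℚ.- ℚ.- b
    distribute = Q.solve 2 (λ a b → Q.:- (a Q.:- b) Q.:= (Q.:- a) Q.:- (Q.:- b)) ≡.refl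

  *ℝ-cong : ∀ x x′ y y′ → x ≈ℝ x′ → y ≈ℝ y′ → x *ℝ y ≈ℝ x′ *ℝ y′
  *ℝ-cong x x′ y y′ x≈x′ y≈y′ ε 0<ε =
    let A , 0<A , K , xK = eventually-bounded x
        B , 0<B , L , yL = eventually-bounded y′
        M , xM = x≈x′ (half ε ℚ.* recip B) (*-pos (half-pos 0<ε) (recip-pos 0<B))
        N , yN = y≈y′ (half ε ℚ.* recip A) (*-pos (half-pos 0<ε) (recip-pos 0<A))
    in (K ℕ.⊔ L) ℕ.⊔ (M ℕ.⊔ N) , λ n ≤n →
    let KL≤n = ℕ.m⊔n≤o⇒m≤o (K ℕ.⊔ L) (M ℕ.⊔ N) ≤n
        MN≤n = ℕ.m⊔n≤o⇒n≤o (K ℕ.⊔ L) (M ℕ.⊔ N) ≤n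
    in *-diff (seq x n) (seq y n) (seq x′ n) (seq y′ n) A B ε 0<A 0<B
      (xK n (ℕ.m⊔n≤o⇒m≤o K L KL≤n)) (yL n (ℕ.m⊔n≤o⇒n≤o K L KL≤n))
      (xM n (ℕ.m⊔n≤o⇒m≤o M N MN≤n)) (yN n (ℕ.m⊔n≤o⇒n≤o M N MN≤n))

module ℂRing where

  open ℝProperties
  private module Q = +-*-Solver

  -- The ring operations act termwise on the representing sequences, so each ring law reduces to an
  -- identity between rationals at every index.
  ≈-pointwise : ∀ z w → (∀ n → seq (re z) n ≡ seq (re w) n) → (∀ n → seq (im z) n ≡ seq (im w) n) → z ≈ w
  ≈-pointwise z w re≡ im≡ = ≈ℝ-pointwise (re z) (re w) re≡ , ≈ℝ-pointwise (im z) (im w) im≡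

  private
    r i : ℂ → ℕ → ℚ
    r z = seq (re z)
    i z = seq (im z)

  ≈-refl : ∀ {z} → z ≈ z
  ≈-refl {z} = ≈ℝ-refl (re z) , ≈ℝ-refl (im z)

  ≈-sym : ∀ {z w} → z ≈ w → w ≈ z
  ≈-sym {z} {w} (re≈ , im≈) = ≈ℝ-sym (re z) (re w) re≈ , ≈ℝ-sym (im z) (im w) im≈

  ≈-trans : ∀ {z w u} → z ≈ w → w ≈ u → z ≈ u
  ≈-trans {z} {w} {u} (re≈ , im≈) (re≈′ , im≈′) =
    ≈ℝ-trans (re z) (re w) (re u) re≈ re≈′ , ≈ℝ-trans (im z) (im w) (im u) im≈ im≈′

  +-cong : ∀ {z z′ w w′} → z ≈ z′ → w ≈ w′ → z + w ≈ z′ + w′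
  +-cong {z} {z′} {w} {w′} (re≈ , im≈) (re≈′ , im≈′) =
    +ℝ-cong (re z) (re z′) (re w) (re w′) re≈ re≈′ , +ℝ-cong (im z) (im z′) (im w) (im w′) im≈ im≈′

  -‿cong : ∀ {z w} → z ≈ w → - z ≈ - w
  -‿cong {z} {w} (re≈ , im≈) = -ℝ-cong (re z) (re w) re≈ , -ℝ-cong (im z) (im w) im≈

  *-cong : ∀ {z z′ w w′} → z ≈ z′ → w ≈ w′ → z * w ≈ z′ * w′
  *-cong {a +i b} {a′ +i b′} {c +i d} {c′ +i d′} (a≈ , b≈) (c≈ , d≈) =
    +ℝ-cong (a *ℝ c) (a′ *ℝ c′) (-ℝ (b *ℝ d)) (-ℝ (b′ *ℝ d′))
      (*ℝ-cong a a′ c c′ a≈ c≈) (-ℝ-cong (b *ℝ d) (b′ *ℝ d′) (*ℝ-cong b b′ d d′ b≈ d≈)) ,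
    +ℝ-cong (a *ℝ d) (a′ *ℝ d′) (b *ℝ c) (b′ *ℝ c′)
      (*ℝ-cong a a′ d d′ a≈ d≈) (*ℝ-cong b b′ c c′ b≈ c≈)

  +-assoc : ∀ z w u → (z + w) + u ≈ z + (w + u)
  +-assoc z w u = ≈-pointwise ((z + w) + u) (z + (w + u))
    (λ n → ℚ.+-assoc (r z n) (r w n) (r u n)) (λ n → ℚ.+-assoc (i z n) (i w n) (i u n))

  +-comm : ∀ z w → z + w ≈ w + z
  +-comm z w = ≈-pointwise (z + w) (w + z) (λ n → ℚ.+-comm (r z n) (r w n)) (λ n → ℚ.+-comm (i z n) (i w n))

  +-identityˡ : ∀ z → 0ℂ + z ≈ z
  +-identityˡ z = ≈-pointwise (0ℂ + z) (z) (λ n → ℚ.+-identityˡ (r z n)) (λ n → ℚ.+-identityˡ (i z n))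

  -‿inverseˡ : ∀ z → - z + z ≈ 0ℂ
  -‿inverseˡ z = ≈-pointwise (- z + z) (0ℂ) (λ n → ℚ.+-inverseˡ (r z n)) (λ n → ℚ.+-inverseˡ (i z n))

  *-assoc : ∀ z w u → (z * w) * u ≈ z * (w * u)
  *-assoc z w u = ≈-pointwise ((z * w) * u) (z * (w * u))
    (λ n → Q.solve 6 (λ a b c d e f →
      (a Q.:* c Q.:- b Q.:* d) Q.:* e Q.:- (a Q.:* d Q.:+ b Q.:* c) Q.:* f Q.:=
      a Q.:* (c Q.:* e Q.:- d Q.:* f) Q.:- b Q.:* (c Q.:* f Q.:+ d Q.:* e)) ≡.refl
      (r z n) (i z n) (r w n) (i w n) (r u n) (i u n))
    (λ n → Q.solve 6 (λ a b c d e f →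
      (a Q.:* c Q.:- b Q.:* d) Q.:* f Q.:+ (a Q.:* d Q.:+ b Q.:* c) Q.:* e Q.:=
      a Q.:* (c Q.:* f Q.:+ d Q.:* e) Q.:+ b Q.:* (c Q.:* e Q.:- d Q.:* f)) ≡.refl
      (r z n) (i z n) (r w n) (i w n) (r u n) (i u n))

  *-comm : ∀ z w → z * w ≈ w * z
  *-comm z w = ≈-pointwise (z * w) (w * z)
    (λ n → Q.solve 4 (λ a b c d → a Q.:* c Q.:- b Q.:* d Q.:= c Q.:* a Q.:- d Q.:* b) ≡.refl
      (r z n) (i z n) (r w n) (i w n))
    (λ n → Q.solve 4 (λ a b c d → a Q.:* d Q.:+ b Q.:* c Q.:= c Q.:* b Q.:+ d Q.:* a) ≡.refl
      (r z n) (i z n) (r w n) (i w n))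

  *-identityˡ : ∀ z → 1ℂ * z ≈ z
  *-identityˡ z = ≈-pointwise (1ℂ * z) (z)
    (λ n → Q.solve 2 (λ a b → Q.con 1ℚ Q.:* a Q.:- Q.con 0ℚ Q.:* b Q.:= a) ≡.refl (r z n) (i z n))
    (λ n → Q.solve 2 (λ a b → Q.con 1ℚ Q.:* b Q.:+ Q.con 0ℚ Q.:* a Q.:= b) ≡.refl (r z n) (i z n))

  distribʳ : ∀ u z w → (z + w) * u ≈ z * u + w * u
  distribʳ u z w = ≈-pointwise ((z + w) * u) (z * u + w * u)
    (λ n → Q.solve 6 (λ a b c d e f →
      (a Q.:+ c) Q.:* e Q.:- (b Q.:+ d) Q.:* f Q.:=
      (a Q.:* e Q.:- b Q.:* f) Q.:+ (c Q.:* e Q.:- d Q.:* f)) ≡.refl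
      (r z n) (i z n) (r w n) (i w n) (r u n) (i u n))
    (λ n → Q.solve 6 (λ a b c d e f →
      (a Q.:+ c) Q.:* f Q.:+ (b Q.:+ d) Q.:* e Q.:=
      (a Q.:* f Q.:+ b Q.:* e) Q.:+ (c Q.:* f Q.:+ d Q.:* e)) ≡.refl
      (r z n) (i z n) (r w n) (i w n) (r u n) (i u n))

  isEquivalence : IsEquivalence _≈_
  isEquivalence = record
    { refl  = λ {z} → ≈-refl {z}
    ; sym   = λ {z} {w} → ≈-sym {z} {w}
    ; trans = λ {z} {w} {u} → ≈-trans {z} {w} {u}
    }

  +-identityʳ : ∀ z → z + 0ℂ ≈ z
  +-identityʳ z = ≈-trans {z + 0ℂ} {0ℂ + z} {z} (+-comm z 0ℂ) (+-identityˡ z)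

  -‿inverseʳ : ∀ z → z + - z ≈ 0ℂ
  -‿inverseʳ z = ≈-trans {z + - z} { - z + z} {0ℂ} (+-comm z (- z)) (-‿inverseˡ z)

  *-identityʳ : ∀ z → z * 1ℂ ≈ z
  *-identityʳ z = ≈-trans {z * 1ℂ} {1ℂ * z} {z} (*-comm z 1ℂ) (*-identityˡ z)

  distribˡ : ∀ u z w → u * (z + w) ≈ u * z + u * w
  distribˡ u z w = ≈-trans {u * (z + w)} {(z + w) * u} {u * z + u * w} (*-comm u (z + w))
    (≈-trans {(z + w) * u} {z * u + w * u} {u * z + u * w} (distribʳ u z w)
      (+-cong {z * u} {u * z} {w * u} {u * w} (*-comm z u) (*-comm w u)))

  -- Without opacity, conversion checking descends into the Cauchy proofs inside
  -- complex numbers whenever two terms differ only up to unfolding.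
  infix  4 _≋_
  infixl 6 _⊕_
  infixl 7 _⊗_
  infix  8 ⊖_

  opaque
    _≋_ : ℂ → ℂ → Set
    _≋_ = _≈_

    _⊕_ _⊗_ : ℂ → ℂ → ℂ
    _⊕_ = _+_
    _⊗_ = _*_

    ⊖_ : ℂ → ℂ
    ⊖_ = -_

    𝟘 𝟙 : ℂ
    𝟘 = 0ℂ
    𝟙 = 1ℂ

    ≈⇒≋ : ∀ {z w} → z ≈ w → z ≋ w
    ≈⇒≋ z≈w = z≈w

    ≋⇒≈ : ∀ {z w} → z ≋ w → z ≈ w
    ≋⇒≈ z≋w = z≋w

    *≋⊗ : ∀ z w → z * w ≋ z ⊗ w
    *≋⊗ z w = ≈-refl {z * w}

    -≋⊖ : ∀ z → - z ≋ ⊖ z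
    -≋⊖ z = ≈-refl { - z}

    0≋𝟘 : 0ℂ ≋ 𝟘
    0≋𝟘 = ≈-refl {0ℂ}

    1≋𝟙 : 1ℂ ≋ 𝟙
    1≋𝟙 = ≈-refl {1ℂ}

    ⊕-⊗-isCommutativeRing : IsCommutativeRing _≋_ _⊕_ _⊗_ ⊖_ 𝟘 𝟙
    ⊕-⊗-isCommutativeRing = record
      { isRing = record
        { +-isAbelianGroup = record
          { isGroup = record
            { isMonoid = record
              { isSemigroup = record
                { isMagma = record
                  { isEquivalence = isEquivalence
                  ; ∙-cong = λ {z} {z′} {w} {w′} → +-cong {z} {z′} {w} {w′}
                  }
                ; assoc = +-assoc
                }
              ; identity = +-identityˡ , +-identityʳ
              }
            ; inverse = -‿inverseˡ , -‿inverseʳ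
            ; ⁻¹-cong = λ {z} {w} → -‿cong {z} {w}
            }
          ; comm = +-comm
          }
        ; *-cong = λ {z} {z′} {w} {w′} → *-cong {z} {z′} {w} {w′}
        ; *-assoc = *-assoc
        ; *-identity = *-identityˡ , *-identityʳ
        ; distrib = distribˡ , distribʳ
        }
      ; *-comm = *-comm
      }

  ℂ-commutativeRing : CommutativeRing 0ℓ 0ℓ
  ℂ-commutativeRing = record { isCommutativeRing = ⊕-⊗-isCommutativeRing }

-- The ℓ¹ norm on ℂ and its completeness

module ℓ¹Norm where

  open ℂRing
  private module Q = +-*-Solver
  open ℚ.≤-Reasoning

  -- The ℓ¹ norm is used instead of the absolute value: it is submultiplicative,
  -- it takes rational values, and ∣z∣ ≤ ∥z∥ ≤ 2∣z∣.
  ∥_,_∥ : ℚ → ℚ → ℚ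
  ∥ a , b ∥ = ∣ a ∣ ℚ.+ ∣ b ∣

  0≤∥∥ : ∀ a b → 0ℚ ℚ.≤ ∥ a , b ∥
  0≤∥∥ a b = ℚ.+-mono-≤ (ℚ.0≤∣p∣ a) (ℚ.0≤∣p∣ b)

  0≤* : ∀ {a b} → 0ℚ ℚ.≤ a → 0ℚ ℚ.≤ b → 0ℚ ℚ.≤ a ℚ.* b
  0≤* {a} {b} 0≤a 0≤b = ≡.subst (ℚ._≤ a ℚ.* b) (ℚ.*-zeroˡ b) (*-mono-≤ {0ℚ} {b} {a} {b} 0≤b 0≤a 0≤a ℚ.≤-refl)

  ∣a∣*∣a∣≡a*a : ∀ a → ∣ a ∣ ℚ.* ∣ a ∣ ≡ a ℚ.* a
  ∣a∣*∣a∣≡a*a a with ℚ.∣p∣≡p∨∣p∣≡-p a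
  ... | inj₁ eq = ≡.cong₂ ℚ._*_ eq eq
  ... | inj₂ eq = ≡.trans (≡.cong₂ ℚ._*_ eq eq)
    (Q.solve 1 (λ a → (Q.:- a) Q.:* (Q.:- a) Q.:= a Q.:* a) ≡.refl a)

  0≤a*a : ∀ a → 0ℚ ℚ.≤ a ℚ.* a
  0≤a*a a = ≡.subst (0ℚ ℚ.≤_) (∣a∣*∣a∣≡a*a a) (0≤* (ℚ.0≤∣p∣ a) (ℚ.0≤∣p∣ a))

  a≤a+b : ∀ a {b} → 0ℚ ℚ.≤ b → a ℚ.≤ a ℚ.+ b
  a≤a+b a {b} 0≤b = ≡.subst (ℚ._≤ a ℚ.+ b) (ℚ.+-identityʳ a) (ℚ.+-monoʳ-≤ a 0≤b)

  b≤a+b : ∀ {a} b → 0ℚ ℚ.≤ a → b ℚ.≤ a ℚ.+ b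
  b≤a+b {a} b 0≤a = ≡.subst (ℚ._≤ a ℚ.+ b) (ℚ.+-identityˡ b) (ℚ.+-monoˡ-≤ b 0≤a)

  a*a≤b*b⇒a≤b : ∀ {a b} → 0ℚ ℚ.≤ b → a ℚ.* a ℚ.≤ b ℚ.* b → a ℚ.≤ b
  a*a≤b*b⇒a≤b {a} {b} 0≤b a²≤b² = ℚ.≮⇒≥ λ b<a → ℚ.<-irrefl ≡.refl (begin-strict
    a ℚ.* a  ≤⟨ a²≤b² ⟩
    b ℚ.* b  ≤⟨ ℚ.*-monoˡ-≤-nonNeg b {{ℚ.nonNegative 0≤b}} (ℚ.<⇒≤ b<a) ⟩
    b ℚ.* a  <⟨ ℚ.*-monoˡ-<-pos a {{ℚ.positive (ℚ.≤-<-trans 0≤b b<a)}} b<a ⟩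
    a ℚ.* a  ∎)

  ∥+∥ : ∀ a b c d → ∥ a ℚ.+ c , b ℚ.+ d ∥ ℚ.≤ ∥ a , b ∥ ℚ.+ ∥ c , d ∥
  ∥+∥ a b c d = begin
    ∣ a ℚ.+ c ∣ ℚ.+ ∣ b ℚ.+ d ∣                      ≤⟨ ℚ.+-mono-≤ (ℚ.∣p+q∣≤∣p∣+∣q∣ a c) (ℚ.∣p+q∣≤∣p∣+∣q∣ b d) ⟩
    (∣ a ∣ ℚ.+ ∣ c ∣) ℚ.+ (∣ b ∣ ℚ.+ ∣ d ∣)
      ≡⟨ Q.solve 4 (λ a b c d → (a Q.:+ c) Q.:+ (b Q.:+ d) Q.:=
           (a Q.:+ b) Q.:+ (c Q.:+ d)) ≡.refl (∣ a ∣) (∣ b ∣) (∣ c ∣) (∣ d ∣) ⟩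
    ∥ a , b ∥ ℚ.+ ∥ c , d ∥                          ∎

  ∥-∥ : ∀ a b → ∥ ℚ.- a , ℚ.- b ∥ ≡ ∥ a , b ∥
  ∥-∥ a b = ≡.cong₂ ℚ._+_ (ℚ.∣-p∣≡∣p∣ a) (ℚ.∣-p∣≡∣p∣ b)

  ∥*∥ : ∀ a b c d → ∥ a ℚ.* c ℚ.- b ℚ.* d , a ℚ.* d ℚ.+ b ℚ.* c ∥ ℚ.≤ ∥ a , b ∥ ℚ.* ∥ c , d ∥
  ∥*∥ a b c d = begin
    ∣ a ℚ.* c ℚ.- b ℚ.* d ∣ ℚ.+ ∣ a ℚ.* d ℚ.+ b ℚ.* c ∣
      ≤⟨ ℚ.+-mono-≤ (ℚ.∣p-q∣≤∣p∣+∣q∣ (a ℚ.* c) (b ℚ.* d)) (ℚ.∣p+q∣≤∣p∣+∣q∣ (a ℚ.* d) (b ℚ.* c)) ⟩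
    (∣ a ℚ.* c ∣ ℚ.+ ∣ b ℚ.* d ∣) ℚ.+ (∣ a ℚ.* d ∣ ℚ.+ ∣ b ℚ.* c ∣)
      ≡⟨ ≡.cong₂ ℚ._+_ (≡.cong₂ ℚ._+_ (ℚ.∣p*q∣≡∣p∣*∣q∣ a c) (ℚ.∣p*q∣≡∣p∣*∣q∣ b d))
                       (≡.cong₂ ℚ._+_ (ℚ.∣p*q∣≡∣p∣*∣q∣ a d) (ℚ.∣p*q∣≡∣p∣*∣q∣ b c)) ⟩
    (∣ a ∣ ℚ.* ∣ c ∣ ℚ.+ ∣ b ∣ ℚ.* ∣ d ∣) ℚ.+ (∣ a ∣ ℚ.* ∣ d ∣ ℚ.+ ∣ b ∣ ℚ.* ∣ c ∣)
      ≡⟨ Q.solve 4 (λ a b c d → (a Q.:* c Q.:+ b Q.:* d) Q.:+ (a Q.:* d Q.:+ b Q.:* c) Q.:=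
           (a Q.:+ b) Q.:* (c Q.:+ d)) ≡.refl (∣ a ∣) (∣ b ∣) (∣ c ∣) (∣ d ∣) ⟩
    ∥ a , b ∥ ℚ.* ∥ c , d ∥
      ∎

  sq : ℚ → ℚ → ℚ
  sq a b = a ℚ.* a ℚ.+ b ℚ.* b

  0≤sq : ∀ a b → 0ℚ ℚ.≤ sq a b
  0≤sq a b = ℚ.+-mono-≤ (0≤a*a a) (0≤a*a b)

  sq≤∥∥² : ∀ a b → sq a b ℚ.≤ ∥ a , b ∥ ℚ.* ∥ a , b ∥
  sq≤∥∥² a b = begin
    a ℚ.* a ℚ.+ b ℚ.* b
      ≡⟨ ≡.cong₂ ℚ._+_ (∣a∣*∣a∣≡a*a a) (∣a∣*∣a∣≡a*a b) ⟨
    ∣ a ∣ ℚ.* ∣ a ∣ ℚ.+ ∣ b ∣ ℚ.* ∣ b ∣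
      ≤⟨ a≤a+b _ (ℚ.+-mono-≤ 0≤ab 0≤ab) ⟩
    ∣ a ∣ ℚ.* ∣ a ∣ ℚ.+ ∣ b ∣ ℚ.* ∣ b ∣ ℚ.+ (∣ a ∣ ℚ.* ∣ b ∣ ℚ.+ ∣ a ∣ ℚ.* ∣ b ∣)
      ≡⟨ Q.solve 2 (λ a b → a Q.:* a Q.:+ b Q.:* b Q.:+ (a Q.:* b Q.:+ a Q.:* b) Q.:=
           (a Q.:+ b) Q.:* (a Q.:+ b)) ≡.refl (∣ a ∣) (∣ b ∣) ⟩
    ∥ a , b ∥ ℚ.* ∥ a , b ∥
      ∎
    where
    0≤ab : 0ℚ ℚ.≤ ∣ a ∣ ℚ.* ∣ b ∣
    0≤ab = 0≤* (ℚ.0≤∣p∣ a) (ℚ.0≤∣p∣ b)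

  sq-swap : ∀ a b → sq a b ≡ sq b a
  sq-swap a b = ℚ.+-comm (a ℚ.* a) (b ℚ.* b)

  sq-* : ∀ a b c d → sq (a ℚ.* c ℚ.- b ℚ.* d) (a ℚ.* d ℚ.+ b ℚ.* c) ≡ sq a b ℚ.* sq c d
  sq-* = Q.solve 4 (λ a b c d →
    (a Q.:* c Q.:- b Q.:* d) Q.:* (a Q.:* c Q.:- b Q.:* d) Q.:+
    (a Q.:* d Q.:+ b Q.:* c) Q.:* (a Q.:* d Q.:+ b Q.:* c) Q.:=
    (a Q.:* a Q.:+ b Q.:* b) Q.:* (c Q.:* c Q.:+ d Q.:* d)) ≡.refl

  a≤σ : ∀ a b {σ} → 0ℚ ℚ.≤ σ → sq a b ℚ.≤ σ ℚ.* σ → ∣ a ∣ ℚ.≤ σ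
  a≤σ a b 0≤σ sq≤ = a*a≤b*b⇒a≤b 0≤σ (ℚ.≤-trans (ℚ.≤-reflexive (∣a∣*∣a∣≡a*a a))
    (ℚ.≤-trans (a≤a+b (a ℚ.* a) (0≤a*a b)) sq≤))

  ∥∥≤2σ : ∀ a b {σ} → 0ℚ ℚ.≤ σ → sq a b ℚ.≤ σ ℚ.* σ → ∥ a , b ∥ ℚ.≤ σ ℚ.+ σ
  ∥∥≤2σ a b 0≤σ sq≤ = ℚ.+-mono-≤ (a≤σ a b 0≤σ sq≤)
    (a≤σ b a 0≤σ (ℚ.≤-trans (ℚ.≤-reflexive (sq-swap b a)) sq≤))

  half<  : ∀ {ε} → 0ℚ ℚ.< ε → half ε ℚ.< ε
  half< {ε} 0<ε = begin-strict
    half ε             ≡⟨ ℚ.+-identityʳ (half ε) ⟨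
    half ε ℚ.+ 0ℚ      <⟨ ℚ.+-monoʳ-< (half ε) (half-pos 0<ε) ⟩
    half ε ℚ.+ half ε  ≡⟨ half+half ε ⟩
    ε                  ∎

  0<b-a : ∀ {a b} → a ℚ.< b → 0ℚ ℚ.< b ℚ.- a
  0<b-a {a} {b} a<b = ≡.subst (ℚ._< b ℚ.- a) (ℚ.+-inverseʳ a) (ℚ.+-monoˡ-< (ℚ.- a) a<b)

  a+[b-a]≡b : ∀ a b → a ℚ.+ (b ℚ.- a) ≡ b
  a+[b-a]≡b = Q.solve 2 (λ a b → a Q.:+ (b Q.:- a) Q.:= b) ≡.refl

  infix 4 _≺_
  -- The gap between `radius` and r makes the relation independent of the representing sequences:
  -- equal numbers may differ at every index, and `≺-resp-≈` spends part of the gap on that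
  -- difference.
  record _≺_ (z : ℂ) (r : ℚ) : Set where
    constructor bound
    field
      radius   : ℚ
      radius<r : radius ℚ.< r
      from     : ℕ
      ∥∥≤      : ∀ n → from ℕ.≤ n → ∥ seq (re z) n , seq (im z) n ∥ ℚ.≤ radius

  ≺-pos : ∀ {z r} → z ≺ r → 0ℚ ℚ.< r
  ≺-pos {z} (bound s s<r N z≤) = ℚ.≤-<-trans (ℚ.≤-trans (0≤∥∥ (seq (re z) N) (seq (im z) N)) (z≤ N ℕ.≤-refl)) s<r

  ≺-weaken : ∀ {z r s} → r ℚ.≤ s → z ≺ r → z ≺ s
  ≺-weaken r≤s (bound t t<r N z≤) = bound t (ℚ.<-≤-trans t<r r≤s) N z≤

  opaque
    unfolding _≋_

    ≺-resp-≈ : ∀ {z w r} → z ≋ w → z ≺ r → w ≺ r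
    ≺-resp-≈ {z} {w} {r} (re≈ , im≈) (bound s s<r N z≤) =
      bound (s ℚ.+ half δ) s+½δ<r (N ℕ.⊔ (K ℕ.⊔ L)) λ n ≤n →
        let a = seq (re z) n ; b = seq (im z) n ; c = seq (re w) n ; d = seq (im w) n in begin
        ∥ c , d ∥
          ≡⟨ ≡.cong₂ ∥_,_∥ (a+[b-a]≡b a c) (a+[b-a]≡b b d) ⟨
        ∥ a ℚ.+ (c ℚ.- a) , b ℚ.+ (d ℚ.- b) ∥
          ≤⟨ ∥+∥ a b (c ℚ.- a) (d ℚ.- b) ⟩
        ∥ a , b ∥ ℚ.+ ∥ c ℚ.- a , d ℚ.- b ∥
          ≤⟨ ℚ.+-mono-≤ (z≤ n (ℕ.m⊔n≤o⇒m≤o N _ ≤n)) (ℚ.<⇒≤ (ℚ.+-mono-<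
               (proj₂ re≈′ n (ℕ.m⊔n≤o⇒m≤o K L (ℕ.m⊔n≤o⇒n≤o N _ ≤n)))
               (proj₂ im≈′ n (ℕ.m⊔n≤o⇒n≤o K L (ℕ.m⊔n≤o⇒n≤o N _ ≤n))))) ⟩
        s ℚ.+ (half (half δ) ℚ.+ half (half δ))
          ≡⟨ ≡.cong (s ℚ.+_) (half+half (half δ)) ⟩
        s ℚ.+ half δ
          ∎
      where
      -- Each coordinate may move by δ/4, so the radius grows by δ/2 and stays below r.
      δ : ℚ
      δ = r ℚ.- s
      0<δ : 0ℚ ℚ.< δ
      0<δ = 0<b-a s<r
      s+½δ<r : s ℚ.+ half δ ℚ.< r
      s+½δ<r = ≡.subst (s ℚ.+ half δ ℚ.<_) (a+[b-a]≡b s r) (ℚ.+-monoʳ-< s (half< 0<δ))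
      re≈′ : ∃[ N ] ∀ n → N ℕ.≤ n → ∣ seq (re w) n ℚ.- seq (re z) n ∣ ℚ.< half (half δ)
      re≈′ = ℝProperties.≈ℝ-sym (re z) (re w) re≈ (half (half δ)) (half-pos (half-pos 0<δ))
      im≈′ : ∃[ N ] ∀ n → N ℕ.≤ n → ∣ seq (im w) n ℚ.- seq (im z) n ∣ ℚ.< half (half δ)
      im≈′ = ℝProperties.≈ℝ-sym (im z) (im w) im≈ (half (half δ)) (half-pos (half-pos 0<δ))
      K L : ℕ
      K = proj₁ re≈′
      L = proj₁ im≈′

    0≺ : ∀ {r} → 0ℚ ℚ.< r → 𝟘 ≺ r
    0≺ 0<r = bound 0ℚ 0<r 0 λ _ _ → ℚ.≤-refl

    1+≺ : ∀ {z r} → z ≺ r → 𝟙 ⊕ z ≺ 1ℚ ℚ.+ r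
    1+≺ {z} (bound s s<r N z≤) = bound (1ℚ ℚ.+ s) (ℚ.+-monoʳ-< 1ℚ s<r) N λ n N≤n →
      ℚ.≤-trans (∥+∥ 1ℚ 0ℚ (seq (re z) n) (seq (im z) n)) (ℚ.+-monoʳ-≤ 1ℚ (z≤ n N≤n))

    -≺ : ∀ {z r} → z ≺ r → ⊖ z ≺ r
    -≺ {z} (bound s s<r N z≤) = bound s s<r N λ n N≤n →
      ℚ.≤-trans (ℚ.≤-reflexive (∥-∥ (seq (re z) n) (seq (im z) n))) (z≤ n N≤n)

    +≺ : ∀ {z w r s} → z ≺ r → w ≺ s → z ⊕ w ≺ r ℚ.+ s
    +≺ {z} {w} (bound s s<r M z≤) (bound t t<r N w≤) = bound (s ℚ.+ t) (ℚ.+-mono-< s<r t<r) (M ℕ.⊔ N) λ n ≤n →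
      ℚ.≤-trans (∥+∥ (seq (re z) n) (seq (im z) n) (seq (re w) n) (seq (im w) n))
        (ℚ.+-mono-≤ (z≤ n (ℕ.m⊔n≤o⇒m≤o M N ≤n)) (w≤ n (ℕ.m⊔n≤o⇒n≤o M N ≤n)))

    *≺ : ∀ {z w r s} → z ≺ r → w ≺ s → z ⊗ w ≺ r ℚ.* s
    *≺ {z} {w} {r} {s} z≺r@(bound r′ r′<r M z≤) w≺s@(bound s′ s′<s N w≤) = bound (r′ ℚ.* s)
      (ℚ.*-monoˡ-<-pos s {{ℚ.positive (≺-pos w≺s)}} r′<r) (M ℕ.⊔ N) λ n ≤n →
      let a = seq (re z) n ; b = seq (im z) n ; c = seq (re w) n ; d = seq (im w) n
          z≤r′ = z≤ n (ℕ.m⊔n≤o⇒m≤o M N ≤n)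
      in ℚ.≤-trans (∥*∥ a b c d)
        (*-mono-≤ {∥ a , b ∥} {∥ c , d ∥} {r′} {s} (0≤∥∥ c d) (ℚ.≤-trans (0≤∥∥ a b) z≤r′) z≤r′
          (ℚ.<⇒≤ (ℚ.≤-<-trans (w≤ n (ℕ.m⊔n≤o⇒n≤o M N ≤n)) s′<s)))

    finite : ∀ z → ∃[ r ] z ≺ r
    finite z =
      let A , 0<A , M , reA = eventually-bounded (re z)
          B , 0<B , N , imB = eventually-bounded (im z)
      in 1ℚ ℚ.+ (A ℚ.+ B) , bound (A ℚ.+ B)
        (≡.subst (ℚ._< 1ℚ ℚ.+ (A ℚ.+ B)) (ℚ.+-identityˡ (A ℚ.+ B)) (ℚ.+-monoˡ-< (A ℚ.+ B) (ℚ.positive⁻¹ 1ℚ)))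
        (M ℕ.⊔ N) λ n ≤n → ℚ.+-mono-≤ (reA n (ℕ.m⊔n≤o⇒m≤o M N ≤n)) (imB n (ℕ.m⊔n≤o⇒n≤o M N ≤n))

    separated : ∀ {z} → (∀ ε → 0ℚ ℚ.< ε → z ≺ ε) → z ≋ 𝟘
    separated {z} z≺ =
      (λ ε 0<ε → let bound s s<ε N z≤ = z≺ ε 0<ε in N , λ n N≤n →
        ≡.subst (λ d → ∣ d ∣ ℚ.< ε) (≡.sym (ℚ.+-identityʳ (seq (re z) n)))
          (ℚ.≤-<-trans (ℚ.≤-trans (a≤a+b (∣ seq (re z) n ∣) (ℚ.0≤∣p∣ (seq (im z) n))) (z≤ n N≤n)) s<ε)) ,
      (λ ε 0<ε → let bound s s<ε N z≤ = z≺ ε 0<ε in N , λ n N≤n →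
        ≡.subst (λ d → ∣ d ∣ ℚ.< ε) (≡.sym (ℚ.+-identityʳ (seq (im z) n)))
          (ℚ.≤-<-trans (ℚ.≤-trans (b≤a+b (∣ seq (im z) n ∣) (ℚ.0≤∣p∣ (seq (re z) n))) (z≤ n N≤n)) s<ε))

module Completeness (ρ : ℚ) (0<ρ : 0ℚ ℚ.< ρ) (ρ<1 : ρ ℚ.< 1ℚ) where

  open ℚPowers ρ 0<ρ ρ<1 renaming (_^_ to _^ℚ_) hiding (*-monoʳ-≤; *-monoˡ-≤)
  open ℂRing
  open ℓ¹Norm
  private module Q = +-*-Solver

  Eventually : (ℕ → Set) → Set
  Eventually P = ∃[ N ] ∀ i → N ℕ.≤ i → P i

  ∣+∣≤ : ∀ {a b A B} → ∣ a ∣ ℚ.≤ A → ∣ b ∣ ℚ.≤ B → ∣ a ℚ.+ b ∣ ℚ.≤ A ℚ.+ B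
  ∣+∣≤ {a} {b} a≤A b≤B = ℚ.≤-trans (ℚ.∣p+q∣≤∣p∣+∣q∣ a b) (ℚ.+-mono-≤ a≤A b≤B)

  ∣-∣-sym : ∀ a b → ∣ a ℚ.- b ∣ ≡ ∣ b ℚ.- a ∣
  ∣-∣-sym a b = ≡.trans (≡.sym (ℚ.∣-p∣≡∣p∣ (a ℚ.- b)))
    (≡.cong ∣_∣ (Q.solve 2 (λ a b → Q.:- (a Q.:- b) Q.:= b Q.:- a) ≡.refl a b))

  chain : ∀ a b c → (a ℚ.- b) ℚ.+ (b ℚ.- c) ≡ a ℚ.- c
  chain = Q.solve 3 (λ a b c → (a Q.:- b) Q.:+ (b Q.:- c) Q.:= a Q.:- c) ≡.refl

  -- The limit is the diagonal sequence l i = x i (m i), where m i is a modulus at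
  -- which x i varies by less than ρⁱ.
  module Diagonal (x : ℕ → ℝ) (K : ℚ) (0<K : 0ℚ ℚ.< K)
    (x-cauchy : ∀ n k → Eventually (λ i → ∣ seq (x (n ℕ.+ k)) i ℚ.- seq (x n) i ∣ ℚ.≤ K ℚ.* ρ ^ℚ n))
    where

    m : ℕ → ℕ
    m i = proj₁ (cauchy (x i) (ρ ^ℚ i) (0<ρ^ i))

    l : ℕ → ℚ
    l i = seq (x i) (m i)

    l-close : ∀ i j → m i ℕ.≤ j → ∣ l i ℚ.- seq (x i) j ∣ ℚ.≤ ρ ^ℚ i
    l-close i j m≤j = ℚ.<⇒≤ (proj₂ (cauchy (x i) (ρ ^ℚ i) (0<ρ^ i)) (m i) j ℕ.≤-refl m≤j)

    -- The summand K is the distance of two members of the sequence; each 1 pays for replacing a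
    -- member by its diagonal entry.
    K₂ : ℚ
    K₂ = 1ℚ ℚ.+ (K ℚ.+ 1ℚ)

    0<K₂ : 0ℚ ℚ.< K₂
    0<K₂ = ℚ.+-mono-< (ℚ.positive⁻¹ 1ℚ) (ℚ.+-mono-< 0<K (ℚ.positive⁻¹ 1ℚ))

    l-cauchy : ∀ n k → ∣ l (n ℕ.+ k) ℚ.- l n ∣ ℚ.≤ K₂ ℚ.* ρ ^ℚ n
    l-cauchy n k = begin
      ∣ l (n ℕ.+ k) ℚ.- l n ∣
        ≡⟨ ≡.cong ∣_∣ (≡.trans (≡.cong (a ℚ.+_) (chain (seq (x (n ℕ.+ k)) j) (seq (x n) j) (l n)))
             (chain (l (n ℕ.+ k)) (seq (x (n ℕ.+ k)) j) (l n))) ⟨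
      ∣ a ℚ.+ (b ℚ.+ c) ∣
        ≤⟨ ∣+∣≤ {a} {b ℚ.+ c} (l-close (n ℕ.+ k) j (ℕ.m⊔n≤o⇒n≤o N₀ _ (ℕ.m⊔n≤o⇒n≤o N₁ _ ℕ.≤-refl)))
             (∣+∣≤ {b} {c} (proj₂ (x-cauchy n k) j (ℕ.m⊔n≤o⇒m≤o N₁ _ ℕ.≤-refl))
               (ℚ.≤-trans (ℚ.≤-reflexive (∣-∣-sym (seq (x n) j) (l n)))
                 (l-close n j (ℕ.m⊔n≤o⇒m≤o N₀ _ (ℕ.m⊔n≤o⇒n≤o N₁ _ ℕ.≤-refl))))) ⟩
      ρ ^ℚ (n ℕ.+ k) ℚ.+ (K ℚ.* ρ ^ℚ n ℚ.+ ρ ^ℚ n)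
        ≤⟨ ℚ.+-monoˡ-≤ (K ℚ.* ρ ^ℚ n ℚ.+ ρ ^ℚ n) (ρ^-anti (ℕ.m≤m+n n k)) ⟩
      ρ ^ℚ n ℚ.+ (K ℚ.* ρ ^ℚ n ℚ.+ ρ ^ℚ n)
        ≡⟨ Q.solve 2 (λ K x → x Q.:+ (K Q.:* x Q.:+ x) Q.:=
             (Q.con 1ℚ Q.:+ (K Q.:+ Q.con 1ℚ)) Q.:* x) ≡.refl K (ρ ^ℚ n) ⟩
      K₂ ℚ.* ρ ^ℚ n
        ∎
      where
      open ℚ.≤-Reasoning
      N₀ N₁ j : ℕ
      N₀ = m n
      N₁ = proj₁ (x-cauchy n k)
      j = N₁ ℕ.⊔ (m n ℕ.⊔ m (n ℕ.+ k))
      a b c : ℚ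
      a = l (n ℕ.+ k) ℚ.- seq (x (n ℕ.+ k)) j
      b = seq (x (n ℕ.+ k)) j ℚ.- seq (x n) j
      c = seq (x n) j ℚ.- l n

    l-cauchy′ : ∀ n i → n ℕ.≤ i → ∣ l i ℚ.- l n ∣ ℚ.≤ K₂ ℚ.* ρ ^ℚ n
    l-cauchy′ n i n≤i = ≡.subst (λ j → ∣ l j ℚ.- l n ∣ ℚ.≤ K₂ ℚ.* ρ ^ℚ n) (ℕ.m+[n∸m]≡n n≤i) (l-cauchy n (i ℕ.∸ n))

    diagonal : ℝ
    diagonal = mkℝ l λ ε 0<ε →
      let 0<ε/4 = half-pos (half-pos 0<ε)
          N , small = ρ^-small K₂ (half (half ε)) 0<K₂ 0<ε/4
          close = λ i N≤i → ℚ.≤-<-trans (ℚ.≤-trans (l-cauchy′ N i N≤i) (small N ℕ.≤-refl)) (half< (half-pos 0<ε))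
      in N , λ i j N≤i N≤j →
      ≡.subst (λ d → ∣ d ∣ ℚ.< ε) (chain (l i) (l N) (l j))
        (∣+∣-split (l i ℚ.- l N) (l N ℚ.- l j) ε (close i N≤i)
          (≡.subst (ℚ._< half ε) (∣-∣-sym (l j) (l N)) (close j N≤j)))

    converges : ∀ n → Eventually (λ i → ∣ seq (x n) i ℚ.- l i ∣ ℚ.≤ (1ℚ ℚ.+ K₂) ℚ.* ρ ^ℚ n)
    converges n = m n ℕ.⊔ n , λ i ≤i → begin
      ∣ seq (x n) i ℚ.- l i ∣
        ≡⟨ ≡.cong ∣_∣ (chain (seq (x n) i) (l n) (l i)) ⟨
      ∣ (seq (x n) i ℚ.- l n) ℚ.+ (l n ℚ.- l i) ∣
        ≤⟨ ∣+∣≤ {seq (x n) i ℚ.- l n} {l n ℚ.- l i}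
             (ℚ.≤-trans (ℚ.≤-reflexive (∣-∣-sym (seq (x n) i) (l n))) (l-close n i (ℕ.m⊔n≤o⇒m≤o (m n) n ≤i)))
             (ℚ.≤-trans (ℚ.≤-reflexive (∣-∣-sym (l n) (l i))) (l-cauchy′ n i (ℕ.m⊔n≤o⇒n≤o (m n) n ≤i))) ⟩
      ρ ^ℚ n ℚ.+ K₂ ℚ.* ρ ^ℚ n
        ≡⟨ Q.solve 2 (λ K x → x Q.:+ K Q.:* x Q.:= (Q.con 1ℚ Q.:+ K) Q.:* x) ≡.refl K₂ (ρ ^ℚ n) ⟩
      (1ℚ ℚ.+ K₂) ℚ.* ρ ^ℚ n
        ∎
      where open ℚ.≤-Reasoning

  opaque
    unfolding _≋_

    complete : ∀ (s : ℕ → ℂ) K → (∀ n k → s (n ℕ.+ k) ⊕ ⊖ s n ≺ K ℚ.* ρ ^ℚ n) →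
      ∃[ l ] ∃[ L ] ∀ n → s n ⊕ ⊖ l ≺ L ℚ.* ρ ^ℚ n
    complete s K s-cauchy = (Re.diagonal +i Im.diagonal) , L , λ n →
      let M , re≤ = Re.converges n
          N , im≤ = Im.converges n
      in bound (L′ ℚ.* ρ ^ℚ n) (ℚ.*-monoˡ-<-pos (ρ ^ℚ n) {{ℚ.positive (0<ρ^ n)}} L′<L) (M ℕ.⊔ N) λ i ≤i →
      ℚ.≤-trans (ℚ.+-mono-≤ (re≤ i (ℕ.m⊔n≤o⇒m≤o M N ≤i)) (im≤ i (ℕ.m⊔n≤o⇒n≤o M N ≤i)))
        (ℚ.≤-reflexive (≡.sym (ℚ.*-distribʳ-+ (ρ ^ℚ n) K₃ K₃)))
      where
      0<K : 0ℚ ℚ.< K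
      0<K = ≡.subst (0ℚ ℚ.<_) (ℚ.*-identityʳ K) (≺-pos (s-cauchy 0 0))

      re-cauchy : ∀ n k → Eventually (λ i →
        ∣ seq (re (s (n ℕ.+ k))) i ℚ.- seq (re (s n)) i ∣ ℚ.≤ K ℚ.* ρ ^ℚ n)
      re-cauchy n k = let bound r r<K N ≤r = s-cauchy n k in N , λ i N≤i →
        ℚ.≤-trans (ℚ.≤-trans
          (a≤a+b (∣ seq (re (s (n ℕ.+ k))) i ℚ.- seq (re (s n)) i ∣)
            (ℚ.0≤∣p∣ (seq (im (s (n ℕ.+ k))) i ℚ.- seq (im (s n)) i)))
          (≤r i N≤i)) (ℚ.<⇒≤ r<K)

      im-cauchy : ∀ n k → Eventually (λ i →
        ∣ seq (im (s (n ℕ.+ k))) i ℚ.- seq (im (s n)) i ∣ ℚ.≤ K ℚ.* ρ ^ℚ n)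
      im-cauchy n k = let bound r r<K N ≤r = s-cauchy n k in N , λ i N≤i →
        ℚ.≤-trans (ℚ.≤-trans
          (b≤a+b (∣ seq (im (s (n ℕ.+ k))) i ℚ.- seq (im (s n)) i ∣)
            (ℚ.0≤∣p∣ (seq (re (s (n ℕ.+ k))) i ℚ.- seq (re (s n)) i)))
          (≤r i N≤i)) (ℚ.<⇒≤ r<K)

      module Re = Diagonal (λ n → re (s n)) K 0<K re-cauchy
      module Im = Diagonal (λ n → im (s n)) K 0<K im-cauchy

      -- `K₃` is the constant of `Diagonal.converges`; real and imaginary part together give `L′`,
      -- and the extra 1 in `L` makes the bound strict.
      K₃ L′ L : ℚ
      K₃ = 1ℚ ℚ.+ (1ℚ ℚ.+ (K ℚ.+ 1ℚ))
      L′ = K₃ ℚ.+ K₃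
      L  = L′ ℚ.+ 1ℚ

      L′<L : L′ ℚ.< L
      L′<L = ≡.subst (ℚ._< L) (ℚ.+-identityʳ L′) (ℚ.+-monoʳ-< L′ (ℚ.positive⁻¹ 1ℚ))

  norm : NormedRing.Norm ℂ-commutativeRing ρ
  norm = record
    { _≺_       = _≺_
    ; ≺-resp-≈  = λ {z} {w} {r} → ≺-resp-≈ {z} {w} {r}
    ; ≺-weaken  = λ {z} {r} {s} → ≺-weaken {z} {r} {s}
    ; ≺-pos     = λ {z} {r} → ≺-pos {z} {r}
    ; 0≺        = λ {r} → 0≺ {r}
    ; 1+≺       = λ {z} {r} → 1+≺ {z} {r}
    ; -≺        = λ {z} {r} → -≺ {z} {r}
    ; +≺        = λ {z} {w} {r} {s} → +≺ {z} {w} {r} {s}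
    ; *≺        = λ {z} {w} {r} {s} → *≺ {z} {w} {r} {s}
    ; finite    = finite
    ; separated = λ {z} → separated {z}
    ; complete  = complete
    }

-- Division, apartness and bounds on the modulus

module Inverses where

  open ℓ¹Norm
  open ℂRing using (_≋_; ≋⇒≈)
  private module Q = +-*-Solver

  ∣_∣² : ℂ → ℕ → ℚ
  ∣ z ∣² n = sq (seq (re z) n) (seq (im z) n)

  recip-anti : ∀ {δ x} → 0ℚ ℚ.< δ → δ ℚ.≤ x → recip x ℚ.≤ recip δ
  recip-anti {δ} {x} 0<δ δ≤x = begin
    recip x                            ≡⟨ ℚ.*-identityʳ (recip x) ⟨
    recip x ℚ.* 1ℚ                     ≡⟨ ≡.cong (recip x ℚ.*_) (recip-inverse δ (≡.≢-sym (ℚ.<⇒≢ 0<δ))) ⟨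
    recip x ℚ.* (δ ℚ.* recip δ)
      ≤⟨ ℚ.*-monoˡ-≤-nonNeg (recip x) {{ℚ.nonNegative (ℚ.<⇒≤ (recip-pos 0<x))}}
           (ℚ.*-monoʳ-≤-nonNeg (recip δ) {{ℚ.nonNegative (ℚ.<⇒≤ (recip-pos 0<δ))}} δ≤x) ⟩
    recip x ℚ.* (x ℚ.* recip δ)
      ≡⟨ Q.solve 3 (λ a b c → a Q.:* (b Q.:* c) Q.:= (b Q.:* a) Q.:* c) ≡.refl (recip x) x (recip δ) ⟩
    (x ℚ.* recip x) ℚ.* recip δ        ≡⟨ ≡.cong (ℚ._* recip δ) (recip-inverse x (≡.≢-sym (ℚ.<⇒≢ 0<x))) ⟩
    1ℚ ℚ.* recip δ                     ≡⟨ ℚ.*-identityˡ (recip δ) ⟩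
    recip δ                            ∎
    where
    open ℚ.≤-Reasoning
    0<x : 0ℚ ℚ.< x
    0<x = ℚ.<-≤-trans 0<δ δ≤x

  inverse : ∀ z → z #0 → ℂ
  inverse z z#0 = (re z *ℝ recipℝ (normSq z) z#0) +i ((-ℝ im z) *ℝ recipℝ (normSq z) z#0)

  -- An apartness proof is a rational lower bound δ of ∣z∣² together with its onset.
  module _ (z : ℂ) (z#0 : z #0) where

    private
      δ : ℚ
      δ = proj₁ z#0
      0<δ : 0ℚ ℚ.< δ
      0<δ = proj₁ (proj₂ z#0)
      K : ℕ
      K = proj₁ (proj₂ (proj₂ z#0))
      δ≤ : ∀ n → K ℕ.≤ n → δ ℚ.≤ ∣ z ∣² n
      δ≤ n K≤n = ≡.subst (ℚ._≤ ∣ z ∣² n) (ℚ.+-identityˡ δ) (proj₂ (proj₂ (proj₂ z#0)) n K≤n)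

    *-inverse : z * inverse z z#0 ≈ 1ℂ
    *-inverse =
      ℝProperties.≈ℝ-eventually (re (z * inverse z z#0)) 1ℝ K (λ n K≤n → ≡.trans
        (Q.solve 3 (λ a b s → a Q.:* (a Q.:* s) Q.:- b Q.:* ((Q.:- b) Q.:* s) Q.:=
          (a Q.:* a Q.:+ b Q.:* b) Q.:* s) ≡.refl (seq (re z) n) (seq (im z) n) (recip (∣ z ∣² n)))
        (recip-inverse (∣ z ∣² n) (≡.≢-sym (ℚ.<⇒≢ (ℚ.<-≤-trans 0<δ (δ≤ n K≤n)))))) ,
      ℝProperties.≈ℝ-pointwise (im (z * inverse z z#0)) 0ℝ (λ n →
        Q.solve 3 (λ a b s → a Q.:* ((Q.:- b) Q.:* s) Q.:+ b Q.:* (a Q.:* s) Q.:= Q.con 0ℚ)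
          ≡.refl (seq (re z) n) (seq (im z) n) (recip (∣ z ∣² n)))

    -- The inverse is the conjugate divided by ∣z∣² ≥ δ, and conjugation preserves the ℓ¹ norm.
    -- Numbers whose apartness proofs share δ thus have uniformly bounded inverses.
    inverse-≺ : ∀ {r} → z ≺ r → inverse z z#0 ≺ r ℚ.* recip δ
    inverse-≺ {r} (bound s s<r N z≤) = bound (s ℚ.* recip δ)
      (ℚ.*-monoˡ-<-pos (recip δ) {{ℚ.positive (recip-pos 0<δ)}} s<r) (N ℕ.⊔ K) λ n ≤n →
      let a = seq (re z) n
          b = seq (im z) n
          t = recip (∣ z ∣² n)
          K≤n = ℕ.m⊔n≤o⇒n≤o N K ≤n
          0≤t = ℚ.<⇒≤ (recip-pos (ℚ.<-≤-trans 0<δ (δ≤ n K≤n)))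
          z≤s = z≤ n (ℕ.m⊔n≤o⇒m≤o N K ≤n)
      in begin
        ∣ a ℚ.* t ∣ ℚ.+ ∣ ℚ.- b ℚ.* t ∣
          ≡⟨ ≡.cong₂ ℚ._+_ (ℚ.∣p*q∣≡∣p∣*∣q∣ a t) (ℚ.∣p*q∣≡∣p∣*∣q∣ (ℚ.- b) t) ⟩
        ∣ a ∣ ℚ.* ∣ t ∣ ℚ.+ ∣ ℚ.- b ∣ ℚ.* ∣ t ∣
          ≡⟨ ≡.cong₂ (λ x y → ∣ a ∣ ℚ.* x ℚ.+ y ℚ.* x) (ℚ.0≤p⇒∣p∣≡p 0≤t) (ℚ.∣-p∣≡∣p∣ b) ⟩
        ∣ a ∣ ℚ.* t ℚ.+ ∣ b ∣ ℚ.* t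
          ≡⟨ ℚ.*-distribʳ-+ t (∣ a ∣) (∣ b ∣) ⟨
        ∥ a , b ∥ ℚ.* t
          ≤⟨ *-mono-≤ {∥ a , b ∥} {t} {s} {recip δ} 0≤t (ℚ.≤-trans (0≤∥∥ a b) z≤s) z≤s (recip-anti 0<δ (δ≤ n K≤n)) ⟩
        s ℚ.* recip δ
          ∎
      where open ℚ.≤-Reasoning

  #0-* : ∀ z w → z #0 → w #0 → (z * w) #0
  #0-* z w (δ , 0<δ , M , z≥) (ε , 0<ε , N , w≥) = δ ℚ.* ε , *-pos 0<δ 0<ε , M ℕ.⊔ N , λ n ≤n →
    let z≥δ = ℚ.≤-trans (ℚ.≤-reflexive (≡.sym (ℚ.+-identityˡ δ))) (z≥ n (ℕ.m⊔n≤o⇒m≤o M N ≤n))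
        w≥ε = ℚ.≤-trans (ℚ.≤-reflexive (≡.sym (ℚ.+-identityˡ ε))) (w≥ n (ℕ.m⊔n≤o⇒n≤o M N ≤n))
    in begin
      0ℚ ℚ.+ δ ℚ.* ε          ≡⟨ ℚ.+-identityˡ (δ ℚ.* ε) ⟩
      δ ℚ.* ε
        ≤⟨ *-mono-≤ {δ} {ε} {∣ z ∣² n} {∣ w ∣² n} (ℚ.<⇒≤ 0<ε) (ℚ.≤-trans (ℚ.<⇒≤ 0<δ) z≥δ) z≥δ w≥ε ⟩
      ∣ z ∣² n ℚ.* ∣ w ∣² n   ≡⟨ sq-* (seq (re z) n) (seq (im z) n) (seq (re w) n) (seq (im w) n) ⟨
      ∣ z * w ∣² n            ∎
    where open ℚ.≤-Reasoning

  #0-product : ∀ n f → (∀ i → f i #0) → product {n} (λ j → f (toℕ j)) #0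
  #0-product zero    f f#0 = 1ℚ , ℚ.positive⁻¹ 1ℚ , 0 , λ _ _ → ℚ.≤-refl
  #0-product (suc n) f f#0 = #0-* (f 0) (product {n} (λ j → f (suc (toℕ j)))) (f#0 0)
    (#0-product n (λ i → f (suc i)) (λ i → f#0 (suc i)))

  -- From ∣zw∣² ≥ (Re zw)² ≥ 1/4 eventually and a bound for ∣w∣².
  #0-unit : ∀ z w → z * w ≈ 1ℂ → z #0
  #0-unit z w (re≈1 , _) = δ , *-pos 0<¼ (recip-pos 0<R²) , N₁ ℕ.⊔ N₂ , λ n ≤n → begin
      0ℚ ℚ.+ δ                                   ≡⟨ ℚ.+-identityˡ δ ⟩
      ℚ.½ ℚ.* ℚ.½ ℚ.* recip (R ℚ.* R)
        ≤⟨ ℚ.*-monoʳ-≤-nonNeg (recip (R ℚ.* R)) {{ℚ.nonNegative (ℚ.<⇒≤ (recip-pos 0<R²))}} (bounds n ≤n) ⟩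
      ∣ z ∣² n ℚ.* (R ℚ.* R) ℚ.* recip (R ℚ.* R) ≡⟨ ℚ.*-assoc (∣ z ∣² n) (R ℚ.* R) (recip (R ℚ.* R)) ⟩
      ∣ z ∣² n ℚ.* (R ℚ.* R ℚ.* recip (R ℚ.* R))
        ≡⟨ ≡.cong (∣ z ∣² n ℚ.*_) (recip-inverse (R ℚ.* R) (≡.≢-sym (ℚ.<⇒≢ 0<R²))) ⟩
      ∣ z ∣² n ℚ.* 1ℚ                            ≡⟨ ℚ.*-identityʳ (∣ z ∣² n) ⟩
      ∣ z ∣² n                                   ∎
    where
    open ℚ.≤-Reasoning
    R : ℚ
    R = proj₁ (finite w)
    w≺R : w ≺ R
    w≺R = proj₂ (finite w)
    0<R² : 0ℚ ℚ.< R ℚ.* R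
    0<R² = *-pos (≺-pos w≺R) (≺-pos w≺R)
    0<¼ : 0ℚ ℚ.< ℚ.½ ℚ.* ℚ.½
    0<¼ = ℚ.positive⁻¹ (ℚ.½ ℚ.* ℚ.½)
    δ : ℚ
    δ = ℚ.½ ℚ.* ℚ.½ ℚ.* recip (R ℚ.* R)
    close : ∃[ N ] ∀ n → N ℕ.≤ n → ∣ seq (re (z * w)) n ℚ.- 1ℚ ∣ ℚ.< ℚ.½
    close = re≈1 ℚ.½ (ℚ.positive⁻¹ ℚ.½)
    N₁ N₂ : ℕ
    N₁ = proj₁ close
    N₂ = _≺_.from w≺R

    ½≤∣∣ : ∀ x → ∣ x ℚ.- 1ℚ ∣ ℚ.< ℚ.½ → ℚ.½ ℚ.≤ ∣ x ∣
    ½≤∣∣ x x≈1 = ℚ.≮⇒≥ λ ∣x∣<½ → ℚ.<-irrefl ≡.refl (begin-strict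
      1ℚ
        ≡⟨ ≡.cong ∣_∣ (Q.solve 1 (λ x → Q.con 1ℚ Q.:= x Q.:- (x Q.:- Q.con 1ℚ)) ≡.refl x) ⟩
      ∣ x ℚ.- (x ℚ.- 1ℚ) ∣             ≤⟨ ℚ.∣p-q∣≤∣p∣+∣q∣ x (x ℚ.- 1ℚ) ⟩
      ∣ x ∣ ℚ.+ ∣ x ℚ.- 1ℚ ∣           <⟨ ℚ.+-mono-< ∣x∣<½ x≈1 ⟩
      1ℚ                               ∎)

    bounds : ∀ n → N₁ ℕ.⊔ N₂ ℕ.≤ n → ℚ.½ ℚ.* ℚ.½ ℚ.≤ ∣ z ∣² n ℚ.* (R ℚ.* R)
    bounds n ≤n = begin
      ℚ.½ ℚ.* ℚ.½
        ≤⟨ *-mono-≤ {ℚ.½} {ℚ.½} {∣ x ∣} {∣ x ∣} (ℚ.<⇒≤ (ℚ.positive⁻¹ ℚ.½)) (ℚ.0≤∣p∣ x) ½≤x ½≤x ⟩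
      ∣ x ∣ ℚ.* ∣ x ∣
        ≡⟨ ∣a∣*∣a∣≡a*a x ⟩
      x ℚ.* x
        ≤⟨ a≤a+b (x ℚ.* x) (0≤a*a (seq (im (z * w)) n)) ⟩
      ∣ z * w ∣² n
        ≡⟨ sq-* (seq (re z) n) (seq (im z) n) c d ⟩
      ∣ z ∣² n ℚ.* ∣ w ∣² n
        ≤⟨ ℚ.*-monoˡ-≤-nonNeg (∣ z ∣² n) {{ℚ.nonNegative (0≤sq (seq (re z) n) (seq (im z) n))}}
             (ℚ.≤-trans (sq≤∥∥² c d)
               (*-mono-≤ {∥ c , d ∥} {∥ c , d ∥} {R} {R} (0≤∥∥ c d) (ℚ.<⇒≤ (≺-pos w≺R)) w≤R w≤R)) ⟩
      ∣ z ∣² n ℚ.* (R ℚ.* R)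
        ∎
      where
      x c d : ℚ
      x = seq (re (z * w)) n
      c = seq (re w) n
      d = seq (im w) n
      ½≤x : ℚ.½ ℚ.≤ ∣ x ∣
      ½≤x = ½≤∣∣ x (proj₂ close n (ℕ.m⊔n≤o⇒m≤o N₁ N₂ ≤n))
      w≤R : ∥ c , d ∥ ℚ.≤ R
      w≤R = ℚ.≤-trans (_≺_.∥∥≤ w≺R n (ℕ.m⊔n≤o⇒n≤o N₁ N₂ ≤n)) (ℚ.<⇒≤ (_≺_.radius<r w≺R))

  ≺⇒∣∣< : ∀ {z ε} → z ≺ ε → ∣ z ∣< ε
  ≺⇒∣∣< {z} {ε} z≺ε@(bound s s<ε N z≤) = ε ℚ.* ε ℚ.- s ℚ.* s , 0<b-a s²<ε² , N , λ n N≤n → begin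
      ∣ z ∣² n ℚ.+ (ε ℚ.* ε ℚ.- s ℚ.* s)
        ≤⟨ ℚ.+-monoˡ-≤ (ε ℚ.* ε ℚ.- s ℚ.* s) (ℚ.≤-trans (sq≤∥∥² (seq (re z) n) (seq (im z) n))
             (*-mono-≤ {∥ seq (re z) n , seq (im z) n ∥} {∥ seq (re z) n , seq (im z) n ∥} {s} {s}
               (0≤∥∥ (seq (re z) n) (seq (im z) n)) 0≤s (z≤ n N≤n) (z≤ n N≤n))) ⟩
      s ℚ.* s ℚ.+ (ε ℚ.* ε ℚ.- s ℚ.* s)
        ≡⟨ a+[b-a]≡b (s ℚ.* s) (ε ℚ.* ε) ⟩
      ε ℚ.* ε
        ∎
    where
    open ℚ.≤-Reasoning
    0≤s : 0ℚ ℚ.≤ s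
    0≤s = ℚ.≤-trans (0≤∥∥ (seq (re z) N) (seq (im z) N)) (z≤ N ℕ.≤-refl)
    s²<ε² : s ℚ.* s ℚ.< ε ℚ.* ε
    s²<ε² = begin-strict
      s ℚ.* s ≤⟨ ℚ.*-monoˡ-≤-nonNeg s {{ℚ.nonNegative 0≤s}} (ℚ.<⇒≤ s<ε) ⟩
      s ℚ.* ε <⟨ ℚ.*-monoˡ-<-pos ε {{ℚ.positive (≺-pos z≺ε)}} s<ε ⟩
      ε ℚ.* ε ∎

module Moduli (ρ : ℚ) (0<ρ : 0ℚ ℚ.< ρ) (ρ<1 : ρ ℚ.< 1ℚ) where

  open ℚPowers ρ 0<ρ ρ<1 renaming (_^_ to _^ℚ_) hiding (*-monoʳ-≤; *-monoˡ-≤)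
  open ℓ¹Norm
  open Inverses
  private module Q = +-*-Solver

  infix 4 _≼ρ^_
  -- This is ∣z∣ ≤ ρᵉ, squared and eventual. By `sq-*` exponents add under multiplication and no
  -- constant accumulates in powers.
  _≼ρ^_ : ℂ → ℕ → Set
  z ≼ρ^ e = ∃[ N ] ∀ n → N ℕ.≤ n → ∣ z ∣² n ℚ.≤ ρ ^ℚ e ℚ.* ρ ^ℚ e

  1≼ : 1ℂ ≼ρ^ 0
  1≼ = 0 , λ _ _ → ℚ.≤-refl

  -≼ : ∀ z e → z ≼ρ^ e → - z ≼ρ^ e
  -≼ z e (N , z≤) = N , λ n N≤n → ℚ.≤-trans
    (ℚ.≤-reflexive (Q.solve 2 (λ a b → (Q.:- a) Q.:* (Q.:- a) Q.:+ (Q.:- b) Q.:* (Q.:- b) Q.:=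
      a Q.:* a Q.:+ b Q.:* b) ≡.refl (seq (re z) n) (seq (im z) n)))
    (z≤ n N≤n)

  *≼ : ∀ z w d e → z ≼ρ^ d → w ≼ρ^ e → z * w ≼ρ^ d ℕ.+ e
  *≼ z w d e (M , z≤) (N , w≤) = (M ℕ.⊔ N) , λ n ≤n → begin
      ∣ z * w ∣² n
        ≡⟨ sq-* (seq (re z) n) (seq (im z) n) (seq (re w) n) (seq (im w) n) ⟩
      ∣ z ∣² n ℚ.* ∣ w ∣² n
        ≤⟨ *-mono-≤ {∣ z ∣² n} {∣ w ∣² n} {ρ ^ℚ d ℚ.* ρ ^ℚ d} {ρ ^ℚ e ℚ.* ρ ^ℚ e}
             (0≤sq (seq (re w) n) (seq (im w) n))
             (ℚ.<⇒≤ (*-pos (0<ρ^ d) (0<ρ^ d))) (z≤ n (ℕ.m⊔n≤o⇒m≤o M N ≤n)) (w≤ n (ℕ.m⊔n≤o⇒n≤o M N ≤n)) ⟩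
      ρ ^ℚ d ℚ.* ρ ^ℚ d ℚ.* (ρ ^ℚ e ℚ.* ρ ^ℚ e)
        ≡⟨ Q.solve 2 (λ x y → x Q.:* x Q.:* (y Q.:* y) Q.:= (x Q.:* y) Q.:* (x Q.:* y)) ≡.refl (ρ ^ℚ d) (ρ ^ℚ e) ⟩
      ρ ^ℚ d ℚ.* ρ ^ℚ e ℚ.* (ρ ^ℚ d ℚ.* ρ ^ℚ e)
        ≡⟨ ≡.cong₂ ℚ._*_ (ρ^+ d e) (ρ^+ d e) ⟨
      ρ ^ℚ (d ℕ.+ e) ℚ.* ρ ^ℚ (d ℕ.+ e)
        ∎
    where open ℚ.≤-Reasoning

  ^≼ : ∀ z e → z ≼ρ^ e → ∀ n → z ^ n ≼ρ^ n ℕ.* e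
  ^≼ z e z≼ zero    = 1≼
  ^≼ z e z≼ (suc n) = *≼ z (z ^ n) e (n ℕ.* e) z≼ (^≼ z e z≼ n)

  ≼-mono : ∀ z {d e} → d ℕ.≤ e → z ≼ρ^ e → z ≼ρ^ d
  ≼-mono z {d} {e} d≤e (N , z≤) = N , λ n N≤n → ℚ.≤-trans (z≤ n N≤n)
    (*-mono-≤ {ρ ^ℚ e} {ρ ^ℚ e} {ρ ^ℚ d} {ρ ^ℚ d} (ℚ.<⇒≤ (0<ρ^ e)) (ℚ.<⇒≤ (0<ρ^ d)) (ρ^-anti d≤e) (ρ^-anti d≤e))

  -- Two units come from ∥z∥ ≤ 2∣z∣, the third makes the bound strict.
  3ℚ : ℚ
  3ℚ = 1ℚ ℚ.+ 1ℚ ℚ.+ 1ℚ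

  ≼⇒≺ : ∀ z e → z ≼ρ^ e → z ≺ 3ℚ ℚ.* ρ ^ℚ e
  ≼⇒≺ z e (N , z≤) = bound (ρ ^ℚ e ℚ.+ ρ ^ℚ e) 2ρ<3ρ N λ n N≤n →
    ∥∥≤2σ (seq (re z) n) (seq (im z) n) (ℚ.<⇒≤ (0<ρ^ e)) (z≤ n N≤n)
    where
    2ρ<3ρ : ρ ^ℚ e ℚ.+ ρ ^ℚ e ℚ.< 3ℚ ℚ.* ρ ^ℚ e
    2ρ<3ρ = ≡.subst₂ ℚ._<_ (ℚ.+-identityʳ (ρ ^ℚ e ℚ.+ ρ ^ℚ e))
      (Q.solve 1 (λ x → x Q.:+ x Q.:+ x Q.:= (Q.con 1ℚ Q.:+ Q.con 1ℚ Q.:+ Q.con 1ℚ) Q.:* x) ≡.refl (ρ ^ℚ e))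
      (ℚ.+-monoʳ-< (ρ ^ℚ e ℚ.+ ρ ^ℚ e) (0<ρ^ e))

  -- Here ∣1 - w∣² ≥ (1 - Re w)² ≥ (1 - ρ)². The witness depends on ρ alone, so it is common to all
  -- factors of the products.
  1-#0 : ∀ w → w ≼ρ^ 1 → (1ℂ - w) #0
  1-#0 w (N , w≤) = (1ℚ ℚ.- ρ) ℚ.* (1ℚ ℚ.- ρ) , *-pos 0<1-ρ 0<1-ρ , N , λ n N≤n →
    let a = seq (re w) n
        b = seq (im w) n
        1-ρ≤1-a = ℚ.+-monoʳ-≤ 1ℚ (ℚ.neg-antimono-≤ (a≤ρ n N≤n))
    in begin
      0ℚ ℚ.+ (1ℚ ℚ.- ρ) ℚ.* (1ℚ ℚ.- ρ)      ≡⟨ ℚ.+-identityˡ ((1ℚ ℚ.- ρ) ℚ.* (1ℚ ℚ.- ρ)) ⟩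
      (1ℚ ℚ.- ρ) ℚ.* (1ℚ ℚ.- ρ)             ≤⟨ *-mono-≤ {1ℚ ℚ.- ρ} {1ℚ ℚ.- ρ} {1ℚ ℚ.- a} {1ℚ ℚ.- a} (ℚ.<⇒≤ 0<1-ρ)
                                                 (ℚ.≤-trans (ℚ.<⇒≤ 0<1-ρ) 1-ρ≤1-a) 1-ρ≤1-a 1-ρ≤1-a ⟩
      (1ℚ ℚ.- a) ℚ.* (1ℚ ℚ.- a)             ≤⟨ a≤a+b ((1ℚ ℚ.- a) ℚ.* (1ℚ ℚ.- a)) (0≤a*a (0ℚ ℚ.- b)) ⟩
      ∣ 1ℂ - w ∣² n                         ∎
    where
    open ℚ.≤-Reasoning
    a≤ρ : ∀ n → N ℕ.≤ n → seq (re w) n ℚ.≤ ρ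
    a≤ρ n N≤n = a*a≤b*b⇒a≤b (ℚ.<⇒≤ 0<ρ) (ℚ.≤-trans (a≤a+b (seq (re w) n ℚ.* seq (re w) n) (0≤a*a (seq (im w) n)))
      (ℚ.≤-trans (w≤ n N≤n) (ℚ.≤-reflexive (≡.cong₂ ℚ._*_ (ℚ.*-identityʳ ρ) (ℚ.*-identityʳ ρ)))))

-- Transfer to the complex numbers

module Transfer where

  open ℂRing
  open Inverses
  module C = CommutativeRing ℂ-commutativeRing
  open FiniteSums ℂ-commutativeRing using (∏; poch) public
  open RawSemiringDefinitions (Semiring.rawSemiring C.semiring) public using ()
    renaming (_^_ to _^ᶜ_; sum to sumᶜ)

  factor : ℂ → ℂ → ℕ → ℂ
  factor x y i = 1ℂ - x * y ^ i

  -- Pointwise reflexivity compares rational numbers only.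
  opaque
    unfolding _≋_

    ^-suc : ∀ (z : ℂ) (n : ℕ) → z ^ suc n ≋ z ⊗ z ^ n
    ^-suc z n = ≈-pointwise (z ^ suc n) (z * z ^ n) (λ _ → ≡.refl) (λ _ → ≡.refl)

    product-suc : ∀ (n : ℕ) (f : ℕ → ℂ) →
      product {suc n} (λ j → f (toℕ j)) ≋ f 0 ⊗ product {n} (λ j → f (suc (toℕ j)))
    product-suc n f = ≈-pointwise (product {suc n} (λ j → f (toℕ j)))
      (f 0 * product {n} (λ j → f (suc (toℕ j)))) (λ _ → ≡.refl) (λ _ → ≡.refl)

    sum-suc : ∀ (n : ℕ) (f : ℕ → ℂ) →
      sum {suc n} (λ j → f (toℕ j)) ≋ f 0 ⊕ sum {n} (λ j → f (suc (toℕ j)))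
    sum-suc n f = ≈-pointwise (sum {suc n} (λ j → f (toℕ j)))
      (f 0 + sum {n} (λ j → f (suc (toℕ j)))) (λ _ → ≡.refl) (λ _ → ≡.refl)

    -≋⊕⊖ : ∀ (z w : ℂ) → z - w ≋ z ⊕ ⊖ w
    -≋⊕⊖ z w = ≈-pointwise (z - w) (z + (- w)) (λ _ → ≡.refl) (λ _ → ≡.refl)

    /≋⊗ : ∀ (z w : ℂ) (w#0 : w #0) → z / w [ w#0 ] ≋ z ⊗ inverse w w#0
    /≋⊗ z w w#0 = ≈-pointwise (z / w [ w#0 ]) (z * inverse w w#0) (λ _ → ≡.refl) (λ _ → ≡.refl)

    factor-unfold : ∀ (x y : ℂ) (i : ℕ) → factor x y i ≋ 𝟙 ⊕ ⊖ (x ⊗ y ^ i)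
    factor-unfold x y i = ≈-pointwise (factor x y i) (1ℂ + - (x * y ^ i)) (λ _ → ≡.refl) (λ _ → ≡.refl)

  ^≋ : ∀ (z : ℂ) {z′ : ℂ} → z ≋ z′ → ∀ (n : ℕ) → z ^ n ≋ z′ ^ᶜ n
  ^≋ z z≋ zero    = 1≋𝟙
  ^≋ z z≋ (suc n) = C.trans (^-suc z n) (C.*-cong z≋ (^≋ z z≋ n))

  product≋ : ∀ (n : ℕ) (f g : ℕ → ℂ) → (∀ i → f i ≋ g i) → product {n} (λ j → f (toℕ j)) ≋ ∏ n g
  product≋ zero    f g f≋g = 1≋𝟙
  product≋ (suc n) f g f≋g = C.trans (product-suc n f)
    (C.*-cong (f≋g 0) (product≋ n (λ i → f (suc i)) (λ i → g (suc i)) (λ i → f≋g (suc i))))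

  sum≋ : ∀ (n : ℕ) (f : ℕ → ℂ) → sum {n} (λ j → f (toℕ j)) ≋ sumᶜ {n} (λ j → f (toℕ j))
  sum≋ zero    f = 0≋𝟘
  sum≋ (suc n) f = C.trans (sum-suc n f) (C.+-congˡ (sum≋ n (λ i → f (suc i))))

  factor≋ : ∀ (x y : ℂ) {x′ y′ : ℂ} → x ≋ x′ → y ≋ y′ → ∀ (i : ℕ) → factor x y i ≋ 𝟙 ⊕ ⊖ (x′ ⊗ y′ ^ᶜ i)
  factor≋ x y x≋ y≋ i = C.trans (factor-unfold x y i)
    (C.+-congˡ (C.-‿cong (C.*-cong x≋ (^≋ y y≋ i))))

  poch≋ : ∀ (x y : ℂ) {x′ y′ : ℂ} → x ≋ x′ → y ≋ y′ → ∀ (n : ℕ) → [ x ⨾ y ] n ≋ poch x′ y′ n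
  poch≋ x y {x′} {y′} x≋ y≋ n =
    product≋ n (factor x y) (λ i → 𝟙 ⊕ ⊖ (x′ ⊗ y′ ^ᶜ i)) (factor≋ x y x≋ y≋)

-- Agda unfolds ^, which Defs copies from a library module, in terms but not in type
-- signatures; the powers are therefore kept abstract until the last step.
Claim : ℂ → (ℕ → ℂ) → (ℂ → ℂ) → Set
Claim q pow square =
  Σ[ den#0 ∈ ((n : ℕ) → ([ - q ⨾ pow 2 ] n * [ pow 4 ⨾ pow 4 ] n) #0) ]
  ∃[ A ] ∃[ B ] ∃[ C ]
  ([ pow 3 ⨾ pow 6 ]∞≈ A) × ([ pow 6 ⨾ pow 6 ]∞≈ B) × ([ pow 2 ⨾ pow 2 ]∞≈ C) ×
  (Σ[ C#0 ∈ C #0 ]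
  (λ n → (pow (2 ℕ.* n ℕ.^ 2) * [ q ⨾ pow 2 ] n)
  / ([ - q ⨾ pow 2 ] n * [ pow 4 ⨾ pow 4 ] n) [ den#0 n ])
  sumsTo ((square A * B) / C [ C#0 ]))

-- As a record over its arguments, the claim can be transported along equations between them without
-- comparing two unfolded claims.
record Instance {A B : Set} (P : A → B → Set) (a : A) (b : B) : Set where
  constructor instantiate
  field
    proof : P a b

open ℂRing using (_≋_; _⊗_)
open Transfer using (_^ᶜ_)

-- The theorem for a fixed q

module Conclusion (q : ℂ) (ρ : ℚ) (0<ρ : 0ℚ ℚ.< ρ) (ρ<1 : ρ ℚ.< 1ℚ)
  (q≼ρ : Moduli._≼ρ^_ ρ 0<ρ ρ<1 q 1)
  (pow : ℕ → ℂ) (pow≋ : ∀ (n : ℕ) → pow n ≋ q ^ᶜ n)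
  (pow≼ : ∀ (n : ℕ) → Moduli._≼ρ^_ ρ 0<ρ ρ<1 (pow n) n)
  (square : ℂ → ℂ) (square≋ : ∀ (z : ℂ) → square z ≋ z ⊗ z)
  where

  open ℂRing
  open Transfer
  open Moduli ρ 0<ρ ρ<1
  open ℓ¹Norm
  open Inverses
  open Completeness ρ 0<ρ ρ<1 using (norm)
  open Asymptotics ℂ-commutativeRing ρ 0<ρ ρ<1 norm using (O; mkO)
  open ℚPowers ρ 0<ρ ρ<1 renaming (_^_ to _^ℚ_) hiding (*-monoʳ-≤; *-monoˡ-≤)

  O⇒⟶ : ∀ (s : ℕ → ℂ) {s′ : ℕ → ℂ} {l : ℂ} → (∀ (n : ℕ) → s n ≋ s′ n) → O (λ n → n) (λ n → s′ n ⊕ ⊖ l) → s ⟶ l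
  O⇒⟶ s {s′} {l} s≋ (mkO K 0<K s≺) ε 0<ε =
    let N , small = ρ^-small K ε 0<K 0<ε
    in N , λ n N≤n → ≺⇒∣∣< {s n - l} {ε} (≺-weaken (small n N≤n)
      (≺-resp-≈ (C.sym (C.trans (-≋⊕⊖ (s n) l) (C.+-congʳ (s≋ n)))) (s≺ n)))

  pow-suc≼ : ∀ (c : ℕ) → pow (suc c) ≼ρ^ 1
  pow-suc≼ c = ≼-mono (pow (suc c)) {1} {suc c} (ℕ.s≤s ℕ.z≤n) (pow≼ (suc c))

  factor#0 : ∀ (x y : ℂ) → x ≼ρ^ 1 → y ≼ρ^ 1 → ∀ (n : ℕ) → factor x y n #0
  factor#0 x y x≼ y≼ n = 1-#0 (x * y ^ n)
    (≼-mono (x * y ^ n) {1} {1 ℕ.+ n ℕ.* 1} (ℕ.m≤m+n 1 (n ℕ.* 1)) (*≼ x (y ^ n) 1 (n ℕ.* 1) x≼ (^≼ y 1 y≼ n)))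

  poch#0 : ∀ (x y : ℂ) → x ≼ρ^ 1 → y ≼ρ^ 1 → ∀ (n : ℕ) → [ x ⨾ y ] n #0
  poch#0 x y x≼ y≼ n = #0-product n (factor x y) (factor#0 x y x≼ y≼)

  den#0 : ∀ (n : ℕ) → ([ - q ⨾ pow 2 ] n * [ pow 4 ⨾ pow 4 ] n) #0
  den#0 n = #0-* ([ - q ⨾ pow 2 ] n) ([ pow 4 ⨾ pow 4 ] n)
    (poch#0 (- q) (pow 2) (-≼ q 1 q≼ρ) (pow-suc≼ 1) n) (poch#0 (pow 4) (pow 4) (pow-suc≼ 3) (pow-suc≼ 3) n)

  e : ℕ → ℕ → ℂ
  e c n = factor (pow (suc c)) (pow (suc c)) n

  e#0 : ∀ (c n : ℕ) → e c n #0
  e#0 c n = factor#0 (pow (suc c)) (pow (suc c)) (pow-suc≼ c) (pow-suc≼ c) n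

  v : ℕ → ℕ → ℂ
  v c n = inverse (e c n) (e#0 c n)

  ⊗-inverse : ∀ (z : ℂ) (z#0 : z #0) → z ⊗ inverse z z#0 ≋ 𝟙
  ⊗-inverse z z#0 = C.trans (C.sym (*≋⊗ z (inverse z z#0))) (C.trans (≈⇒≋ (*-inverse z z#0)) 1≋𝟙)

  v-inverse : ∀ (c n : ℕ) → (𝟙 ⊕ ⊖ (q ^ᶜ suc c ⊗ (q ^ᶜ suc c) ^ᶜ n)) ⊗ v c n ≋ 𝟙
  v-inverse c n = C.trans
    (C.*-congʳ (C.sym (factor≋ (pow (suc c)) (pow (suc c)) (pow≋ (suc c)) (pow≋ (suc c)) n)))
    (⊗-inverse (e c n) (e#0 c n))

  v-bounded : ∀ (c : ℕ) → O (λ _ → 0) (v c)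
  v-bounded c = mkO K 0<K λ n → ≺-weaken (ℚ.≤-reflexive (≡.sym (ℚ.*-identityʳ K)))
    (inverse-≺ (e c n) (e#0 c n) (e≺ n))
    where
    -- The first factor bounds ∥1 - x yⁿ∥ by 1 + ∥x∥ ∥yⁿ∥; the second is the reciprocal of the lower
    -- bound (1 - ρ)² that `1-#0` provides for every n.
    K : ℚ
    K = (1ℚ ℚ.+ 3ℚ ℚ.* ρ ^ℚ 1 ℚ.* (3ℚ ℚ.* ρ ^ℚ 0)) ℚ.* recip ((1ℚ ℚ.- ρ) ℚ.* (1ℚ ℚ.- ρ))
    0<K : 0ℚ ℚ.< K
    0<K = *-pos
      (ℚ.+-mono-< (ℚ.positive⁻¹ 1ℚ)
        (*-pos (*-pos (ℚ.positive⁻¹ 3ℚ) (0<ρ^ 1)) (*-pos (ℚ.positive⁻¹ 3ℚ) (0<ρ^ 0))))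
      (recip-pos (*-pos 0<1-ρ 0<1-ρ))
    e≺ : ∀ (n : ℕ) → e c n ≺ 1ℚ ℚ.+ 3ℚ ℚ.* ρ ^ℚ 1 ℚ.* (3ℚ ℚ.* ρ ^ℚ 0)
    e≺ n = ≺-resp-≈ (C.sym (factor-unfold (pow (suc c)) (pow (suc c)) n))
      (1+≺ (-≺ (*≺ (≼⇒≺ (pow (suc c)) 1 (pow-suc≼ c))
        (≼⇒≺ (pow (suc c) ^ n) 0
          (≼-mono (pow (suc c) ^ n) {0} {n ℕ.* 1} ℕ.z≤n (^≼ (pow (suc c)) 1 (pow-suc≼ c) n))))))

  q^-small : O (λ n → n) (q ^ᶜ_)
  q^-small = mkO 3ℚ (ℚ.positive⁻¹ 3ℚ) λ n → ≺-resp-≈ (pow≋ n) (≼⇒≺ (pow n) n (pow≼ n))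

  open Limits ℂ-commutativeRing ρ 0<ρ ρ<1 norm using (module Identity; module EulerProduct)
  open Identity q q^-small (v 1) (v-inverse 1) (v-bounded 1) (v 5) (v-inverse 5) (v-bounded 5)

  open EulerProduct (q ^ᶜ 2) (powers-small′ 2) (v 1) (v-inverse 1) (v-bounded 1)
    using (P∞; I∞; P→P∞; P∞*I∞≈1)

  A∞ B∞ C∞ C∞⁻¹ : ℂ
  A∞   = A
  B∞   = B
  C∞   = P∞
  C∞⁻¹ = I∞

  A→A∞ : O (λ n → n) (λ n → poch (q ^ᶜ 3) (q ^ᶜ 6) n ⊕ ⊖ A∞)
  A→A∞ = proj₂ X₆.poch-limit

  B→B∞ : O (λ n → n) (λ n → poch (q ^ᶜ 6) (q ^ᶜ 6) n ⊕ ⊖ B∞)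
  B→B∞ = E₆.P→P∞

  C→C∞ : O (λ n → n) (λ n → poch (q ^ᶜ 2) (q ^ᶜ 2) n ⊕ ⊖ C∞)
  C→C∞ = P→P∞

  C*C⁻¹≋𝟙 : C∞ ⊗ C∞⁻¹ ≋ 𝟙
  C*C⁻¹≋𝟙 = P∞*I∞≈1

  -- Apartness from zero is not inherited by a limit of products. It comes from the limit of the
  -- reciprocal products, which is an inverse of `C∞`.
  C∞#0 : C∞ #0
  C∞#0 = #0-unit C∞ C∞⁻¹ (≋⇒≈ (C.trans (*≋⊗ C∞ C∞⁻¹) (C.trans C*C⁻¹≋𝟙 (C.sym 1≋𝟙))))

  den⁻¹ : ℕ → ℂ
  den⁻¹ n = inverse ([ - q ⨾ pow 2 ] n * [ pow 4 ⨾ pow 4 ] n) (den#0 n)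

  den≋ : ∀ (n : ℕ) → [ - q ⨾ pow 2 ] n * [ pow 4 ⨾ pow 4 ] n ≋ poch (⊖ q) (q ^ᶜ 2) n ⊗ poch (q ^ᶜ 4) (q ^ᶜ 4) n
  den≋ n = C.trans (*≋⊗ ([ - q ⨾ pow 2 ] n) ([ pow 4 ⨾ pow 4 ] n))
    (C.*-cong (poch≋ (- q) (pow 2) (-≋⊖ q) (pow≋ 2) n) (poch≋ (pow 4) (pow 4) (pow≋ 4) (pow≋ 4) n))

  den-inverse : ∀ (n : ℕ) → (poch (⊖ q) (q ^ᶜ 2) n ⊗ poch (q ^ᶜ 4) (q ^ᶜ 4) n) ⊗ den⁻¹ n ≋ 𝟙
  den-inverse n = C.trans (C.*-congʳ (C.sym (den≋ n)))
    (⊗-inverse ([ - q ⨾ pow 2 ] n * [ pow 4 ⨾ pow 4 ] n) (den#0 n))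

  inverse-unique : ∀ (z u w : ℂ) → z ⊗ u ≋ 𝟙 → z ⊗ w ≋ 𝟙 → u ≋ w
  inverse-unique z u w zu≋1 zw≋1 = begin
    u              ≈⟨ C.*-identityʳ u ⟨
    u ⊗ 𝟙          ≈⟨ C.*-congˡ zw≋1 ⟨
    u ⊗ (z ⊗ w)    ≈⟨ C.*-assoc u z w ⟨
    u ⊗ z ⊗ w      ≈⟨ C.*-congʳ (C.*-comm u z) ⟩
    z ⊗ u ⊗ w      ≈⟨ C.*-congʳ zu≋1 ⟩
    𝟙 ⊗ w          ≈⟨ C.*-identityˡ w ⟩
    w              ∎
    where open SetoidReasoning C.setoid

  inverse-C∞≋C∞⁻¹ : inverse C∞ C∞#0 ≋ C∞⁻¹
  inverse-C∞≋C∞⁻¹ = inverse-unique C∞ (inverse C∞ C∞#0) C∞⁻¹ (⊗-inverse C∞ C∞#0) C*C⁻¹≋𝟙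

  limit≋ : (square A∞ * B∞) / C∞ [ C∞#0 ] ≋ A∞ ⊗ A∞ ⊗ B∞ ⊗ C∞⁻¹
  limit≋ = C.trans (/≋⊗ (square A∞ * B∞) C∞ C∞#0)
    (C.*-cong (C.trans (*≋⊗ (square A∞) B∞) (C.*-congʳ (square≋ A∞))) inverse-C∞≋C∞⁻¹)

  term : ℕ → ℂ
  term n = (pow (2 ℕ.* n ℕ.^ 2) * [ q ⨾ pow 2 ] n) / ([ - q ⨾ pow 2 ] n * [ pow 4 ⨾ pow 4 ] n) [ den#0 n ]

  term≋ : ∀ (n : ℕ) → term n ≋ q ^ᶜ (2 ℕ.* n ℕ.^ 2) ⊗ poch q (q ^ᶜ 2) n ⊗ den⁻¹ n
  term≋ n = C.trans
    (/≋⊗ (pow (2 ℕ.* n ℕ.^ 2) * [ q ⨾ pow 2 ] n) ([ - q ⨾ pow 2 ] n * [ pow 4 ⨾ pow 4 ] n) (den#0 n))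
    (C.*-congʳ (C.trans (*≋⊗ (pow (2 ℕ.* n ℕ.^ 2)) ([ q ⨾ pow 2 ] n))
      (C.*-cong (pow≋ (2 ℕ.* n ℕ.^ 2)) (poch≋ q (pow 2) C.refl (pow≋ 2) n))))

  term-limit : term sumsTo ((square A∞ * B∞) / C∞ [ C∞#0 ])
  term-limit ε 0<ε = shift
    (series-limit term λ n → C.trans (term≋ n) (summand n (den⁻¹ n) (den-inverse n)))
    where
    shift : O (λ n → n) (λ n → sumᶜ {suc n} (λ j → term (toℕ j)) ⊕ ⊖ (A∞ ⊗ A∞ ⊗ B∞ ⊗ C∞⁻¹)) →
      ∃[ N ] ∀ n → N ℕ.≤ n → ∣ sum {n} (λ j → term (toℕ j)) - ((square A∞ * B∞) / C∞ [ C∞#0 ]) ∣< ε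
    -- The estimate at n concerns the sum of n + 1 terms, hence the threshold `suc N`.
    shift (mkO K 0<K s≺) = let N , small = ρ^-small K ε 0<K 0<ε in suc N , λ where
      (suc n) (ℕ.s≤s N≤n) → ≺⇒∣∣< {sum {suc n} (λ j → term (toℕ j)) - ((square A∞ * B∞) / C∞ [ C∞#0 ])} {ε}
        (≺-weaken (small n N≤n) (≺-resp-≈
          (C.sym (C.trans (-≋⊕⊖ (sum {suc n} (λ j → term (toℕ j))) ((square A∞ * B∞) / C∞ [ C∞#0 ]))
            (C.+-cong (sum≋ (suc n) term) (C.-‿cong limit≋)))) (s≺ n)))

  A-limit : [ pow 3 ⨾ pow 6 ]∞≈ A∞
  A-limit = O⇒⟶ [ pow 3 ⨾ pow 6 ] (poch≋ (pow 3) (pow 6) (pow≋ 3) (pow≋ 6)) A→A∞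

  B-limit : [ pow 6 ⨾ pow 6 ]∞≈ B∞
  B-limit = O⇒⟶ [ pow 6 ⨾ pow 6 ] (poch≋ (pow 6) (pow 6) (pow≋ 6) (pow≋ 6)) B→B∞

  C-limit : [ pow 2 ⨾ pow 2 ]∞≈ C∞
  C-limit = O⇒⟶ [ pow 2 ⨾ pow 2 ] (poch≋ (pow 2) (pow 2) (pow≋ 2) (pow≋ 2)) C→C∞

  claim : Claim q pow square
  claim = den#0 , A∞ , B∞ , C∞ , A-limit , B-limit , C-limit , C∞#0 , term-limit

-- From ∣q∣² + δ ≤ 1 follows ∣q∣² ≤ 1 - δ ≤ (1 - δ/2)², so ρ = 1 - δ/2 bounds ∣q∣ without a square
-- root. It is positive because δ ≤ 1.
modulus-bound : ∀ q → ∣ q ∣< 1ℚ → ∃[ ρ ] Σ[ 0<ρ ∈ 0ℚ ℚ.< ρ ] Σ[ ρ<1 ∈ ρ ℚ.< 1ℚ ] Moduli._≼ρ^_ ρ 0<ρ ρ<1 q 1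
modulus-bound q (δ , 0<δ , N , q≤) = ρ , 0<ρ , ρ<1 , N , λ n N≤n → begin
    sq (seq (re q) n) (seq (im q) n)
      ≡⟨ Q.solve 2 (λ x y → x Q.:= (x Q.:+ y) Q.:- y) ≡.refl (sq (seq (re q) n) (seq (im q) n)) δ ⟩
    sq (seq (re q) n) (seq (im q) n) ℚ.+ δ ℚ.- δ
      ≤⟨ ℚ.+-monoˡ-≤ (ℚ.- δ) (q≤ n N≤n) ⟩
    1ℚ ℚ.- δ
      ≤⟨ a≤a+b (1ℚ ℚ.- δ) (0≤a*a (half δ)) ⟩
    1ℚ ℚ.- δ ℚ.+ half δ ℚ.* half δ
      ≡⟨ ≡.cong (λ d → 1ℚ ℚ.- d ℚ.+ half δ ℚ.* half δ) (half+half δ) ⟨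
    1ℚ ℚ.- (half δ ℚ.+ half δ) ℚ.+ half δ ℚ.* half δ
      ≡⟨ Q.solve 1 (λ h → Q.con 1ℚ Q.:- (h Q.:+ h) Q.:+ h Q.:* h Q.:=
           (Q.con 1ℚ Q.:- h) Q.:* Q.con 1ℚ Q.:* ((Q.con 1ℚ Q.:- h) Q.:* Q.con 1ℚ)) ≡.refl (half δ) ⟩
    ρ ℚ.* 1ℚ ℚ.* (ρ ℚ.* 1ℚ)
      ∎
  where
  open ℚ.≤-Reasoning
  open ℓ¹Norm
  module Q = +-*-Solver
  ρ : ℚ
  ρ = 1ℚ ℚ.- half δ
  δ≤1 : δ ℚ.≤ 1ℚ
  δ≤1 = ℚ.≤-trans (b≤a+b δ (0≤sq (seq (re q) N) (seq (im q) N))) (q≤ N ℕ.≤-refl)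
  0<ρ : 0ℚ ℚ.< ρ
  0<ρ = 0<b-a (ℚ.<-≤-trans (half< 0<δ) δ≤1)
  ρ<1 : ρ ℚ.< 1ℚ
  ρ<1 = ≡.subst (ρ ℚ.<_) (ℚ.+-identityʳ 1ℚ) (ℚ.+-monoʳ-< 1ℚ (ℚ.neg-antimono-< (half-pos 0<δ)))

powers : ℂ → ℕ → ℂ
powers q n = q ^ n

square : ℂ → ℂ
square z = z ^ 2

powers≡ : (q : ℂ) → powers q ≡ (λ n → q ^ n)
powers≡ q = ≡.refl

square≡ : square ≡ (λ z → z ^ 2)
square≡ = ≡.refl

claim : (q : ℂ) → ∣ q ∣< 1ℚ → Instance (Claim q) (powers q) square
claim q ∣q∣<1 = let ρ , 0<ρ , ρ<1 , q≼ρ = modulus-bound q ∣q∣<1 in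
  instantiate (Conclusion.claim q ρ 0<ρ ρ<1 q≼ρ (powers q) (powers≋ q) (powers≼ ρ 0<ρ ρ<1 q≼ρ) square square≋)
  where
  open ℂRing
  open Transfer
  powers≋ : ∀ (q : ℂ) (n : ℕ) → powers q n ≋ q ^ᶜ n
  powers≋ q = ^≋ q C.refl
  square≋ : ∀ (z : ℂ) → square z ≋ z ⊗ z
  square≋ z = C.trans (^≋ z C.refl 2) (C.*-congˡ (C.*-identityʳ z))
  powers≼ : ∀ ρ 0<ρ ρ<1 → Moduli._≼ρ^_ ρ 0<ρ ρ<1 q 1 → ∀ (n : ℕ) → Moduli._≼ρ^_ ρ 0<ρ ρ<1 (powers q n) n
  powers≼ ρ 0<ρ ρ<1 q≼ρ n = ≼-mono (powers q n) {n} {n ℕ.* 1}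
    (ℕ.≤-reflexive (≡.sym (ℕ.*-identityʳ n))) (^≼ q 1 q≼ρ n)
    where open Moduli ρ 0<ρ ρ<1

claim′ : (q : ℂ) → ∣ q ∣< 1ℚ → Instance (Claim q) (λ n → q ^ n) (λ z → z ^ 2)
claim′ q ∣q∣<1 = ≡.subst₂ (Instance (Claim q)) (powers≡ q) square≡ (claim q ∣q∣<1)

theorem2p4 : (q : ℂ) → ∣ q ∣< 1ℚ →
    Σ[ den#0 ∈ ((n : ℕ) → ([ - q ⨾ q ^ 2 ] n * [ q ^ 4 ⨾ q ^ 4 ] n) #0) ]
    ∃[ A ] ∃[ B ] ∃[ C ]
    ([ q ^ 3 ⨾ q ^ 6 ]∞≈ A) × ([ q ^ 6 ⨾ q ^ 6 ]∞≈ B) × ([ q ^ 2 ⨾ q ^ 2 ]∞≈ C) ×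
    (Σ[ C#0 ∈ C #0 ]
    (λ n → (q ^ (2 ℕ.* n ℕ.^ 2) * [ q ⨾ q ^ 2 ] n)
    / ([ - q ⨾ q ^ 2 ] n * [ q ^ 4 ⨾ q ^ 4 ] n) [ den#0 n ])
    sumsTo ((A ^ 2 * B) / C [ C#0 ]))
theorem2p4 q ∣q∣<1 = Instance.proof (claim′ q ∣q∣<1)
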